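{- Let $p$ be a prime number, $n$ a positive integer and $Q\in\mathbb{Z}[X_1,\dots,X_n]$ a nonsingular quadratic form. Then the set $R(Q(\mathbb{Z}^n))$ is dense in $\mathbb{Q}_p$ (with respect to the $p$-adic topology) if and only if either $n\geq 3$, or $n=2$ and $Q=aX_1^2+bX_1X_2+cX_2^2$ with $a,b,c\in\mathbb{Z}$ such that $2\mid\nu_p(b^2-4ac)$ and \begin{itemize} \item if $p>2$: $\left(\frac{p^{ -\nu_p(b^2-4ac)}(b^2-4ac)}{p}\right)=1$ (Legendre symbol), \item if $p=2$: $p^{ -\nu_p(b^2-4ac)}(b^2-4ac)\equiv 1\pmod{8}$. \end{itemize}
   Context: A quadratic form over a ring $\mathcal{R}$ is a homogeneous polynomial of degree two with coefficients in $\mathcal{R}$, not all zero. Writing $Q=\sum_{1\le i,j\le n}a_{ij}X_iX_j$ with $a_{ij}=a_{ji}$, $Q$ is nonsingular if $\det[a_{ij}]\neq 0$. For a subset $A$ of a field, its quotient set is $R(A)=\{a/b: a,b\in A,\ b\neq 0\}$. $\nu_p$ denotes the $p$-adic valuation, and $Q(\mathbb{Z}^n)=\{Q(\mathbf{x}):\mathbf{x}\in\mathbb{Z}^n\}$. -}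

module Defs where

open import Data.Bool.Base using (if_then_else_)
open import Data.Fin.Base as Fin using (Fin; zero; suc; toℕ; punchIn)
open import Data.Fin.Properties as Finₚ using (any?)
open import Data.Integer.Base as ℤ using (ℤ; +_; ∣_∣; 0ℤ; 1ℤ; -1ℤ)
open import Data.Integer.Divisibility.Signed as ℤ∣ using ()
open import Data.Integer.Properties as ℤₚ using ()
open import Data.Nat.Base as ℕ using (ℕ; zero; suc)
open import Data.Nat.Divisibility as ℕ∣ using ()
open import Data.Nat.Primality using (Prime; prime⇒nonZero)
open import Data.Nat.Properties as ℕₚ using ()
open import Data.Product.Base using (∃-syntax; Σ-syntax; _×_; _,_)
open import Data.Rational.Base as ℚ using (ℚ; 0ℚ; 1ℚ; ↥_; ↧ₙ_)
open import Data.Rational.Properties as ℚProp using ()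
open import Algebra.Bundles using (CommutativeRing)
open import Algebra.Properties.Semiring.Sum
  (CommutativeRing.semiring ℤₚ.+-*-commutativeRing)
  using () renaming (sum to sumℤ)
open import Algebra.Properties.Semiring.Sum
  (CommutativeRing.semiring ℚProp.+-*-commutativeRing)
  using () renaming (sum to sumℚ)
open import Algebra.Properties.Semiring.Exp
  (CommutativeRing.semiring ℚProp.+-*-commutativeRing)
  using () renaming (_^_ to _^ℚ_)
open import Level using (0ℓ)
open import Relation.Binary.Construct.Add.Supremum.NonStrict ℤ._≤_ using (_≤⁺_; _≤⊤⁺)
open import Relation.Binary.Definitions using (tri<; tri≈; tri>)
open import Relation.Binary.PropositionalEquality.Core using (_≡_; _≢_; subst; sym)
open import Relation.Nullary.Construct.Add.Supremum using (_⁺; ⊤⁺; [_])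
open import Relation.Nullary.Decidable.Core using (yes; no; does)
open import Relation.Unary using (Pred; _∈_)

------------------------------------------------------------------------
-- Quadratic forms over ℤ

-- Homogeneous polynomials of degree two in n variables: one coefficient for
-- each monomial XᵢXⱼ with i ≤ j.
Homogeneous₂ : ℕ → Set
Homogeneous₂ n = (i j : Fin n) → .(i Fin.≤ j) → ℤ

infix 4 _≐_

_≐_ : ∀ {n} → Homogeneous₂ n → Homogeneous₂ n → Set
P ≐ Q = ∀ i j .(i≤j : i Fin.≤ j) → P i j i≤j ≡ Q i j i≤j

record QuadraticForm (n : ℕ) : Set where
  field
    coeff    : Homogeneous₂ n
    not-zero : ∃[ i ] ∃[ j ] Σ[ i≤j ∈ i Fin.≤ j ] coeff i j i≤j ≢ 0ℤ

open QuadraticForm public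

⟦_⟧ : ∀ {n} → Homogeneous₂ n → (Fin n → ℤ) → ℤ
⟦_⟧ {n} P x = sumℤ λ i → sumℤ λ j → term i j
  where
  term : Fin n → Fin n → ℤ
  term i j with i Finₚ.≤? j
  ... | yes i≤j = P i j i≤j ℤ.* x i ℤ.* x j
  ... | no  _   = 0ℤ

aX₁²+bX₁X₂+cX₂² : (a b c : ℤ) → Homogeneous₂ 2
aX₁²+bX₁X₂+cX₂² a b c zero       zero       _ = a
aX₁²+bX₁X₂+cX₂² a b c zero       (suc zero) _ = b
aX₁²+bX₁X₂+cX₂² a b c (suc zero) (suc zero) _ = c

Matrix : ℕ → Set
Matrix n = Fin n → Fin n → ℚ

-- Laplace expansion along the first row.
det : ∀ {n} → Matrix n → ℚ
det {zero}  M = 1ℚ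
det {suc n} M = sumℚ λ j →
  ((ℚ.- 1ℚ) ^ℚ toℕ j) ℚ.* M zero j ℚ.* det (λ i k → M (suc i) (punchIn j k))

-- The symmetric matrix [aᵢⱼ] with P = Σ aᵢⱼXᵢXⱼ over all i and j; its entries
-- off the diagonal are half the coefficients of P, hence lie in ℚ.
gram : ∀ {n} → Homogeneous₂ n → Matrix n
gram P i j with Finₚ.<-cmp i j
... | tri< i<j _ _ = P i j (ℕₚ.<⇒≤ i<j) ℚ./ 2
... | tri≈ _ _ _   = P i i ℕₚ.≤-refl ℚ./ 1
... | tri> _ _ j<i = P j i (ℕₚ.<⇒≤ j<i) ℚ./ 2

Nonsingular : ∀ {n} → QuadraticForm n → Set
Nonsingular Q = det (gram (coeff Q)) ≢ 0ℚ

-- Q(ℤⁿ), as a subset of ℚ.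
Values : ∀ {n} → QuadraticForm n → Pred ℚ 0ℓ
Values Q q = ∃[ x ] q ≡ ⟦ coeff Q ⟧ x ℚ./ 1

-- The quotient set.
R : Pred ℚ 0ℓ → Pred ℚ 0ℓ
R A q = ∃[ a ] ∃[ b ] a ∈ A × b ∈ A ×
  (Σ[ b≢0 ∈ ℚ.NonZero b ] q ≡ (a ℚ.÷ b) {{b≢0}})

------------------------------------------------------------------------
-- p-adic valuation

-- The largest e ≤ k such that p ^ e divides m.
maxExponent : (p m k : ℕ) → ℕ
maxExponent p m zero    = 0
maxExponent p m (suc k) =
  if does (p ℕ.^ suc k ℕ∣.∣? m) then suc k else maxExponent p m k

-- The valuation of a nonzero integer. Bounding the exponent by ∣ z ∣ loses
-- nothing for p ≥ 2, since p ^ e > e. The value 0 at z = 0 is a convention.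
νℤ : ℕ → ℤ → ℕ
νℤ p z = maxExponent p ∣ z ∣ ∣ z ∣

-- The valuation on ℚ, with ν 0 = ⊤⁺ (infinity).
ν : ℕ → ℚ → ℤ ⁺
ν p q with q ℚProp.≟ 0ℚ
... | yes _ = ⊤⁺
... | no  _ = [ + νℤ p (↥ q) ℤ.- + νℤ p (+ (↧ₙ q)) ]

-- p ^ (- ν z) * z; the division is exact.
unitPart : ∀ {p} → Prime p → ℤ → ℤ
unitPart {p} p-prime z = (z ℤ./ℕ (p ℕ.^ νℤ p z)) {{p^ν≢0}}
  where
  p^ν≢0 : ℕ.NonZero (p ℕ.^ νℤ p z)
  p^ν≢0 = ℕₚ.m^n≢0 p (νℤ p z) {{prime⇒nonZero p-prime}}

-- The Legendre symbol (z / p), for p an odd prime.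
legendre : ℕ → ℤ → ℤ
legendre p z =
  if does (+ p ℤ∣.∣? z) then 0ℤ else
  if does (any? λ (x : Fin p) → + p ℤ∣.∣? (+ toℕ x ℤ.* + toℕ x ℤ.- z))
  then 1ℤ else -1ℤ

------------------------------------------------------------------------
-- The p-adic numbers, as the completion of ℚ

Cauchy : ℕ → (ℕ → ℚ) → Set
Cauchy p s = ∀ (k : ℤ) → ∃[ N ] ∀ m n → m ℕ.≥ N → n ℕ.≥ N →
  [ k ] ≤⁺ ν p (s m ℚ.- s n)

record ℚₚ (p : ℕ) : Set where
  field
    seq    : ℕ → ℚ
    cauchy : Cauchy p seq

open ℚₚ public

-- y lies in the ball { y | ν (x - y) ≥ k }. Elements of ℚₚ p are identified
-- when this holds for all k.
Close : ∀ {p} → ℤ → ℚₚ p → ℚₚ p → Set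
Close {p} k x y = ∃[ N ] ∀ m → m ℕ.≥ N → [ k ] ≤⁺ ν p (seq x m ℚ.- seq y m)

ι : ∀ {p} → ℚ → ℚₚ p
ι {p} q .seq    _ = q
ι {p} q .cauchy k = 0 , λ _ _ _ _ → k≤ν[q-q]
  where
  k≤ν[q-q] : [ k ] ≤⁺ ν p (q ℚ.- q)
  k≤ν[q-q] = subst (λ r → [ k ] ≤⁺ ν p r) (sym (ℚProp.+-inverseʳ q)) ([ k ] ≤⊤⁺)

-- Density in ℚₚ p of the image of a subset of ℚ: every ball meets it.
Dense : ℕ → Pred ℚ 0ℓ → Set
Dense p A = ∀ (x : ℚₚ p) (k : ℤ) → ∃[ q ] q ∈ A × Close k x (ι q)

-- For n ≥ 3, completing the square reduces Q over ℚ to a ternary form, and modulo squares to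
-- ⟨1,u,w⟩ or ⟨1,u,pw⟩ with p-adic units u, w. An approximation of r by quotients of values is
-- found as soon as r Q(x) Q(y) is a p-adic square, and by Hensel's lemma this is a question
-- modulo p (pigeonhole) or modulo 8 and 16 (finitely many cases); when x² + uy² represents -w the
-- form contains a hyperbolic plane instead.
--
-- For n = 2, multiplying by Q(y)² shows that the quotients are the values U² - D V², with D the
-- discriminant. If D is a p-adic square this norm form is hyperbolic; if not, then once even
-- powers of p are removed from D, some r is not even modulo p³ of the form (u² - D v²) / z² with
-- u, v, z not all divisible by p. The latter also settles n = 1.

module Submission where

open import Defs
open import Data.Integer.Base using (ℤ; +_; 1ℤ; _+_; _*_; _-_)
open import Data.Integer.Divisibility.Signed using () renaming (_∣_ to _∣ℤ_)
open import Data.Nat.Base using (ℕ; _≥_; _>_)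
open import Data.Nat.Divisibility using (_∣_)
open import Data.Nat.Primality using (Prime)
open import Data.Product.Base using (Σ-syntax; ∃-syntax; _×_)
open import Data.Sum.Base using (_⊎_)
open import Function.Bundles using (_⇔_)
open import Relation.Binary.PropositionalEquality using (_≡_; subst)

open import Algebra.Bundles using (CommutativeRing)
open import Data.Bool.Base using (if_then_else_)
open import Data.Empty using (⊥; ⊥-elim)
open import Data.Fin.Base as Fin using (Fin; zero; suc; toℕ)
open import Data.Fin.Properties as Finₚ using ()
open import Data.Integer.Base as ℤ using (0ℤ; -1ℤ; -_; _^_; ∣_∣)
import Data.Integer.DivMod as ℤDM
open import Data.Integer.Divisibility.Signed as ℤ∣ using (divides)
open import Data.Integer.Properties as ℤₚ using ()
import Data.Integer.Tactic.RingSolver as ℤSolver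
open import Data.Nat.Base as ℕ using (zero; suc)
open import Data.Nat.Coprimality using (coprime-Bézout; prime⇒coprime)
open import Data.Nat.Divisibility as ℕ∣ using ()
open import Data.Nat.GCD using (module Bézout)
open import Data.Nat.Primality using (prime⇒nonZero; prime⇒nonTrivial; prime⇒irreducible; euclidsLemma)
open import Data.Nat.Properties as ℕₚ using ()
open import Data.Product.Base using (_,_; proj₁; proj₂)
open import Data.Rational.Base as ℚ using (ℚ; 0ℚ; 1ℚ; ½; ↥_; ↧_; ↧ₙ_)
  renaming (_+_ to _+ℚ_; _*_ to _*ℚ_; _-_ to _-ℚ_; -_ to -ℚ_)
open import Data.Rational.Properties as ℚProp using ()
open import Data.Rational.Unnormalised.Base as ℚᵘ using (mkℚᵘ; *≡*)
open import Data.Rational.Unnormalised.Properties as ℚᵘₚ using ()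
open import Data.Sum.Base using (inj₁; inj₂; [_,_]′)
open import Function.Base using (_∘_)
open import Function.Bundles using (mk⇔)
open import Level using (0ℓ)
open import Relation.Binary.Construct.Add.Supremum.NonStrict ℤ._≤_ using (_≤⁺_; _≤⊤⁺; [_])
open import Relation.Binary.Definitions using (tri<; tri≈; tri>)
open import Relation.Binary.PropositionalEquality
  using (_≢_; refl; sym; trans; cong; cong₂; subst₂; module ≡-Reasoning)
open import Relation.Nullary using (¬_; Dec; yes; no; contradiction)
open import Relation.Nullary.Construct.Add.Supremum using ([_])
open import Relation.Nullary.Decidable using (dec⇒maybe; toWitness; _×-dec_; _⊎-dec_; _→-dec_; ¬?; decidable-stable)
open import Relation.Nullary.Decidable.Core using (does)
open import Tactic.RingSolver using (solve-∀)
open import Tactic.RingSolver.Core.AlmostCommutativeRing using (AlmostCommutativeRing; fromCommutativeRing)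
open import Algebra.Properties.Semiring.Sum (CommutativeRing.semiring ℚProp.+-*-commutativeRing)
  using (sum-cong-≗; sum-replicate-zero; *-distribˡ-sum; ∑-distrib-+; ∑-comm) renaming (sum to sumℚ)
open import Algebra.Properties.Semiring.Sum (CommutativeRing.semiring ℤₚ.+-*-commutativeRing)
  using () renaming (sum to sumℤ)
open import Algebra.Properties.Semiring.Exp (CommutativeRing.semiring ℚProp.+-*-commutativeRing)
  using () renaming (_^_ to _^ℚ_)

-- No p-adic limit is ever formed. Neighbourhoods of 0 are the sets p^k ℤ_(p) of rationals, and a
-- p-adic square is a rational that rational squares approximate to every precision. Density is
-- tested at rational points only, since these approximate every element of ℚₚ. Forms are evaluated
-- at rational vectors; clearing denominators multiplies both values in a quotient by the same
-- square.
--
-- If r Q(x) Q(y) is close to s², then r is close to (s / Q(x))² Q(x) / Q(y), again a quotient of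
-- values. Two vectors x and y are used because one form may miss a square class: over ℚ₂, x² + y² +
-- z² never lies in the class of 7.
--
-- For the converse, r must make r z² = u² - D v² insoluble, so its Hilbert symbol with D has to be
-- -1. For odd p, r is a nonresidue if p divides D exactly once, and r = p if D is a nonresidue
-- prime to p; for p = 2, r is 5, 2 or -1. The exponent in p³ is dictated by p = 2, where
-- congruences modulo 4 do not suffice.

ℤ-ring : AlmostCommutativeRing 0ℓ 0ℓ
ℤ-ring = ℤSolver.ring

ℚ-ring : AlmostCommutativeRing 0ℓ 0ℓ
ℚ-ring = fromCommutativeRing ℚProp.+-*-commutativeRing λ x → dec⇒maybe (0ℚ ℚProp.≟ x)

-- Integers inside ℚ.

int : ℤ → ℚ
int z = z ℚ./ 1

toℚᵘ-int : ∀ z → ℚ.toℚᵘ (int z) ℚᵘ.≃ mkℚᵘ z 0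
toℚᵘ-int z = ℚProp.toℚᵘ-fromℚᵘ (mkℚᵘ z 0)

int-injective : ∀ {a b} → int a ≡ int b → a ≡ b
int-injective {a} {b} e with ℚᵘₚ.≃-trans (ℚᵘₚ.≃-sym (toℚᵘ-int a)) (ℚᵘₚ.≃-trans (ℚProp.toℚᵘ-cong e) (toℚᵘ-int b))
... | *≡* e′ = trans (sym (ℤₚ.*-identityʳ a)) (trans e′ (ℤₚ.*-identityʳ b))

int-+ : ∀ a b → int (a + b) ≡ int a +ℚ int b
int-+ a b = ℚProp.toℚᵘ-injective (begin
  ℚ.toℚᵘ (int (a + b))                   ≈⟨ toℚᵘ-int (a + b) ⟩
  mkℚᵘ (a + b) 0                         ≈⟨ *≡* (lemma a b) ⟩
  mkℚᵘ a 0 ℚᵘ.+ mkℚᵘ b 0                 ≈⟨ ℚᵘₚ.+-cong (toℚᵘ-int a) (toℚᵘ-int b) ⟨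
  ℚ.toℚᵘ (int a) ℚᵘ.+ ℚ.toℚᵘ (int b)     ≈⟨ ℚProp.toℚᵘ-homo-+ (int a) (int b) ⟨
  ℚ.toℚᵘ (int a +ℚ int b)                ∎)
  where
  open ℚᵘₚ.≃-Reasoning
  lemma : ∀ a b → (a + b) * 1ℤ ≡ (a * 1ℤ + b * 1ℤ) * 1ℤ
  lemma = solve-∀ ℤ-ring

int-* : ∀ a b → int (a * b) ≡ int a *ℚ int b
int-* a b = ℚProp.toℚᵘ-injective (begin
  ℚ.toℚᵘ (int (a * b))                   ≈⟨ toℚᵘ-int (a * b) ⟩
  mkℚᵘ a 0 ℚᵘ.* mkℚᵘ b 0                 ≈⟨ ℚᵘₚ.*-cong (toℚᵘ-int a) (toℚᵘ-int b) ⟨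
  ℚ.toℚᵘ (int a) ℚᵘ.* ℚ.toℚᵘ (int b)     ≈⟨ ℚProp.toℚᵘ-homo-* (int a) (int b) ⟨
  ℚ.toℚᵘ (int a *ℚ int b)                ∎)
  where open ℚᵘₚ.≃-Reasoning

int-neg : ∀ a → int (- a) ≡ -ℚ int a
int-neg a = begin
  int (- a)                              ≡⟨ lemma (int (- a)) (int a) ⟩
  (int a +ℚ int (- a)) +ℚ -ℚ int a       ≡⟨ cong (_+ℚ -ℚ int a) (int-+ a (- a)) ⟨
  int (a - a) +ℚ -ℚ int a                ≡⟨ cong (λ z → int z +ℚ -ℚ int a) (ℤₚ.+-inverseʳ a) ⟩
  0ℚ +ℚ -ℚ int a                         ≡⟨ ℚProp.+-identityˡ _ ⟩
  -ℚ int a                               ∎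
  where
  open ≡-Reasoning
  lemma : ∀ x y → x ≡ (y +ℚ x) +ℚ -ℚ y
  lemma = solve-∀ ℚ-ring

int-- : ∀ a b → int (a - b) ≡ int a -ℚ int b
int-- a b = trans (int-+ a (- b)) (cong (int a +ℚ_) (int-neg b))

int≢0 : ∀ {z} → z ≢ 0ℤ → int z ≢ 0ℚ
int≢0 z≢0 e = z≢0 (int-injective e)

fraction : ∀ q → q *ℚ int (↧ q) ≡ int (↥ q)
fraction q = trans (cong (_*ℚ int (↧ q)) (sym (ℚProp.↥p/↧p≡p q))) (ℚProp.toℚᵘ-injective (begin
  ℚ.toℚᵘ (↥ q ℚ./ ↧ₙ q *ℚ int (↧ q))           ≈⟨ ℚProp.toℚᵘ-homo-* (↥ q ℚ./ ↧ₙ q) (int (↧ q)) ⟩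
  ℚ.toℚᵘ (↥ q ℚ./ ↧ₙ q) ℚᵘ.* ℚ.toℚᵘ (int (↧ q)) ≈⟨ ℚᵘₚ.*-cong (ℚProp.toℚᵘ-fromℚᵘ (mkℚᵘ (↥ q) d-1)) (toℚᵘ-int (↧ q)) ⟩
  mkℚᵘ (↥ q) d-1 ℚᵘ.* mkℚᵘ (↧ q) 0             ≈⟨ *≡* (lemma (↥ q) (↧ q)) ⟩
  mkℚᵘ (↥ q) 0                                  ≈⟨ toℚᵘ-int (↥ q) ⟨
  ℚ.toℚᵘ (int (↥ q))                            ∎))
  where
  open ℚᵘₚ.≃-Reasoning
  d-1 = ℚ.ℚ.denominator-1 q
  lemma : ∀ n d → n * d * 1ℤ ≡ n * (d * 1ℤ)
  lemma = solve-∀ ℤ-ring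

inverse : ∀ {x} → x ≢ 0ℚ → ∃[ i ] x *ℚ i ≡ 1ℚ
inverse {x} x≢0 = (ℚ.1/ x) , ℚProp.*-inverseʳ x
  where instance _ = ℚ.≢-nonZero x≢0

*-cancelˡ-ℚ : ∀ {x y z} → x ≢ 0ℚ → x *ℚ y ≡ x *ℚ z → y ≡ z
*-cancelˡ-ℚ {x} {y} {z} x≢0 e with i , xi≡1 ← inverse x≢0 = begin
  y                 ≡⟨ ℚProp.*-identityˡ y ⟨
  1ℚ *ℚ y           ≡⟨ cong (_*ℚ y) xi≡1 ⟨
  x *ℚ i *ℚ y       ≡⟨ lemma x i y ⟩
  i *ℚ (x *ℚ y)     ≡⟨ cong (i *ℚ_) e ⟩
  i *ℚ (x *ℚ z)     ≡⟨ lemma x i z ⟨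
  x *ℚ i *ℚ z       ≡⟨ cong (_*ℚ z) xi≡1 ⟩
  1ℚ *ℚ z           ≡⟨ ℚProp.*-identityˡ z ⟩
  z                 ∎
  where
  open ≡-Reasoning
  lemma : ∀ x i y → x *ℚ i *ℚ y ≡ i *ℚ (x *ℚ y)
  lemma = solve-∀ ℚ-ring

*-≢0 : ∀ {x y} → x ≢ 0ℚ → y ≢ 0ℚ → x *ℚ y ≢ 0ℚ
*-≢0 {x} x≢0 y≢0 e = y≢0 (*-cancelˡ-ℚ x≢0 (trans e (sym (ℚProp.*-zeroʳ x))))

*-≢0⁻ˡ : ∀ {x y} → x *ℚ y ≢ 0ℚ → x ≢ 0ℚ
*-≢0⁻ˡ {_} {y} h refl = h (ℚProp.*-zeroˡ y)

*-≢0⁻ʳ : ∀ {x y} → x *ℚ y ≢ 0ℚ → y ≢ 0ℚ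
*-≢0⁻ʳ {x} h refl = h (ℚProp.*-zeroʳ x)

ℤ-*-≢0 : ∀ {x y} → x ≢ 0ℤ → y ≢ 0ℤ → x * y ≢ 0ℤ
ℤ-*-≢0 {x} x≢0 y≢0 e = [ x≢0 , y≢0 ]′ (ℤₚ.i*j≡0⇒i≡0∨j≡0 x e)

ℤ-*-cancelˡ : ∀ {x y z} → x ≢ 0ℤ → x * y ≡ x * z → y ≡ z
ℤ-*-cancelˡ {x} {y} {z} x≢0 = ℤₚ.*-cancelˡ-≡ x y z {{ℤ.≢-nonZero x≢0}}

∣ℤ-sum : ∀ {d m n k} → d ∣ℤ m → d ∣ℤ n → k ≡ m + n → d ∣ℤ k
∣ℤ-sum d∣m d∣n refl = ℤ∣.∣m∣n⇒∣m+n d∣m d∣n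

∣ℤ-multiple : ∀ {d m k} c → d ∣ℤ m → k ≡ c * m → d ∣ℤ k
∣ℤ-multiple c d∣m refl = ℤ∣.∣n⇒∣m*n c d∣m

-- The valuation and the localisation of ℤ at p.

n<p^n : ∀ {p} → p ℕ.> 1 → ∀ n → n ℕ.< p ℕ.^ n
n<p^n p>1 zero    = ℕ.s≤s ℕ.z≤n
n<p^n {p} p>1 (suc n) = begin-strict
  suc n               <⟨ ℕ.s≤s (n<p^n p>1 n) ⟩
  suc (p ℕ.^ n)       ≤⟨ ℕₚ.+-monoˡ-≤ (p ℕ.^ n) (ℕₚ.m^n>0 p n) ⟩
  p ℕ.^ n ℕ.+ p ℕ.^ n ≡⟨ cong (p ℕ.^ n ℕ.+_) (ℕₚ.+-identityʳ _) ⟨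
  2 ℕ.* p ℕ.^ n       ≤⟨ ℕₚ.*-monoˡ-≤ (p ℕ.^ n) p>1 ⟩
  p ℕ.* p ℕ.^ n       ∎
  where
  open ℕₚ.≤-Reasoning
  instance _ = ℕ.>-nonZero (ℕₚ.<-trans (ℕ.s≤s ℕ.z≤n) p>1)

maxExponent-∣ : ∀ p m k → p ℕ.^ maxExponent p m k ∣ m
maxExponent-∣ p m zero = ℕ∣.1∣ m
maxExponent-∣ p m (suc k) with p ℕ.^ suc k ℕ∣.∣? m
... | yes d = d
... | no  _ = maxExponent-∣ p m k

maxExponent-max : ∀ p m k {j} → j ℕ.≤ k → p ℕ.^ j ∣ m → j ℕ.≤ maxExponent p m k
maxExponent-max p m zero j≤0 _ = j≤0
maxExponent-max p m (suc k) {j} j≤1+k d with p ℕ.^ suc k ℕ∣.∣? m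
... | yes _ = j≤1+k
... | no ¬d with ℕₚ.m≤n⇒m<n∨m≡n j≤1+k
...   | inj₁ j<1+k = maxExponent-max p m k (ℕ.s≤s⁻¹ j<1+k) d
...   | inj₂ refl  = contradiction d ¬d

pos-^ : ∀ m n → + (m ℕ.^ n) ≡ (+ m) ^ n
pos-^ m zero = refl
pos-^ m (suc n) = trans (ℤₚ.pos-* m (m ℕ.^ n)) (cong (+ m *_) (pos-^ m n))

-- The difference between q and the computed quotient, times d, is the remainder, which is smaller
-- than d; so the difference vanishes.
/ℕ-exact : ∀ q d .{{_ : ℕ.NonZero d}} → (q * + d) ℤ./ℕ d ≡ q
/ℕ-exact q d = sym (ℤₚ.i-j≡0⇒i≡j q a/d (ℤₚ.∣i∣≡0⇒i≡0 (ℕₚ.n<1⇒n≡0 (ℕₚ.*-cancelʳ-< _ _ 1 (begin-strict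
  ∣ q - a/d ∣ ℕ.* d        ≡⟨ ℤₚ.abs-* (q - a/d) (+ d) ⟨
  ∣ (q - a/d) * + d ∣      ≡⟨ cong ∣_∣ remainder ⟩
  (q * + d) ℤ.%ℕ d         <⟨ ℤDM.n%ℕd<d (q * + d) d ⟩
  d                        ≡⟨ ℕₚ.*-identityˡ d ⟨
  1 ℕ.* d                  ∎)))))
  where
  open ℕₚ.≤-Reasoning
  a/d = (q * + d) ℤ./ℕ d
  lemma : ∀ q a d r → q * d ≡ r + a * d → (q - a) * d ≡ r
  lemma q a d r e = trans (ℤₚ.*-distribʳ-+ d q (- a)) (trans (cong (_+ - a * d) e) (cancel r a d))
    where
    cancel : ∀ r a d → r + a * d + - a * d ≡ r
    cancel = solve-∀ ℤ-ring
  remainder : (q - a/d) * + d ≡ + ((q * + d) ℤ.%ℕ d)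
  remainder = lemma q a/d (+ d) _ (ℤDM.a≡a%ℕn+[a/ℕn]*n (q * + d) d)

module PAdic (p : ℕ) (p-prime : Prime p) where

  instance
    p-nonZero : ℕ.NonZero p
    p-nonZero = prime⇒nonZero p-prime

  p>1 : p ℕ.> 1
  p>1 = ℕ.nonTrivial⇒n>1 p {{prime⇒nonTrivial p-prime}}

  P : ℤ
  P = + p

  P≢0 : P ≢ 0ℤ
  P≢0 e = ℕ.≢-nonZero⁻¹ p (ℤₚ.+-injective e)

  P^≢0 : ∀ k → P ^ k ≢ 0ℤ
  P^≢0 zero ()
  P^≢0 (suc k) = ℤ-*-≢0 P≢0 (P^≢0 k)

  Unit : ℤ → Set
  Unit z = ¬ P ∣ℤ z

  Unit⇒≢0 : ∀ {z} → Unit z → z ≢ 0ℤ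
  Unit⇒≢0 u refl = u (divides 0ℤ refl)

  euclid : ∀ {a b} → P ∣ℤ a * b → P ∣ℤ a ⊎ P ∣ℤ b
  euclid {a} {b} d with euclidsLemma ∣ a ∣ ∣ b ∣ p-prime (subst (p ∣_) (ℤₚ.abs-* a b) (ℤ∣.∣⇒∣ᵤ d))
  ... | inj₁ e = inj₁ (ℤ∣.∣ᵤ⇒∣ e)
  ... | inj₂ e = inj₂ (ℤ∣.∣ᵤ⇒∣ e)

  Unit-* : ∀ {a b} → Unit a → Unit b → Unit (a * b)
  Unit-* ua ub d = [ ua , ub ]′ (euclid d)

  Unit-1 : Unit 1ℤ
  Unit-1 d = ℕₚ.<⇒≱ p>1 (ℕ∣.∣⇒≤ (ℤ∣.∣⇒∣ᵤ d))

  P∣x²⇒P∣x : ∀ {x} → P ∣ℤ x * x → P ∣ℤ x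
  P∣x²⇒P∣x d = [ (λ e → e) , (λ e → e) ]′ (euclid d)

  -- Euclid's lemma strips one factor p off `a` at a time.
  P^-∣-cancel : ∀ k {a b} → Unit b → P ^ k ∣ℤ a * b → P ^ k ∣ℤ a
  P^-∣-cancel zero    {a} _ _ = divides a (sym (ℤₚ.*-identityʳ a))
  P^-∣-cancel (suc k) {a} {b} ub (divides q e) = [ step , (λ P∣b → contradiction P∣b ub) ]′
    (euclid {a} {b} (divides (q * P ^ k) (trans e (lemma₁ q P (P ^ k)))))
    where
    lemma₁ : ∀ q P K → q * (P * K) ≡ q * K * P
    lemma₁ = solve-∀ ℤ-ring
    lemma₂ : ∀ a b P → P * (a * b) ≡ a * P * b
    lemma₂ = solve-∀ ℤ-ring
    lemma₃ : ∀ q P K → q * (P * K) ≡ P * (q * K)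
    lemma₃ = solve-∀ ℤ-ring
    step : P ∣ℤ a → P ^ suc k ∣ℤ a
    step (divides a′ a≡) = divides a″ (trans a≡ (trans (cong (_* P) a′≡) (trans (ℤₚ.*-assoc a″ (P ^ k) P) (cong (a″ *_) (ℤₚ.*-comm (P ^ k) P)))))
      where
      a′b≡ : a′ * b ≡ q * P ^ k
      a′b≡ = ℤ-*-cancelˡ P≢0 (trans (lemma₂ a′ b P) (trans (cong (_* b) (sym a≡)) (trans e (lemma₃ q P (P ^ k)))))
      open _∣ℤ_ (P^-∣-cancel k {a′} ub (divides q a′b≡)) renaming (quotient to a″; equality to a′≡)

  private
    p^≢0 : ∀ k → ℕ.NonZero (p ℕ.^ k)
    p^≢0 k = ℕₚ.m^n≢0 p k

  unitPart-eq : ∀ z → z ≡ P ^ νℤ p z * unitPart p-prime z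
  unitPart-eq z with ℤ∣.∣ᵤ⇒∣ {+ (p ℕ.^ νℤ p z)} {z} (maxExponent-∣ p ∣ z ∣ ∣ z ∣)
  ... | divides q e = begin
    z                                   ≡⟨ e ⟩
    q * + (p ℕ.^ νℤ p z)                ≡⟨ cong (_* + (p ℕ.^ νℤ p z)) (/ℕ-exact q (p ℕ.^ νℤ p z)) ⟨
    quotient (q * + (p ℕ.^ νℤ p z)) * + (p ℕ.^ νℤ p z) ≡⟨ cong (λ y → quotient y * + (p ℕ.^ νℤ p z)) e ⟨
    quotient z * + (p ℕ.^ νℤ p z)       ≡⟨ ℤₚ.*-comm (quotient z) _ ⟩
    + (p ℕ.^ νℤ p z) * quotient z       ≡⟨ cong (_* quotient z) (pos-^ p (νℤ p z)) ⟩
    P ^ νℤ p z * unitPart p-prime z     ∎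
    where
    open ≡-Reasoning
    instance _ = p^≢0 (νℤ p z)
    quotient : ℤ → ℤ
    quotient y = y ℤ./ℕ (p ℕ.^ νℤ p z)

  -- From j < p ^ j ≤ ∣ z ∣, the exponent j lies within the range that `νℤ` searches, so the maximum
  -- found there is at least j.
  P^∣⇒≤νℤ : ∀ {z j} → z ≢ 0ℤ → P ^ j ∣ℤ z → j ℕ.≤ νℤ p z
  P^∣⇒≤νℤ {z} {j} z≢0 d = maxExponent-max p ∣ z ∣ ∣ z ∣
    (ℕₚ.<⇒≤ (ℕₚ.<-≤-trans (n<p^n p>1 j) (ℕ∣.∣⇒≤ {{ℕ.≢-nonZero (z≢0 ∘ ℤₚ.∣i∣≡0⇒i≡0)}} d′))) d′
    where
    d′ : p ℕ.^ j ∣ ∣ z ∣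
    d′ = ℤ∣.∣⇒∣ᵤ (subst (_∣ℤ z) (sym (pos-^ p j)) d)

  -- One more factor p would contradict the maximality of `νℤ p z`.
  unitPart-unit : ∀ {z} → z ≢ 0ℤ → Unit (unitPart p-prime z)
  unitPart-unit {z} z≢0 (divides q e) = ℕₚ.1+n≰n (P^∣⇒≤νℤ z≢0
    (divides q (trans (unitPart-eq z) (trans (cong (P ^ νℤ p z *_) e) (lemma q P (P ^ νℤ p z))))))
    where
    lemma : ∀ q P K → K * (q * P) ≡ q * (P * K)
    lemma = solve-∀ ℤ-ring

  -- Membership in p^k ℤ_(p), witnessed by any fraction whose denominator is prime to p, not by the
  -- reduced one. Closure under ring operations then becomes an identity between fractions, and 0 is
  -- no exception.
  record V (k : ℕ) (x : ℚ) : Set where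
    constructor mkV
    field
      numer denom : ℤ
      denom-unit  : Unit denom
      equation    : x *ℚ int denom ≡ int (P ^ k * numer)

  V-0 : ∀ k → V k 0ℚ
  V-0 k = mkV 0ℤ 1ℤ Unit-1 (cong int (sym (ℤₚ.*-zeroʳ (P ^ k))))

  V-neg : ∀ {k x} → V k x → V k (-ℚ x)
  V-neg {k} {x} (mkV a b ub e) = mkV (- a) b ub (begin
    -ℚ x *ℚ int b      ≡⟨ ℚProp.neg-distribˡ-* x (int b) ⟨
    -ℚ (x *ℚ int b)    ≡⟨ cong -ℚ_ e ⟩
    -ℚ int (P ^ k * a) ≡⟨ int-neg (P ^ k * a) ⟨
    int (- (P ^ k * a)) ≡⟨ cong int (ℤₚ.neg-distribʳ-* (P ^ k) a) ⟩
    int (P ^ k * - a)  ∎)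
    where open ≡-Reasoning

  V-+ : ∀ {k x y} → V k x → V k y → V k (x +ℚ y)
  V-+ {k} {x} {y} (mkV a b ub e) (mkV a′ b′ ub′ e′) = mkV (a * b′ + a′ * b) (b * b′) (Unit-* ub ub′) (begin
    (x +ℚ y) *ℚ int (b * b′)                         ≡⟨ cong ((x +ℚ y) *ℚ_) (int-* b b′) ⟩
    (x +ℚ y) *ℚ (int b *ℚ int b′)                    ≡⟨ lemma x y (int b) (int b′) ⟩
    x *ℚ int b *ℚ int b′ +ℚ y *ℚ int b′ *ℚ int b     ≡⟨ cong₂ (λ u v → u *ℚ int b′ +ℚ v *ℚ int b) e e′ ⟩
    int (P ^ k * a) *ℚ int b′ +ℚ int (P ^ k * a′) *ℚ int b ≡⟨ cong₂ _+ℚ_ (int-* (P ^ k * a) b′) (int-* (P ^ k * a′) b) ⟨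
    int (P ^ k * a * b′) +ℚ int (P ^ k * a′ * b)     ≡⟨ int-+ (P ^ k * a * b′) _ ⟨
    int (P ^ k * a * b′ + P ^ k * a′ * b)            ≡⟨ cong int (lemmaℤ (P ^ k) a b′ a′ b) ⟩
    int (P ^ k * (a * b′ + a′ * b))                  ∎)
    where
    open ≡-Reasoning
    lemma : ∀ x y b c → (x +ℚ y) *ℚ (b *ℚ c) ≡ x *ℚ b *ℚ c +ℚ y *ℚ c *ℚ b
    lemma = solve-∀ ℚ-ring
    lemmaℤ : ∀ K a b′ a′ b → K * a * b′ + K * a′ * b ≡ K * (a * b′ + a′ * b)
    lemmaℤ = solve-∀ ℤ-ring

  V-- : ∀ {k x y} → V k x → V k y → V k (x -ℚ y)
  V-- vx vy = V-+ vx (V-neg vy)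

  V-* : ∀ {k l x y} → V k x → V l y → V (k ℕ.+ l) (x *ℚ y)
  V-* {k} {l} {x} {y} (mkV a b ub e) (mkV a′ b′ ub′ e′) = mkV (a * a′) (b * b′) (Unit-* ub ub′) (begin
    x *ℚ y *ℚ int (b * b′)                ≡⟨ cong (x *ℚ y *ℚ_) (int-* b b′) ⟩
    x *ℚ y *ℚ (int b *ℚ int b′)           ≡⟨ lemma x y (int b) (int b′) ⟩
    x *ℚ int b *ℚ (y *ℚ int b′)           ≡⟨ cong₂ _*ℚ_ e e′ ⟩
    int (P ^ k * a) *ℚ int (P ^ l * a′)   ≡⟨ int-* (P ^ k * a) _ ⟨
    int (P ^ k * a * (P ^ l * a′))        ≡⟨ cong int (lemmaℤ (P ^ k) a (P ^ l) a′) ⟩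
    int (P ^ k * P ^ l * (a * a′))        ≡⟨ cong (λ K → int (K * (a * a′))) (ℤₚ.^-distribˡ-+-* P k l) ⟨
    int (P ^ (k ℕ.+ l) * (a * a′))        ∎)
    where
    open ≡-Reasoning
    lemma : ∀ x y b c → x *ℚ y *ℚ (b *ℚ c) ≡ x *ℚ b *ℚ (y *ℚ c)
    lemma = solve-∀ ℚ-ring
    lemmaℤ : ∀ K a L b → K * a * (L * b) ≡ K * L * (a * b)
    lemmaℤ = solve-∀ ℤ-ring

  V-weaken : ∀ {k l x} → k ℕ.≤ l → V l x → V k x
  V-weaken {k} {l} {x} k≤l (mkV a b ub e) = mkV (P ^ (l ℕ.∸ k) * a) b ub (trans e (cong int (begin
    P ^ l * a                       ≡⟨ cong (λ j → P ^ j * a) (ℕₚ.m+[n∸m]≡n k≤l) ⟨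
    P ^ (k ℕ.+ (l ℕ.∸ k)) * a       ≡⟨ cong (_* a) (ℤₚ.^-distribˡ-+-* P k (l ℕ.∸ k)) ⟩
    P ^ k * P ^ (l ℕ.∸ k) * a       ≡⟨ ℤₚ.*-assoc (P ^ k) _ a ⟩
    P ^ k * (P ^ (l ℕ.∸ k) * a)     ∎)))
    where open ≡-Reasoning

  V-int : ∀ {k z} → P ^ k ∣ℤ z → V k (int z)
  V-int {k} (divides q refl) = mkV q 1ℤ Unit-1 (trans (ℚProp.*-identityʳ (int (q * P ^ k))) (cong int (ℤₚ.*-comm q (P ^ k))))

  V-int⁻ : ∀ {k z} → V k (int z) → P ^ k ∣ℤ z
  V-int⁻ {k} {z} (mkV a b ub e) = P^-∣-cancel k ub
    (divides a (trans (int-injective (trans (int-* z b) e)) (ℤₚ.*-comm (P ^ k) a)))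

  record Decomposed (z : ℤ) : Set where
    constructor decomposed
    field
      exponent  : ℕ
      unit      : ℤ
      isUnit    : Unit unit
      equation  : z ≡ P ^ exponent * unit

  decompose : ∀ {z} → z ≢ 0ℤ → Decomposed z
  decompose {z} z≢0 = decomposed (νℤ p z) (unitPart p-prime z) (unitPart-unit z≢0) (unitPart-eq z)

  ↧≢0 : ∀ q → ↧ q ≢ 0ℤ
  ↧≢0 q ()

  -- Continuity of multiplication by c: the precision lost is the power of p in the denominator of
  -- c, the same for all k and x.
  V-scale : ∀ c → ∃[ m ] ∀ {k x} → V (m ℕ.+ k) x → V k (c *ℚ x)
  V-scale c = m , λ {k} {x} → scale k x
    where
    open Decomposed (decompose (↧≢0 c)) renaming (exponent to m; unit to w; isUnit to uw; equation to d≡)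
    open ≡-Reasoning
    lemma : ∀ c x M w b → M *ℚ (c *ℚ x *ℚ (w *ℚ b)) ≡ c *ℚ (M *ℚ w) *ℚ (x *ℚ b)
    lemma = solve-∀ ℚ-ring
    lemmaℤ : ∀ n M K a → n * (M * K * a) ≡ M * (K * (n * a))
    lemmaℤ = solve-∀ ℤ-ring
    scale : ∀ k x → V (m ℕ.+ k) x → V k (c *ℚ x)
    scale k x (mkV a b ub e) = mkV (↥ c * a) (w * b) (Unit-* uw ub) (*-cancelˡ-ℚ (int≢0 (P^≢0 m)) (begin
      int (P ^ m) *ℚ (c *ℚ x *ℚ int (w * b))             ≡⟨ cong (λ y → int (P ^ m) *ℚ (c *ℚ x *ℚ y)) (int-* w b) ⟩
      int (P ^ m) *ℚ (c *ℚ x *ℚ (int w *ℚ int b))        ≡⟨ lemma c x (int (P ^ m)) (int w) (int b) ⟩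
      c *ℚ (int (P ^ m) *ℚ int w) *ℚ (x *ℚ int b)        ≡⟨ cong (λ y → c *ℚ y *ℚ (x *ℚ int b)) (int-* (P ^ m) w) ⟨
      c *ℚ int (P ^ m * w) *ℚ (x *ℚ int b)               ≡⟨ cong (λ y → c *ℚ int y *ℚ (x *ℚ int b)) d≡ ⟨
      c *ℚ int (↧ c) *ℚ (x *ℚ int b)                     ≡⟨ cong₂ _*ℚ_ (fraction c) e ⟩
      int (↥ c) *ℚ int (P ^ (m ℕ.+ k) * a)               ≡⟨ int-* (↥ c) _ ⟨
      int (↥ c * (P ^ (m ℕ.+ k) * a))                    ≡⟨ cong (λ K → int (↥ c * (K * a))) (ℤₚ.^-distribˡ-+-* P m k) ⟩
      int (↥ c * (P ^ m * P ^ k * a))                    ≡⟨ cong int (lemmaℤ (↥ c) (P ^ m) (P ^ k) a) ⟩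
      int (P ^ m * (P ^ k * (↥ c * a)))                  ≡⟨ int-* (P ^ m) _ ⟩
      int (P ^ m) *ℚ int (P ^ k * (↥ c * a))             ∎))

  -- Cross-multiplication with the reduced fraction of q shows that p ^ (k + ν of the denominator)
  -- divides the numerator times b, and the unit b cancels.
  V⇒≤ν : ∀ {k q} → V k q → [ + k ] ≤⁺ ν p q
  V⇒≤ν {k} {q} (mkV a b ub e) with q ℚProp.≟ 0ℚ
  ... | yes _   = _ ≤⊤⁺
  ... | no q≢0  = [ ℤₚ.≤-trans (ℤₚ.≤-reflexive (lemma (+ k) (+ νℤ p (↧ q))))
                     (ℤₚ.+-monoˡ-≤ (- + νℤ p (↧ q)) (ℤ.+≤+ (P^∣⇒≤νℤ n≢0 (P^-∣-cancel (k ℕ.+ νℤ p (↧ q)) ub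
                       (divides (unitPart p-prime (↧ q) * a) nb≡))))) ]
    where
    open ≡-Reasoning
    n≢0 : ↥ q ≢ 0ℤ
    n≢0 n≡0 = q≢0 (ℚProp.↥p≡0⇒p≡0 q n≡0)
    lemma : ∀ k l → k ≡ k + l - l
    lemma = solve-∀ ℤ-ring
    lemma₁ : ∀ q d b → q *ℚ d *ℚ b ≡ d *ℚ (q *ℚ b)
    lemma₁ = solve-∀ ℚ-ring
    lemma₂ : ∀ L w K a → L * w * (K * a) ≡ w * a * (K * L)
    lemma₂ = solve-∀ ℤ-ring
    nb≡ : ↥ q * b ≡ unitPart p-prime (↧ q) * a * P ^ (k ℕ.+ νℤ p (↧ q))
    nb≡ = int-injective (begin
      int (↥ q * b)                        ≡⟨ int-* (↥ q) b ⟩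
      int (↥ q) *ℚ int b                   ≡⟨ cong (_*ℚ int b) (fraction q) ⟨
      q *ℚ int (↧ q) *ℚ int b              ≡⟨ lemma₁ q (int (↧ q)) (int b) ⟩
      int (↧ q) *ℚ (q *ℚ int b)            ≡⟨ cong (int (↧ q) *ℚ_) e ⟩
      int (↧ q) *ℚ int (P ^ k * a)         ≡⟨ int-* (↧ q) (P ^ k * a) ⟨
      int (↧ q * (P ^ k * a))              ≡⟨ cong (λ y → int (y * (P ^ k * a))) (unitPart-eq (↧ q)) ⟩
      int (P ^ νℤ p (↧ q) * unitPart p-prime (↧ q) * (P ^ k * a)) ≡⟨ cong int (lemma₂ (P ^ νℤ p (↧ q)) (unitPart p-prime (↧ q)) (P ^ k) a) ⟩
      int (unitPart p-prime (↧ q) * a * (P ^ k * P ^ νℤ p (↧ q))) ≡⟨ cong (λ y → int (unitPart p-prime (↧ q) * a * y)) (ℤₚ.^-distribˡ-+-* P k (νℤ p (↧ q))) ⟨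
      int (unitPart p-prime (↧ q) * a * P ^ (k ℕ.+ νℤ p (↧ q))) ∎)

  -- The power of p in the denominator of q is absorbed by the numerator with at least k factors
  -- left over; the unit part of the denominator remains.
  ≤ν⇒V : ∀ {k q} → [ + k ] ≤⁺ ν p q → V k q
  ≤ν⇒V {k} {q} h with q ℚProp.≟ 0ℚ
  ... | yes refl = V-0 k
  ≤ν⇒V {k} {q} [ h ] | no q≢0 = mkV (P ^ j * unitPart p-prime (↥ q)) (unitPart p-prime (↧ q)) (unitPart-unit (↧≢0 q))
    (*-cancelˡ-ℚ (int≢0 (P^≢0 l)) (begin
      int (P ^ l) *ℚ (q *ℚ int (unitPart p-prime (↧ q))) ≡⟨ lemma₁ (int (P ^ l)) q (int (unitPart p-prime (↧ q))) ⟩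
      q *ℚ (int (P ^ l) *ℚ int (unitPart p-prime (↧ q))) ≡⟨ cong (q *ℚ_) (int-* (P ^ l) _) ⟨
      q *ℚ int (P ^ l * unitPart p-prime (↧ q))          ≡⟨ cong (λ y → q *ℚ int y) (unitPart-eq (↧ q)) ⟨
      q *ℚ int (↧ q)                                     ≡⟨ fraction q ⟩
      int (↥ q)                                          ≡⟨ cong int (unitPart-eq (↥ q)) ⟩
      int (P ^ νℤ p (↥ q) * u)                           ≡⟨ cong (λ i → int (P ^ i * u)) (ℕₚ.m+[n∸m]≡n l+k≤) ⟨
      int (P ^ (l ℕ.+ k ℕ.+ j) * u)                      ≡⟨ cong (λ K → int (K * u)) (trans (ℤₚ.^-distribˡ-+-* P (l ℕ.+ k) j) (cong (_* P ^ j) (ℤₚ.^-distribˡ-+-* P l k))) ⟩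
      int (P ^ l * P ^ k * P ^ j * u)                    ≡⟨ cong int (lemma₂ (P ^ l) (P ^ k) (P ^ j) u) ⟩
      int (P ^ l * (P ^ k * (P ^ j * u)))                ≡⟨ int-* (P ^ l) _ ⟩
      int (P ^ l) *ℚ int (P ^ k * (P ^ j * u))           ∎))
    where
    open ≡-Reasoning
    l = νℤ p (↧ q)
    j = νℤ p (↥ q) ℕ.∸ (l ℕ.+ k)
    u = unitPart p-prime (↥ q)
    lemma₁ : ∀ L q w → L *ℚ (q *ℚ w) ≡ q *ℚ (L *ℚ w)
    lemma₁ = solve-∀ ℚ-ring
    lemma₂ : ∀ L K J u → L * K * J * u ≡ L * (K * (J * u))
    lemma₂ = solve-∀ ℤ-ring
    lemma₃ : ∀ l n → l + (n - l) ≡ n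
    lemma₃ = solve-∀ ℤ-ring
    l+k≤ : l ℕ.+ k ℕ.≤ νℤ p (↥ q)
    l+k≤ = ℤₚ.drop‿+≤+ (ℤₚ.≤-trans (ℤₚ.+-monoʳ-≤ (+ l) h) (ℤₚ.≤-reflexive (lemma₃ (+ l) (+ νℤ p (↥ q)))))

-- p-adic squares and density of quotient sets.

¼ 2ℚ 4ℚ : ℚ
¼ = + 1 ℚ./ 4
2ℚ = int (+ 2)
4ℚ = int (+ 4)

-- Values at rational, not integral, vectors: these are stable under rescaling of coordinates and
-- under multiplication by rational squares.
record Rep₂ (d₁ d₂ q : ℚ) : Set where
  constructor rep₂
  field
    x y   : ℚ
    value : d₁ *ℚ (x *ℚ x) +ℚ d₂ *ℚ (y *ℚ y) ≡ q

record Rep₃ (d₁ d₂ d₃ q : ℚ) : Set where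
  constructor rep₃
  field
    x y z : ℚ
    value : d₁ *ℚ (x *ℚ x) +ℚ d₂ *ℚ (y *ℚ y) +ℚ d₃ *ℚ (z *ℚ z) ≡ q

module Density (p : ℕ) (p-prime : Prime p) where
  open PAdic p p-prime

  V-resp : ∀ {k x y} → x ≡ y → V k x → V k y
  V-resp refl v = v

  -- Being a square in ℚₚ, expressed by rational approximations to the root, which need not converge
  -- together.
  Square : ℚ → Set
  Square q = ∀ k → ∃[ s ] V k (q -ℚ s *ℚ s)

  Square-scale : ∀ {q} c → Square q → Square (c *ℚ c *ℚ q)
  Square-scale {q} c sq k =
    let m , scale = V-scale (c *ℚ c)
        s , v = sq (m ℕ.+ k)
    in c *ℚ s , V-resp (lemma c q s) (scale v)
    where
    lemma : ∀ c q s → c *ℚ c *ℚ (q -ℚ s *ℚ s) ≡ c *ℚ c *ℚ q -ℚ c *ℚ s *ℚ (c *ℚ s)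
    lemma = solve-∀ ℚ-ring

  Square-unscale : ∀ {q c} → c ≢ 0ℚ → Square (c *ℚ c *ℚ q) → Square q
  Square-unscale {q} {c} c≢0 sq = subst Square eq (Square-scale i sq)
    where
    i = proj₁ (inverse c≢0)
    lemma : ∀ c i q → i *ℚ i *ℚ (c *ℚ c *ℚ q) ≡ c *ℚ i *ℚ (c *ℚ i) *ℚ q
    lemma = solve-∀ ℚ-ring
    eq : i *ℚ i *ℚ (c *ℚ c *ℚ q) ≡ q
    eq = trans (lemma c i q) (trans (cong (λ y → y *ℚ y *ℚ q) (proj₂ (inverse c≢0))) (ℚProp.*-identityˡ q))

  V₀-int : ∀ z → V 0 (int z)
  V₀-int z = V-int (divides z (sym (ℤₚ.*-identityʳ z)))

  -- Dividing by s in Newton's step is unnecessary when s ≡ 1: adding 2δ to s, where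
  -- δ = (m - s²) / 4, turns δ into δ (1 - s - δ).
  hensel : ∀ {δ} → V 1 δ → Square (1ℚ +ℚ 4ℚ *ℚ δ)
  hensel {δ₀} vδ₀ k =
    let s , δ , e , _ , vδ = stage k
    in s , V-weaken (ℕₚ.n≤1+n k) (V-resp (sym e) (V-* (V₀-int (+ 4)) vδ))
    where
    m = 1ℚ +ℚ 4ℚ *ℚ δ₀
    stage : ∀ j → ∃[ s ] ∃[ δ ] m -ℚ s *ℚ s ≡ 4ℚ *ℚ δ × V 1 (1ℚ -ℚ s) × V (suc j) δ
    stage zero    = 1ℚ , δ₀ , lemma δ₀ , V-0 1 , vδ₀
      where
      lemma : ∀ δ → 1ℚ +ℚ 4ℚ *ℚ δ -ℚ 1ℚ *ℚ 1ℚ ≡ 4ℚ *ℚ δ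
      lemma = solve-∀ ℚ-ring
    stage (suc j) =
      let s , δ , e , vs , vδ = stage j
          s′ = s +ℚ 2ℚ *ℚ δ
          vs′ = V-resp (lemma₁ s δ) (V-- vs (V-* (V₀-int (+ 2)) (V-weaken (ℕ.s≤s ℕ.z≤n) vδ)))
      in s′ , δ *ℚ (1ℚ -ℚ s -ℚ δ)
         , trans (lemma₂ m s δ) (trans (cong (_-ℚ (4ℚ *ℚ s *ℚ δ +ℚ 4ℚ *ℚ δ *ℚ δ)) e) (lemma₃ s δ))
         , vs′
         , V-weaken (ℕₚ.≤-reflexive (ℕₚ.+-comm 1 (suc j))) (V-* vδ (V-- vs (V-weaken (ℕ.s≤s ℕ.z≤n) vδ)))
      where
      lemma₁ : ∀ s δ → 1ℚ -ℚ s -ℚ 2ℚ *ℚ δ ≡ 1ℚ -ℚ (s +ℚ 2ℚ *ℚ δ)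
      lemma₁ = solve-∀ ℚ-ring
      lemma₂ : ∀ m s δ → m -ℚ (s +ℚ 2ℚ *ℚ δ) *ℚ (s +ℚ 2ℚ *ℚ δ) ≡ m -ℚ s *ℚ s -ℚ (4ℚ *ℚ s *ℚ δ +ℚ 4ℚ *ℚ δ *ℚ δ)
      lemma₂ = solve-∀ ℚ-ring
      lemma₃ : ∀ s δ → 4ℚ *ℚ δ -ℚ (4ℚ *ℚ s *ℚ δ +ℚ 4ℚ *ℚ δ *ℚ δ) ≡ 4ℚ *ℚ (δ *ℚ (1ℚ -ℚ s -ℚ δ))
      lemma₃ = solve-∀ ℚ-ring

  -- Units congruent modulo M to the square of a unit are p-adic squares.
  record SquareModulus (M : ℤ) : Set where
    field
      P∣M : P ∣ℤ M
      V-M : V 1 (¼ *ℚ int M)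

  -- The quotient q = a / b is recorded as `q *ℚ b ≡ a`, an equation that survives multiplying a and
  -- b by a common factor.
  ApproximableBy : (ℚ → Set) → ℚ → Set
  ApproximableBy W r = ∀ k → ∃[ q ] ∃[ a ] ∃[ b ] W a × W b × b ≢ 0ℚ × q *ℚ b ≡ a × V k (r -ℚ q)

  Dens : (ℚ → Set) → Set
  Dens W = ∀ r → ApproximableBy W r

  -- The factor c cancels in the quotient, so a form may be replaced by a nonzero multiple of
  -- itself.
  Dens-map : ∀ {W W′} c → c ≢ 0ℚ → (∀ {q} → W q → W′ (c *ℚ q)) → Dens W → Dens W′
  Dens-map c c≢0 f dens r k =
    let q , a , b , wa , wb , b≢0 , e , v = dens r k
    in q , c *ℚ a , c *ℚ b , f wa , f wb , *-≢0 c≢0 b≢0 , trans (lemma q c b) (cong (c *ℚ_) e) , v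
    where
    lemma : ∀ q c b → q *ℚ (c *ℚ b) ≡ c *ℚ (q *ℚ b)
    lemma = solve-∀ ℚ-ring

  Dens-⊆ : ∀ {W W′} → (∀ {q} → W q → W′ q) → Dens W → Dens W′
  Dens-⊆ f dens r k =
    let q , a , b , wa , wb , rest = dens r k
    in q , a , b , f wa , f wb , rest

  -- With r a b ≈ s², take q = s² / (a b) = (s / a)² a / b. Dividing by a b costs a fixed amount of
  -- precision, which is added to the demand on s beforehand.
  approximate : ∀ {W : ℚ → Set} → (∀ c {q} → W q → W (c *ℚ c *ℚ q)) →
    ∀ {r a b} → W a → W b → a ≢ 0ℚ → b ≢ 0ℚ → Square (r *ℚ a *ℚ b) → ApproximableBy W r
  approximate W-scale {r} {a} {b} wa wb a≢0 b≢0 sq k =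
    let i , ai≡1 = inverse a≢0
        j , bj≡1 = inverse b≢0
        m , scale = V-scale (i *ℚ j)
        s , v = sq (m ℕ.+ k)
        q = s *ℚ s *ℚ i *ℚ j
    in q , s *ℚ i *ℚ (s *ℚ i) *ℚ a , b , W-scale (s *ℚ i) wa , wb , b≢0 ,
       (begin
          s *ℚ s *ℚ i *ℚ j *ℚ b            ≡⟨ lemma₁ s i j b ⟩
          s *ℚ s *ℚ i *ℚ (b *ℚ j)          ≡⟨ cong (s *ℚ s *ℚ i *ℚ_) (trans bj≡1 (sym ai≡1)) ⟩
          s *ℚ s *ℚ i *ℚ (a *ℚ i)          ≡⟨ lemma₂ s i a ⟩
          s *ℚ i *ℚ (s *ℚ i) *ℚ a          ∎) ,
       V-resp (begin
          i *ℚ j *ℚ (r *ℚ a *ℚ b -ℚ s *ℚ s)  ≡⟨ lemma₃ r s a i b j ⟩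
          r *ℚ ((a *ℚ i) *ℚ (b *ℚ j)) -ℚ q   ≡⟨ cong₂ (λ x y → r *ℚ (x *ℚ y) -ℚ q) ai≡1 bj≡1 ⟩
          r *ℚ (1ℚ *ℚ 1ℚ) -ℚ q               ≡⟨ cong (_-ℚ q) (ℚProp.*-identityʳ r) ⟩
          r -ℚ q                             ∎) (scale v)
    where
    open ≡-Reasoning
    lemma₁ : ∀ s i j b → s *ℚ s *ℚ i *ℚ j *ℚ b ≡ s *ℚ s *ℚ i *ℚ (b *ℚ j)
    lemma₁ = solve-∀ ℚ-ring
    lemma₂ : ∀ s i a → s *ℚ s *ℚ i *ℚ (a *ℚ i) ≡ s *ℚ i *ℚ (s *ℚ i) *ℚ a
    lemma₂ = solve-∀ ℚ-ring
    lemma₃ : ∀ r s a i b j → i *ℚ j *ℚ (r *ℚ a *ℚ b -ℚ s *ℚ s) ≡ r *ℚ ((a *ℚ i) *ℚ (b *ℚ j)) -ℚ s *ℚ s *ℚ i *ℚ j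
    lemma₃ = solve-∀ ℚ-ring

  -- If D ≈ δ², then r = X² - D Y² is solved approximately by X + δY = r, X - δY = 1;
  -- 1 / δ is written as δ / D.
  norm-dense : ∀ {D} → D ≢ 0ℚ → Square D → Dens (Rep₂ 1ℚ (-ℚ D))
  norm-dense {D} D≢0 sq r k =
    let i , Di≡1 = inverse D≢0
        -- The final error r - q equals -c (D - δ²), so the precision of δ is chosen with respect to
        -- c.
        c = (r -ℚ 1ℚ) *ℚ (r -ℚ 1ℚ) *ℚ ¼ *ℚ i
        m , scale = V-scale c
        δ , v = sq (m ℕ.+ k)
        X = ½ *ℚ (1ℚ +ℚ r)
        Y = ½ *ℚ (r -ℚ 1ℚ) *ℚ δ *ℚ i
        q = 1ℚ *ℚ (X *ℚ X) +ℚ -ℚ D *ℚ (Y *ℚ Y)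
    in q , q , 1ℚ , rep₂ X Y refl , rep₂ 1ℚ 0ℚ (lemma₁ D) , ℚProp.1≢0 , ℚProp.*-identityʳ q ,
       V-resp (begin
         -ℚ (c *ℚ (D -ℚ δ *ℚ δ))                                   ≡⟨ lemma₂ r i D δ ⟩
         (r -ℚ 1ℚ) *ℚ (r -ℚ 1ℚ) *ℚ ¼ *ℚ (δ *ℚ δ *ℚ i *ℚ 1ℚ -ℚ D *ℚ i) ≡⟨ cong₂ (λ x y → (r -ℚ 1ℚ) *ℚ (r -ℚ 1ℚ) *ℚ ¼ *ℚ (δ *ℚ δ *ℚ i *ℚ x -ℚ y)) (sym Di≡1) Di≡1 ⟩
         (r -ℚ 1ℚ) *ℚ (r -ℚ 1ℚ) *ℚ ¼ *ℚ (δ *ℚ δ *ℚ i *ℚ (D *ℚ i) -ℚ 1ℚ) ≡⟨ lemma₃ r i D δ ⟩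
         r -ℚ q                                                    ∎) (V-neg (scale v))
    where
    open ≡-Reasoning
    lemma₁ : ∀ D → 1ℚ *ℚ (1ℚ *ℚ 1ℚ) +ℚ -ℚ D *ℚ (0ℚ *ℚ 0ℚ) ≡ 1ℚ
    lemma₁ = solve-∀ ℚ-ring
    lemma₂ : ∀ r i D δ → -ℚ ((r -ℚ 1ℚ) *ℚ (r -ℚ 1ℚ) *ℚ ¼ *ℚ i *ℚ (D -ℚ δ *ℚ δ)) ≡
      (r -ℚ 1ℚ) *ℚ (r -ℚ 1ℚ) *ℚ ¼ *ℚ (δ *ℚ δ *ℚ i *ℚ 1ℚ -ℚ D *ℚ i)
    lemma₂ = solve-∀ ℚ-ring
    lemma₃ : ∀ r i D δ → (r -ℚ 1ℚ) *ℚ (r -ℚ 1ℚ) *ℚ ¼ *ℚ (δ *ℚ δ *ℚ i *ℚ (D *ℚ i) -ℚ 1ℚ) ≡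
      r -ℚ (1ℚ *ℚ (½ *ℚ (1ℚ +ℚ r) *ℚ (½ *ℚ (1ℚ +ℚ r))) +ℚ
            -ℚ D *ℚ (½ *ℚ (r -ℚ 1ℚ) *ℚ δ *ℚ i *ℚ (½ *ℚ (r -ℚ 1ℚ) *ℚ δ *ℚ i)))
    lemma₃ = solve-∀ ℚ-ring

  -- Since d₁ (X / d₁)² + d₂ Y² = (X² + d₁ d₂ Y²) / d₁, this is a multiple of the norm form with D =
  -- -d₁ d₂.
  hyperbolic-dense : ∀ {d₁ d₂} → d₁ ≢ 0ℚ → d₂ ≢ 0ℚ → Square (-ℚ (d₁ *ℚ d₂)) → Dens (Rep₂ d₁ d₂)
  hyperbolic-dense {d₁} {d₂} d₁≢0 d₂≢0 sq = Dens-map i i≢0 f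
    (norm-dense (λ e → *-≢0 d₁≢0 d₂≢0 (trans (lemma₀ (d₁ *ℚ d₂)) (cong -ℚ_ e))) sq)
    where
    open ≡-Reasoning
    i = proj₁ (inverse d₁≢0)
    d₁i≡1 = proj₂ (inverse d₁≢0)
    lemma₀ : ∀ x → x ≡ -ℚ (-ℚ x)
    lemma₀ = solve-∀ ℚ-ring
    i≢0 : i ≢ 0ℚ
    i≢0 = *-≢0⁻ʳ {d₁} (λ e → ℚProp.1≢0 (trans (sym d₁i≡1) e))
    lemma₁ : ∀ d₁ d₂ i X Y → d₁ *ℚ (i *ℚ X *ℚ (i *ℚ X)) +ℚ d₂ *ℚ (Y *ℚ Y) ≡
      d₁ *ℚ i *ℚ (i *ℚ (X *ℚ X)) +ℚ 1ℚ *ℚ (d₂ *ℚ (Y *ℚ Y))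
    lemma₁ = solve-∀ ℚ-ring
    lemma₂ : ∀ d₁ d₂ i X Y → 1ℚ *ℚ (i *ℚ (X *ℚ X)) +ℚ d₁ *ℚ i *ℚ (d₂ *ℚ (Y *ℚ Y)) ≡
      i *ℚ (1ℚ *ℚ (X *ℚ X) +ℚ -ℚ (-ℚ (d₁ *ℚ d₂)) *ℚ (Y *ℚ Y))
    lemma₂ = solve-∀ ℚ-ring
    f : ∀ {q} → Rep₂ 1ℚ (-ℚ (-ℚ (d₁ *ℚ d₂))) q → Rep₂ d₁ d₂ (i *ℚ q)
    f (rep₂ X Y refl) = rep₂ (i *ℚ X) Y (trans (lemma₁ d₁ d₂ i X Y)
      (trans (cong₂ (λ x y → x *ℚ (i *ℚ (X *ℚ X)) +ℚ y *ℚ (d₂ *ℚ (Y *ℚ Y))) d₁i≡1 (sym d₁i≡1))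
      (lemma₂ d₁ d₂ i X Y)))

  -- Modulo rational squares, r is an integer prime to p or p times such an integer, according to
  -- the parity of its valuation.
  data SquareClass (r : ℚ) : Set where
    evenClass : ∀ s τ → s ≢ 0ℚ → Unit τ → s *ℚ s *ℚ r ≡ int τ → SquareClass r
    oddClass  : ∀ s τ → s ≢ 0ℚ → Unit τ → s *ℚ s *ℚ r ≡ int (P * τ) → SquareClass r

  data Parity : ℕ → Set where
    2*   : ∀ m → Parity (m ℕ.+ m)
    1+2* : ∀ m → Parity (suc (m ℕ.+ m))

  parity : ∀ n → Parity n
  parity zero = 2* 0
  parity (suc n) with parity n
  ... | 2* m   = 1+2* m
  ... | 1+2* m = subst Parity (cong suc (ℕₚ.+-suc m m)) (2* (suc m))

  squareClass : ∀ {r} → r ≢ 0ℚ → SquareClass r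
  squareClass {r} r≢0 = class (decompose nd≢0)
    where
    open ≡-Reasoning
    -- Numerator times denominator is r times the square of the denominator: an integer in the
    -- square class of r.
    nd = ↥ r * ↧ r
    nd≢0 : nd ≢ 0ℤ
    nd≢0 = ℤ-*-≢0 (λ e → r≢0 (ℚProp.↥p≡0⇒p≡0 r e)) (↧≢0 r)
    lemma₁ : ∀ d i r → d *ℚ i *ℚ (d *ℚ i) *ℚ r ≡ r *ℚ d *ℚ d *ℚ (i *ℚ i)
    lemma₁ = solve-∀ ℚ-ring
    lemma₂ : ∀ Q i x → Q *ℚ Q *ℚ x *ℚ (i *ℚ i) ≡ (Q *ℚ i) *ℚ (Q *ℚ i) *ℚ x
    lemma₂ = solve-∀ ℚ-ring
    module _ (m : ℕ) where
      i = proj₁ (inverse (int≢0 (P^≢0 m)))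
      Pi≡1 = proj₂ (inverse (int≢0 (P^≢0 m)))
      s = int (↧ r) *ℚ i
      s≢0 : s ≢ 0ℚ
      s≢0 = *-≢0 (int≢0 (↧≢0 r)) (*-≢0⁻ʳ {int (P ^ m)} (λ e → ℚProp.1≢0 (trans (sym Pi≡1) e)))
      s²r≡ : ∀ {t} → nd ≡ P ^ m * P ^ m * t → s *ℚ s *ℚ r ≡ int t
      s²r≡ {t} e = begin
        s *ℚ s *ℚ r                                       ≡⟨ lemma₁ (int (↧ r)) i r ⟩
        r *ℚ int (↧ r) *ℚ int (↧ r) *ℚ (i *ℚ i)           ≡⟨ cong (λ y → y *ℚ int (↧ r) *ℚ (i *ℚ i)) (fraction r) ⟩
        int (↥ r) *ℚ int (↧ r) *ℚ (i *ℚ i)                ≡⟨ cong (_*ℚ (i *ℚ i)) (int-* (↥ r) (↧ r)) ⟨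
        int nd *ℚ (i *ℚ i)                                ≡⟨ cong (λ y → int y *ℚ (i *ℚ i)) e ⟩
        int (P ^ m * P ^ m * t) *ℚ (i *ℚ i)               ≡⟨ cong (_*ℚ (i *ℚ i)) (trans (int-* (P ^ m * P ^ m) t) (cong (_*ℚ int t) (int-* (P ^ m) (P ^ m)))) ⟩
        int (P ^ m) *ℚ int (P ^ m) *ℚ int t *ℚ (i *ℚ i)   ≡⟨ lemma₂ (int (P ^ m)) i (int t) ⟩
        int (P ^ m) *ℚ i *ℚ (int (P ^ m) *ℚ i) *ℚ int t   ≡⟨ cong (λ y → y *ℚ y *ℚ int t) Pi≡1 ⟩
        1ℚ *ℚ int t                                       ≡⟨ ℚProp.*-identityˡ (int t) ⟩
        int t                                             ∎
    class : Decomposed nd → SquareClass r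
    class (decomposed e w uw eq) with parity e
    ... | 2* m   = evenClass (s m) w (s≢0 m) uw (s²r≡ m (trans eq (cong (_* w) (ℤₚ.^-distribˡ-+-* P m m))))
    ... | 1+2* m = oddClass (s m) w (s≢0 m) uw (s²r≡ m (trans eq (trans (cong (λ K → P * K * w) (ℤₚ.^-distribˡ-+-* P m m)) (lemma P (P ^ m) w))))
      where
      lemma : ∀ P K w → P * (K * K) * w ≡ K * K * (P * w)
      lemma = solve-∀ ℤ-ring

-- Ternary diagonal forms.

module Ternary (p : ℕ) (p-prime : Prime p) where
  open PAdic p p-prime
  open Density p p-prime

  module _ {M : ℤ} (M-modulus : SquareModulus M) where
    open SquareModulus M-modulus

    M∣⇒Unit : ∀ {a b} → Unit b → M ∣ℤ a - b → Unit a
    M∣⇒Unit {a} {b} ub d P∣a = ub (∣ℤ-sum P∣a (ℤ∣.∣m⇒∣-m (ℤ∣.∣-trans P∣M d)) (lemma a b))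
      where
      lemma : ∀ a b → b ≡ a + - (a - b)
      lemma = solve-∀ ℤ-ring

    -- With m - t² = c M one has m = t² (1 + 4δ) for δ = c (M / 4) / t², and δ is divisible by p
    -- because M / 4 is and t is a unit.
    unit-square : ∀ {m t} → Unit t → M ∣ℤ m - t * t → Square (int m)
    unit-square {m} {t} ut (divides c e) = subst Square t²x≡m (Square-scale (int t) (hensel vδ))
      where
      open ≡-Reasoning
      i = proj₁ (inverse (int≢0 (Unit⇒≢0 ut)))
      ti≡1 = proj₂ (inverse (int≢0 (Unit⇒≢0 ut)))
      vi : V 0 i
      vi = mkV 1ℤ t ut (trans (ℚProp.*-comm i (int t)) ti≡1)
      δ = int c *ℚ (i *ℚ i) *ℚ (¼ *ℚ int M)
      vδ : V 1 δ
      vδ = V-* (V-* (V₀-int c) (V-* vi vi)) V-M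
      lemma₁ : ∀ t c i M → t *ℚ t *ℚ (1ℚ +ℚ 4ℚ *ℚ (c *ℚ (i *ℚ i) *ℚ (¼ *ℚ M))) ≡ t *ℚ t +ℚ t *ℚ i *ℚ (t *ℚ i) *ℚ (c *ℚ M)
      lemma₁ = solve-∀ ℚ-ring
      lemma₂ : ∀ m t → t * t + 1ℤ * (m - t * t) ≡ m
      lemma₂ = solve-∀ ℤ-ring
      t²x≡m : int t *ℚ int t *ℚ (1ℚ +ℚ 4ℚ *ℚ δ) ≡ int m
      t²x≡m = begin
        int t *ℚ int t *ℚ (1ℚ +ℚ 4ℚ *ℚ δ)                                      ≡⟨ lemma₁ (int t) (int c) i (int M) ⟩
        int t *ℚ int t +ℚ int t *ℚ i *ℚ (int t *ℚ i) *ℚ (int c *ℚ int M)       ≡⟨ cong₂ (λ x y → int t *ℚ int t +ℚ x *ℚ x *ℚ y) ti≡1 (sym (trans (cong int e) (int-* c M))) ⟩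
        int t *ℚ int t +ℚ 1ℚ *ℚ 1ℚ *ℚ int (m - t * t)                          ≡⟨ cong₂ _+ℚ_ (sym (int-* t t)) (sym (int-* 1ℤ (m - t * t))) ⟩
        int (t * t) +ℚ int (1ℤ * (m - t * t))                                  ≡⟨ int-+ (t * t) (1ℤ * (m - t * t)) ⟨
        int (t * t + 1ℤ * (m - t * t))                                         ≡⟨ cong int (lemma₂ m t) ⟩
        int m                                                                  ∎

  Rep₃-scale : ∀ {d₁ d₂ d₃} c {q} → Rep₃ d₁ d₂ d₃ q → Rep₃ d₁ d₂ d₃ (c *ℚ c *ℚ q)
  Rep₃-scale {d₁} {d₂} {d₃} c (rep₃ x y z refl) = rep₃ (c *ℚ x) (c *ℚ y) (c *ℚ z) (lemma d₁ d₂ d₃ c x y z)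
    where
    lemma : ∀ d₁ d₂ d₃ c x y z → d₁ *ℚ (c *ℚ x *ℚ (c *ℚ x)) +ℚ d₂ *ℚ (c *ℚ y *ℚ (c *ℚ y)) +ℚ d₃ *ℚ (c *ℚ z *ℚ (c *ℚ z)) ≡
      c *ℚ c *ℚ (d₁ *ℚ (x *ℚ x) +ℚ d₂ *ℚ (y *ℚ y) +ℚ d₃ *ℚ (z *ℚ z))
    lemma = solve-∀ ℚ-ring

  int-form : ∀ u w x y z → 1ℚ *ℚ (int x *ℚ int x) +ℚ int u *ℚ (int y *ℚ int y) +ℚ int w *ℚ (int z *ℚ int z) ≡
    int (x * x + u * (y * y) + w * (z * z))
  int-form u w x y z = sym (begin
    int (x * x + u * (y * y) + w * (z * z))                       ≡⟨ trans (int-+ (x * x + u * (y * y)) _) (cong (_+ℚ int (w * (z * z))) (int-+ (x * x) _)) ⟩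
    int (x * x) +ℚ int (u * (y * y)) +ℚ int (w * (z * z))         ≡⟨ cong₂ (λ a b → int (x * x) +ℚ a +ℚ b) (int-*² u y) (int-*² w z) ⟩
    int (x * x) +ℚ int u *ℚ (int y *ℚ int y) +ℚ int w *ℚ (int z *ℚ int z)
      ≡⟨ cong (λ a → a +ℚ int u *ℚ (int y *ℚ int y) +ℚ int w *ℚ (int z *ℚ int z)) (trans (int-* x x) (sym (ℚProp.*-identityˡ _))) ⟩
    1ℚ *ℚ (int x *ℚ int x) +ℚ int u *ℚ (int y *ℚ int y) +ℚ int w *ℚ (int z *ℚ int z) ∎)
    where
    open ≡-Reasoning
    int-*² : ∀ u y → int (u * (y * y)) ≡ int u *ℚ (int y *ℚ int y)
    int-*² u y = trans (int-* u (y * y)) (cong (int u *ℚ_) (int-* y y))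

  Rep₃-int : ∀ u w x y z → Rep₃ 1ℚ (int u) (int w) (int (x * x + u * (y * y) + w * (z * z)))
  Rep₃-int u w x y z = rep₃ (int x) (int y) (int z) (int-form u w x y z)

  Rep₃-1 : ∀ u w → Rep₃ 1ℚ u w 1ℚ
  Rep₃-1 u w = rep₃ 1ℚ 0ℚ 0ℚ (lemma u w)
    where
    lemma : ∀ u w → 1ℚ *ℚ (1ℚ *ℚ 1ℚ) +ℚ u *ℚ (0ℚ *ℚ 0ℚ) +ℚ w *ℚ (0ℚ *ℚ 0ℚ) ≡ 1ℚ
    lemma = solve-∀ ℚ-ring

  Rep₃-last : ∀ u w → Rep₃ 1ℚ u w w
  Rep₃-last u w = rep₃ 0ℚ 0ℚ 1ℚ (lemma u w)
    where
    lemma : ∀ u w → 1ℚ *ℚ (0ℚ *ℚ 0ℚ) +ℚ u *ℚ (0ℚ *ℚ 0ℚ) +ℚ w *ℚ (1ℚ *ℚ 1ℚ) ≡ w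
    lemma = solve-∀ ℚ-ring

  approximate-class : ∀ {d₁ d₂ d₃ r s t} → s ≢ 0ℚ → s *ℚ s *ℚ r ≡ t →
    (∃[ a ] ∃[ b ] Rep₃ d₁ d₂ d₃ a × Rep₃ d₁ d₂ d₃ b × a ≢ 0ℚ × b ≢ 0ℚ × Square (t *ℚ a *ℚ b)) →
    ApproximableBy (Rep₃ d₁ d₂ d₃) r
  approximate-class {r = r} {s} s≢0 refl (a , b , wa , wb , a≢0 , b≢0 , sq) =
    approximate Rep₃-scale {r} {a} {b} wa wb a≢0 b≢0 (Square-unscale s≢0 (subst Square (lemma s r a b) sq))
    where
    lemma : ∀ s r a b → s *ℚ s *ℚ r *ℚ a *ℚ b ≡ s *ℚ s *ℚ (r *ℚ a *ℚ b)
    lemma = solve-∀ ℚ-ring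

  approximate-0 : ∀ {u w} → ApproximableBy (Rep₃ 1ℚ u w) 0ℚ
  approximate-0 {u} {w} k = 0ℚ , 0ℚ , 1ℚ , rep₃ 0ℚ 0ℚ 0ℚ (lemma u w) , Rep₃-1 u w , ℚProp.1≢0 , refl , V-0 k
    where
    lemma : ∀ u w → 1ℚ *ℚ (0ℚ *ℚ 0ℚ) +ℚ u *ℚ (0ℚ *ℚ 0ℚ) +ℚ w *ℚ (0ℚ *ℚ 0ℚ) ≡ 0ℚ
    lemma = solve-∀ ℚ-ring

  dense-by-class : ∀ {u w} →
    (∀ {τ} → Unit τ → ∃[ a ] ∃[ b ] Rep₃ 1ℚ u w a × Rep₃ 1ℚ u w b × a ≢ 0ℚ × b ≢ 0ℚ × Square (int τ *ℚ a *ℚ b)) →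
    (∀ {τ} → Unit τ → ∃[ a ] ∃[ b ] Rep₃ 1ℚ u w a × Rep₃ 1ℚ u w b × a ≢ 0ℚ × b ≢ 0ℚ × Square (int (P * τ) *ℚ a *ℚ b)) →
    Dens (Rep₃ 1ℚ u w)
  dense-by-class f g r with r ℚProp.≟ 0ℚ
  ... | yes refl = approximate-0
  ... | no r≢0 = go (squareClass r≢0)
    where
    go : SquareClass r → ApproximableBy (Rep₃ 1ℚ _ _) r
    go (evenClass s τ s≢0 uτ e) = approximate-class s≢0 e (f uτ)
    go (oddClass s τ s≢0 uτ e) = approximate-class s≢0 e (g uτ)

  module _ {M : ℤ} (M-modulus : SquareModulus M) where

    -- The vector (0,0,1) gives the value pw, so that the two classes of r reduce to each other.
    dense-1,u,pw : ∀ {u w} → Unit w →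
      (∀ {τ} → Unit τ → ∃[ x ] ∃[ y ] ∃[ z ] M ∣ℤ x * x + u * (y * y) + P * w * (z * z) - τ) →
      Dens (Rep₃ 1ℚ (int u) (int (P * w)))
    dense-1,u,pw {u} {w} uw represent = dense-by-class
      (λ {τ} uτ → let x , y , z , d = represent uτ
                      a = x * x + u * (y * y) + P * w * (z * z) in
        int a , 1ℚ , Rep₃-int u (P * w) x y z , Rep₃-1 (int u) (int (P * w)) ,
        int≢0 {a} (Unit⇒≢0 (M∣⇒Unit M-modulus uτ d)) , ℚProp.1≢0 ,
        subst Square (trans (int-* τ a) (sym (ℚProp.*-identityʳ (int τ *ℚ int a))))
          (unit-square M-modulus {τ * a} uτ (∣ℤ-multiple τ d (lemma₁ τ a))))
      (λ {τ} uτ → let x , y , z , d = represent (Unit-* uτ uw)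
                      a = x * x + u * (y * y) + P * w * (z * z) in
        int a , int (P * w) , Rep₃-int u (P * w) x y z , Rep₃-last (int u) (int (P * w)) ,
        int≢0 {a} (Unit⇒≢0 (M∣⇒Unit M-modulus (Unit-* uτ uw) d)) , int≢0 (ℤ-*-≢0 P≢0 (Unit⇒≢0 uw)) ,
        subst Square (trans (cong (int P *ℚ int P *ℚ_) (trans (int-* (τ * w) a) (cong (_*ℚ int a) (int-* τ w))))
                     (trans (lemma₃ (int P) (int τ) (int w) (int a))
                            (cong₂ (λ x y → x *ℚ int a *ℚ y) (sym (int-* P τ)) (sym (int-* P w)))))
          (Square-scale (int P) (unit-square M-modulus {τ * w * a} (Unit-* uτ uw) (∣ℤ-multiple (τ * w) d (lemma₁ (τ * w) a)))))
      where
      lemma₁ : ∀ τ a → τ * a - τ * τ ≡ τ * (a - τ)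
      lemma₁ = solve-∀ ℤ-ring
      lemma₃ : ∀ P τ w a → P *ℚ P *ℚ (τ *ℚ w *ℚ a) ≡ P *ℚ τ *ℚ a *ℚ (P *ℚ w)
      lemma₃ = solve-∀ ℚ-ring

    -- Let a = x² + u y² ≡ -w. Then -a w ≡ w² modulo M is a p-adic square, so a X² + w Z² is
    -- hyperbolic; it sits inside the ternary form through the vectors (X x, X y, Z).
    isotropic-dense : ∀ {u w} → Unit w → (∃[ x ] ∃[ y ] M ∣ℤ x * x + u * (y * y) + w) →
      Dens (Rep₃ 1ℚ (int u) (int w))
    isotropic-dense {u} {w} uw (x , y , d) = Dens-⊆ f (hyperbolic-dense (int≢0 (Unit⇒≢0 ua)) (int≢0 (Unit⇒≢0 uw))
      (subst Square (trans (int-neg (a * w)) (cong -ℚ_ (int-* a w)))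
        (unit-square M-modulus {m = - (a * w)} uw (∣ℤ-multiple (- w) d (lemma₂ x y u w)))))
      where
      -- The vanishing third term presents a as the value of the ternary form at (x, y, 0), the
      -- shape of `int-form`.
      a = x * x + u * (y * y) + w * (0ℤ * 0ℤ)
      lemma₁ : ∀ x y u w → x * x + u * (y * y) + w * (0ℤ * 0ℤ) - - w ≡ 1ℤ * (x * x + u * (y * y) + w)
      lemma₁ = solve-∀ ℤ-ring
      lemma₂ : ∀ x y u w → - ((x * x + u * (y * y) + w * (0ℤ * 0ℤ)) * w) - w * w ≡ - w * (x * x + u * (y * y) + w)
      lemma₂ = solve-∀ ℤ-ring
      ua : Unit a
      ua = M∣⇒Unit M-modulus {b = - w} (λ e → uw (∣ℤ-multiple (- 1ℤ) e (lemma w))) (∣ℤ-multiple 1ℤ d (lemma₁ x y u w))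
        where
        lemma : ∀ w → w ≡ - 1ℤ * - w
        lemma = solve-∀ ℤ-ring
      lemma₃ : ∀ x y u w X Z → 1ℚ *ℚ (X *ℚ x *ℚ (X *ℚ x)) +ℚ u *ℚ (X *ℚ y *ℚ (X *ℚ y)) +ℚ w *ℚ (Z *ℚ Z) ≡
        (1ℚ *ℚ (x *ℚ x) +ℚ u *ℚ (y *ℚ y) +ℚ w *ℚ (0ℚ *ℚ 0ℚ)) *ℚ (X *ℚ X) +ℚ w *ℚ (Z *ℚ Z)
      lemma₃ = solve-∀ ℚ-ring
      f : ∀ {q} → Rep₂ (int a) (int w) q → Rep₃ 1ℚ (int u) (int w) q
      f (rep₂ X Z refl) = rep₃ (X *ℚ int x) (X *ℚ int y) Z
        (trans (lemma₃ (int x) (int y) (int u) (int w) X Z)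
          (cong (λ b → b *ℚ (X *ℚ X) +ℚ int w *ℚ (Z *ℚ Z)) (int-form u w x y 0ℤ)))

  swap₁₂ : ∀ {d₁ d₂ d₃} → Dens (Rep₃ d₂ d₁ d₃) → Dens (Rep₃ d₁ d₂ d₃)
  swap₁₂ {d₁} {d₂} {d₃} = Dens-⊆ λ { (rep₃ x y z refl) → rep₃ y x z (lemma d₁ d₂ d₃ x y z) }
    where
    lemma : ∀ d₁ d₂ d₃ x y z → d₁ *ℚ (y *ℚ y) +ℚ d₂ *ℚ (x *ℚ x) +ℚ d₃ *ℚ (z *ℚ z) ≡ d₂ *ℚ (x *ℚ x) +ℚ d₁ *ℚ (y *ℚ y) +ℚ d₃ *ℚ (z *ℚ z)
    lemma = solve-∀ ℚ-ring

  swap₂₃ : ∀ {d₁ d₂ d₃} → Dens (Rep₃ d₁ d₃ d₂) → Dens (Rep₃ d₁ d₂ d₃)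
  swap₂₃ {d₁} {d₂} {d₃} = Dens-⊆ λ { (rep₃ x y z refl) → rep₃ x z y (lemma d₁ d₂ d₃ x y z) }
    where
    lemma : ∀ d₁ d₂ d₃ x y z → d₁ *ℚ (x *ℚ x) +ℚ d₂ *ℚ (z *ℚ z) +ℚ d₃ *ℚ (y *ℚ y) ≡ d₁ *ℚ (x *ℚ x) +ℚ d₃ *ℚ (y *ℚ y) +ℚ d₂ *ℚ (z *ℚ z)
    lemma = solve-∀ ℚ-ring

  rescale₁ : ∀ {d₁ d₂ d₃} s {e₁} → s *ℚ s *ℚ d₁ ≡ e₁ → Dens (Rep₃ e₁ d₂ d₃) → Dens (Rep₃ d₁ d₂ d₃)
  rescale₁ {d₁} {d₂} {d₃} s refl = Dens-⊆ λ { (rep₃ x y z refl) → rep₃ (s *ℚ x) y z (lemma d₁ d₂ d₃ s x y z) }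
    where
    lemma : ∀ d₁ d₂ d₃ s x y z → d₁ *ℚ (s *ℚ x *ℚ (s *ℚ x)) +ℚ d₂ *ℚ (y *ℚ y) +ℚ d₃ *ℚ (z *ℚ z) ≡
      s *ℚ s *ℚ d₁ *ℚ (x *ℚ x) +ℚ d₂ *ℚ (y *ℚ y) +ℚ d₃ *ℚ (z *ℚ z)
    lemma = solve-∀ ℚ-ring

  rescale₂ : ∀ {d₁ d₂ d₃} s {e₂} → s *ℚ s *ℚ d₂ ≡ e₂ → Dens (Rep₃ d₁ e₂ d₃) → Dens (Rep₃ d₁ d₂ d₃)
  rescale₂ s e = swap₁₂ ∘ rescale₁ s e ∘ swap₁₂

  rescale₃ : ∀ {d₁ d₂ d₃} s {e₃} → s *ℚ s *ℚ d₃ ≡ e₃ → Dens (Rep₃ d₁ d₂ e₃) → Dens (Rep₃ d₁ d₂ d₃)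
  rescale₃ s e = swap₂₃ ∘ rescale₂ s e ∘ swap₂₃

  multiply : ∀ {d₁ d₂ d₃} c → c ≢ 0ℚ → Dens (Rep₃ (c *ℚ d₁) (c *ℚ d₂) (c *ℚ d₃)) → Dens (Rep₃ d₁ d₂ d₃)
  multiply {d₁} {d₂} {d₃} c c≢0 = Dens-map i (*-≢0⁻ʳ {c} (λ e → ℚProp.1≢0 (trans (sym ci≡1) e)))
    λ { (rep₃ x y z refl) → rep₃ x y z
      (trans (sym (ℚProp.*-identityˡ _)) (trans (cong (_*ℚ _) (sym ci≡1)) (lemma d₁ d₂ d₃ c i x y z))) }
    where
    i = proj₁ (inverse c≢0)
    ci≡1 = proj₂ (inverse c≢0)
    lemma : ∀ d₁ d₂ d₃ c i x y z → c *ℚ i *ℚ (d₁ *ℚ (x *ℚ x) +ℚ d₂ *ℚ (y *ℚ y) +ℚ d₃ *ℚ (z *ℚ z)) ≡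
      i *ℚ (c *ℚ d₁ *ℚ (x *ℚ x) +ℚ c *ℚ d₂ *ℚ (y *ℚ y) +ℚ c *ℚ d₃ *ℚ (z *ℚ z))
    lemma = solve-∀ ℚ-ring

  module _
    (dense-units : ∀ {u w} → Unit u → Unit w → Dens (Rep₃ 1ℚ (int u) (int w)))
    (dense-mixed : ∀ {u w} → Unit u → Unit w → Dens (Rep₃ 1ℚ (int u) (int (P * w)))) where

    -- Multiplying the form by a turns its first coefficient into a², which a change of variable
    -- reduces to 1.
    normalise : ∀ {a b c} → Unit a → Dens (Rep₃ 1ℚ (int (a * b)) (int (a * c))) → Dens (Rep₃ (int a) (int b) (int c))
    normalise {a} {b} {c} ua dens = multiply (int a) (int≢0 (Unit⇒≢0 ua))
      (subst₂ (λ y z → Dens (Rep₃ (int a *ℚ int a) y z)) (int-* a b) (int-* a c)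
        (rescale₁ i (trans (lemma i (int a)) (cong (λ y → y *ℚ y) ai≡1)) dens))
      where
      i = proj₁ (inverse (int≢0 (Unit⇒≢0 ua)))
      ai≡1 = proj₂ (inverse (int≢0 (Unit⇒≢0 ua)))
      lemma : ∀ i a → i *ℚ i *ℚ (a *ℚ a) ≡ a *ℚ i *ℚ (a *ℚ i)
      lemma = solve-∀ ℚ-ring

    units : ∀ {a b c} → Unit a → Unit b → Unit c → Dens (Rep₃ (int a) (int b) (int c))
    units ua ub uc = normalise ua (dense-units (Unit-* ua ub) (Unit-* ua uc))

    mixed : ∀ {a b c} → Unit a → Unit b → Unit c → Dens (Rep₃ (int a) (int b) (int (P * c)))
    mixed {a} {b} {c} ua ub uc = normalise ua
      (subst (λ y → Dens (Rep₃ 1ℚ (int (a * b)) (int y))) (lemma P a c) (dense-mixed (Unit-* ua ub) (Unit-* ua uc)))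
      where
      lemma : ∀ P a c → P * (a * c) ≡ a * (P * c)
      lemma = solve-∀ ℤ-ring

    private
      P⁻¹ = proj₁ (inverse (int≢0 P≢0))
      P-cancel : ∀ a → P⁻¹ *ℚ P⁻¹ *ℚ (int P *ℚ int (P * a)) ≡ int a
      P-cancel a = trans (cong (λ y → P⁻¹ *ℚ P⁻¹ *ℚ (int P *ℚ y)) (int-* P a)) (trans (lemma P⁻¹ (int P) (int a))
        (trans (cong (λ y → y *ℚ y *ℚ int a) (proj₂ (inverse (int≢0 P≢0)))) (ℚProp.*-identityˡ (int a))))
        where
        lemma : ∀ i P a → i *ℚ i *ℚ (P *ℚ (P *ℚ a)) ≡ P *ℚ i *ℚ (P *ℚ i) *ℚ a
        lemma = solve-∀ ℚ-ring

    -- Multiplication by p exchanges the two kinds of coefficients: p · p a is a up to the square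
    -- p².
    units′ : ∀ {a b c} → Unit a → Unit b → Unit c → Dens (Rep₃ (int (P * a)) (int (P * b)) (int (P * c)))
    units′ {a} {b} {c} ua ub uc = multiply (int P) (int≢0 P≢0)
      (rescale₁ P⁻¹ (P-cancel a) (rescale₂ P⁻¹ (P-cancel b) (rescale₃ P⁻¹ (P-cancel c) (units ua ub uc))))

    mixed′ : ∀ {a b c} → Unit a → Unit b → Unit c → Dens (Rep₃ (int (P * a)) (int (P * b)) (int c))
    mixed′ {a} {b} {c} ua ub uc = multiply (int P) (int≢0 P≢0)
      (rescale₁ P⁻¹ (P-cancel a) (rescale₂ P⁻¹ (P-cancel b)
        (subst (λ y → Dens (Rep₃ (int a) (int b) y)) (int-* P c) (mixed ua ub uc))))

    -- Two of the three valuations have equal parity. Multiplying by p where necessary makes these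
    -- two coefficients units up to squares, and a permutation puts the remaining coefficient last.
    ternary-dense : ∀ {d₁ d₂ d₃} → d₁ ≢ 0ℚ → d₂ ≢ 0ℚ → d₃ ≢ 0ℚ → Dens (Rep₃ d₁ d₂ d₃)
    ternary-dense {d₁} {d₂} {d₃} d₁≢0 d₂≢0 d₃≢0 = go (squareClass d₁≢0) (squareClass d₂≢0) (squareClass d₃≢0)
      where
      go : SquareClass d₁ → SquareClass d₂ → SquareClass d₃ → Dens (Rep₃ d₁ d₂ d₃)
      go (evenClass s a _ ua e) (evenClass s′ b _ ub e′) (evenClass s″ c _ uc e″) =
        rescale₁ s e (rescale₂ s′ e′ (rescale₃ s″ e″ (units ua ub uc)))
      go (evenClass s a _ ua e) (evenClass s′ b _ ub e′) (oddClass s″ c _ uc e″) =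
        rescale₁ s e (rescale₂ s′ e′ (rescale₃ s″ e″ (mixed ua ub uc)))
      go (evenClass s a _ ua e) (oddClass s′ b _ ub e′) (evenClass s″ c _ uc e″) =
        rescale₁ s e (rescale₂ s′ e′ (rescale₃ s″ e″ (swap₂₃ (mixed ua uc ub))))
      go (evenClass s a _ ua e) (oddClass s′ b _ ub e′) (oddClass s″ c _ uc e″) =
        rescale₁ s e (rescale₂ s′ e′ (rescale₃ s″ e″ (swap₁₂ (swap₂₃ (mixed′ ub uc ua)))))
      go (oddClass s a _ ua e) (evenClass s′ b _ ub e′) (evenClass s″ c _ uc e″) =
        rescale₁ s e (rescale₂ s′ e′ (rescale₃ s″ e″ (swap₁₂ (swap₂₃ (mixed ub uc ua)))))
      go (oddClass s a _ ua e) (evenClass s′ b _ ub e′) (oddClass s″ c _ uc e″) =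
        rescale₁ s e (rescale₂ s′ e′ (rescale₃ s″ e″ (swap₂₃ (mixed′ ua uc ub))))
      go (oddClass s a _ ua e) (oddClass s′ b _ ub e′) (evenClass s″ c _ uc e″) =
        rescale₁ s e (rescale₂ s′ e′ (rescale₃ s″ e″ (mixed′ ua ub uc)))
      go (oddClass s a _ ua e) (oddClass s′ b _ ub e′) (oddClass s″ c _ uc e″) =
        rescale₁ s e (rescale₂ s′ e′ (rescale₃ s″ e″ (units′ ua ub uc)))

-- Congruences and reduction to residues.

-- A record, so that its type determines both sides; the difference alone does not.
record Cong (d a b : ℤ) : Set where
  constructor mkCong
  field difference : d ∣ℤ a - b
open Cong using (difference)

cong-refl : ∀ {d a} → Cong d a a
cong-refl {d} {a} = mkCong (divides 0ℤ (ℤₚ.+-inverseʳ a))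

cong-sym : ∀ {d a b} → Cong d a b → Cong d b a
cong-sym {d} {a} {b} (mkCong e) = mkCong (∣ℤ-multiple (- 1ℤ) e (lemma a b))
  where
  lemma : ∀ a b → b - a ≡ - 1ℤ * (a - b)
  lemma = solve-∀ ℤ-ring

cong-trans : ∀ {d a b c} → Cong d a b → Cong d b c → Cong d a c
cong-trans {d} {a} {b} {c} (mkCong e) (mkCong f) = mkCong (∣ℤ-sum e f (lemma a b c))
  where
  lemma : ∀ a b c → a - c ≡ a - b + (b - c)
  lemma = solve-∀ ℤ-ring

cong-+ : ∀ {d a b a′ b′} → Cong d a b → Cong d a′ b′ → Cong d (a + a′) (b + b′)
cong-+ {d} {a} {b} {a′} {b′} (mkCong e) (mkCong f) = mkCong (∣ℤ-sum e f (lemma a b a′ b′))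
  where
  lemma : ∀ a b a′ b′ → a + a′ - (b + b′) ≡ a - b + (a′ - b′)
  lemma = solve-∀ ℤ-ring

cong-* : ∀ {d a b a′ b′} → Cong d a b → Cong d a′ b′ → Cong d (a * a′) (b * b′)
cong-* {d} {a} {b} {a′} {b′} (mkCong e) (mkCong f) =
  mkCong (∣ℤ-sum (ℤ∣.∣n⇒∣m*n a′ e) (ℤ∣.∣n⇒∣m*n b f) (lemma a b a′ b′))
  where
  lemma : ∀ a b a′ b′ → a * a′ - b * b′ ≡ a′ * (a - b) + b * (a′ - b′)
  lemma = solve-∀ ℤ-ring

cong-neg : ∀ {d a b} → Cong d a b → Cong d (- a) (- b)
cong-neg {d} {a} {b} (mkCong e) = mkCong (∣ℤ-multiple (- 1ℤ) e (lemma a b))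
  where
  lemma : ∀ a b → - a - - b ≡ - 1ℤ * (a - b)
  lemma = solve-∀ ℤ-ring

cong-coarsen : ∀ {d d′ a b} → d′ ∣ℤ d → Cong d a b → Cong d′ a b
cong-coarsen d′∣d (mkCong e) = mkCong (ℤ∣.∣-trans d′∣d e)

cong-∣ : ∀ {d a b} → Cong d a b → d ∣ℤ b → d ∣ℤ a
cong-∣ {d} {a} {b} (mkCong e) f = ∣ℤ-sum e f (lemma a b)
  where
  lemma : ∀ a b → a ≡ a - b + b
  lemma = solve-∀ ℤ-ring

-- Refinement of a congruence by one digit: if z = c + d q, then r is q modulo n. Starting from
-- modulus 1, where everything is congruent, this yields residues of any shape.
residue : ∀ {c d z} n .{{_ : ℕ.NonZero n}} → Cong d z c → ∃[ r ] Cong (d * + n) z (c + d * + toℕ {n} r)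
residue {c} {d} {z} n (mkCong (divides q e)) = Fin.fromℕ< (ℤDM.n%ℕd<d q n) , mkCong (divides (q ℤ./ℕ n) (begin
  z - (c + d * + toℕ (Fin.fromℕ< (ℤDM.n%ℕd<d q n)))   ≡⟨ cong (λ i → z - (c + d * + i)) (Finₚ.toℕ-fromℕ< (ℤDM.n%ℕd<d q n)) ⟩
  z - (c + d * + (q ℤ.%ℕ n))                          ≡⟨ lemma₁ z c d (+ (q ℤ.%ℕ n)) ⟩
  (z - c) - d * + (q ℤ.%ℕ n)                          ≡⟨ cong (_- d * + (q ℤ.%ℕ n)) (trans e (cong (_* d) (ℤDM.a≡a%ℕn+[a/ℕn]*n q n))) ⟩
  (+ (q ℤ.%ℕ n) + (q ℤ./ℕ n) * + n) * d - d * + (q ℤ.%ℕ n) ≡⟨ lemma₂ (+ (q ℤ.%ℕ n)) (q ℤ./ℕ n) (+ n) d ⟩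
  (q ℤ./ℕ n) * (d * + n)                              ∎))
  where
  open ≡-Reasoning
  lemma₁ : ∀ z c d r → z - (c + d * r) ≡ z - c - d * r
  lemma₁ = solve-∀ ℤ-ring
  lemma₂ : ∀ r q n d → (r + q * n) * d - d * r ≡ q * (d * n)
  lemma₂ = solve-∀ ℤ-ring

cong-1 : ∀ z → Cong 1ℤ z 0ℤ
cong-1 z = mkCong (divides (z - 0ℤ) (sym (ℤₚ.*-identityʳ (z - 0ℤ))))

∣-small⇒≡ : ∀ {n a b} → a ℕ.< n → b ℕ.< n → + n ∣ℤ + a - + b → a ≡ b
∣-small⇒≡ {n} {a} {b} a<n b<n d = ℤₚ.+-injective (ℤₚ.i-j≡0⇒i≡j (+ a) (+ b) (ℤₚ.∣i∣≡0⇒i≡0 (small (ℤ∣.∣⇒∣ᵤ d) bound)))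
  where
  bound : ∣ + a - + b ∣ ℕ.< n
  bound = ℕₚ.≤-<-trans (subst (λ i → ∣ i ∣ ℕ.≤ a ℕ.⊔ b) (sym (ℤₚ.m-n≡m⊖n a b)) (ℤₚ.∣m⊝n∣≤m⊔n a b)) (ℕₚ.⊔-lub a<n b<n)
  small : ∀ {n m} → n ∣ m → m ℕ.< n → m ≡ 0
  small {m = zero}  _ _   = refl
  small {m = suc _} e m<n = contradiction m<n (ℕₚ.≤⇒≯ (ℕ∣.∣⇒≤ e))

-- Insolubility of r z² = u² - D v².

module Anisotropy (p : ℕ) (p-prime : Prime p) where
  open PAdic p p-prime

  -- Bézout's identity for p and the remainder of z. Over ℕ it comes with either of two signs,
  -- whence the two cases.
  unit-inverse : ∀ {z} → Unit z → ∃[ z′ ] P ∣ℤ z * z′ - 1ℤ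
  unit-inverse {z} uz = bézout (coprime-Bézout (prime⇒coprime p-prime {{ℕ.≢-nonZero r≢0}} (ℤDM.n%ℕd<d z p)))
    where
    open ≡-Reasoning
    r = z ℤ.%ℕ p
    c = z ℤ./ℕ p
    z≡ : z ≡ + r + c * P
    z≡ = ℤDM.a≡a%ℕn+[a/ℕn]*n z p
    r≢0 : r ≢ 0
    r≢0 r≡0 = uz (divides c (trans z≡ (trans (cong (λ i → + i + c * P) r≡0) (ℤₚ.+-identityˡ (c * P)))))
    lemma₁ : ∀ c P y r x → (r + c * P) * - y - 1ℤ ≡ - (x + c * y) * P + (x * P - (1ℤ + y * r))
    lemma₁ = solve-∀ ℤ-ring
    lemma₂ : ∀ c P y r x → (r + c * P) * y - 1ℤ ≡ (x + c * y) * P + (y * r - (1ℤ + x * P))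
    lemma₂ = solve-∀ ℤ-ring
    cast : ∀ {x y m n} → 1 ℕ.+ y ℕ.* n ≡ x ℕ.* m → + x * + m - (1ℤ + + y * + n) ≡ 0ℤ
    cast {x} {y} {m} {n} e = trans (cong₂ _-_ (sym (ℤₚ.pos-* x m)) (trans (cong (λ i → 1ℤ + i) (sym (ℤₚ.pos-* y n))) (trans (sym (ℤₚ.pos-+ 1 (y ℕ.* n))) (cong +_ e))))
      (ℤₚ.+-inverseʳ (+ (x ℕ.* m)))
    bézout : Bézout.Identity 1 p r → ∃[ z′ ] P ∣ℤ z * z′ - 1ℤ
    bézout (Bézout.+- x y e) = - + y , divides (- (+ x + c * + y)) (trans (cong (λ i → i * - + y - 1ℤ) z≡)
      (trans (lemma₁ c P (+ y) (+ r) (+ x)) (trans (cong (λ i → - (+ x + c * + y) * P + i) (cast {x} {y} {p} {r} e)) (ℤₚ.+-identityʳ _))))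
    bézout (Bézout.-+ x y e) = + y , divides (+ x + c * + y) (trans (cong (λ i → i * + y - 1ℤ) z≡)
      (trans (lemma₂ c P (+ y) (+ r) (+ x)) (trans (cong (λ i → (+ x + c * + y) * P + i) (cast {y} {x} {r} {p} e)) (ℤₚ.+-identityʳ _))))

  -- Some r is not even modulo p³ of the form (u² - D v²) / z² with u, v, z not all divisible by p.
  Anisotropic : ℤ → Set
  Anisotropic D = ∃[ r ] ∀ u v z → P ^ 3 ∣ℤ r * (z * z) - u * u + D * (v * v) → P ∣ℤ u × P ∣ℤ v × P ∣ℤ z

  P²∣-from : ∀ {x} → P ^ 3 ∣ℤ x → P * P ∣ℤ x
  P²∣-from {x} (divides q e) = divides (q * P) (trans e (lemma q P))
    where
    lemma : ∀ q P → q * (P * (P * (P * 1ℤ))) ≡ q * P * (P * P)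
    lemma = solve-∀ ℤ-ring

  P∣-from : ∀ {x} → P * P ∣ℤ x → P ∣ℤ x
  P∣-from {x} (divides q e) = divides (q * P) (trans e (sym (ℤₚ.*-assoc q P P)))

-- Odd p.

module OddPrime (p : ℕ) (p-prime : Prime p) (p>2 : p > 2) where
  open PAdic p p-prime
  open Density p p-prime
  open Ternary p p-prime
  open Anisotropy p p-prime

  Unit-2 : Unit (+ 2)
  Unit-2 d = ℕₚ.<⇒≱ p>2 (ℕ∣.∣⇒≤ (ℤ∣.∣⇒∣ᵤ d))

  p-modulus : SquareModulus P
  p-modulus = record
    { P∣M = ℤ∣.∣-refl
    ; V-M = mkV 1ℤ (+ 4) (Unit-* Unit-2 Unit-2) (trans (lemma (int P)) (cong int (sym (lemmaℤ P))))
    }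
    where
    lemma : ∀ x → ¼ *ℚ x *ℚ 4ℚ ≡ x
    lemma = solve-∀ ℚ-ring
    lemmaℤ : ∀ P → P * 1ℤ * 1ℤ ≡ P
    lemmaℤ = solve-∀ ℤ-ring

  half : ∃[ m ] p ≡ suc (m ℕ.+ m)
  half = go (parity p) refl
    where
    go : ∀ {n} → Parity n → n ≡ p → ∃[ m ] p ≡ suc (m ℕ.+ m)
    go (1+2* m) e = m , sym e
    go (2* m)   e = ⊥-elim ([ (λ ()) , (λ 2≡p → ℕₚ.<⇒≢ p>2 2≡p) ]′ (prime⇒irreducible p-prime 2∣p))
      where
      2∣p : 2 ∣ p
      2∣p = ℕ∣.divides m (trans (sym e) (trans (cong (m ℕ.+_) (sym (ℕₚ.+-identityʳ m))) (ℕₚ.*-comm 2 m)))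

  residue-class : ℤ → Fin p
  residue-class z = Fin.fromℕ< (ℤDM.n%ℕd<d z p)

  residue-class-≡ : ∀ a b → residue-class a ≡ residue-class b → P ∣ℤ a - b
  residue-class-≡ a b e = divides (a ℤ./ℕ p - b ℤ./ℕ p) (begin
    a - b                                                       ≡⟨ cong₂ _-_ (ℤDM.a≡a%ℕn+[a/ℕn]*n a p) (ℤDM.a≡a%ℕn+[a/ℕn]*n b p) ⟩
    + (a ℤ.%ℕ p) + a/p * P - (+ (b ℤ.%ℕ p) + b/p * P)           ≡⟨ cong (λ r → + r + a/p * P - (+ (b ℤ.%ℕ p) + b/p * P)) (Finₚ.fromℕ<-injective _ _ _ _ e) ⟩
    + (b ℤ.%ℕ p) + a/p * P - (+ (b ℤ.%ℕ p) + b/p * P)           ≡⟨ lemma (+ (b ℤ.%ℕ p)) a/p b/p P ⟩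
    (a/p - b/p) * P                                             ∎)
    where
    open ≡-Reasoning
    a/p = a ℤ./ℕ p
    b/p = b ℤ./ℕ p
    lemma : ∀ r x y P → r + x * P - (r + y * P) ≡ (x - y) * P
    lemma = solve-∀ ℤ-ring

  -- The root is the residue of u / v.
  root : ∀ {d} u v → Unit v → P ∣ℤ u * u - d * (v * v) → ∃[ x ] P ∣ℤ + toℕ {p} x * + toℕ x - d
  root {d} u v uv e = x , difference (cong-trans
      (cong-* x≡ x≡)
      (cong-trans (mkCong (∣ℤ-multiple (v′ * v′) e (lemma₁ u v v′ d)))
        (cong-trans (cong-* (cong-refl {P} {d}) (cong-* vv′≡1 vv′≡1)) (subst (λ y → Cong P y d) (sym (ℤₚ.*-identityʳ d)) cong-refl))))
    where
    v′ = proj₁ (unit-inverse uv)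
    vv′≡1 : Cong P (v * v′) 1ℤ
    vv′≡1 = mkCong (proj₂ (unit-inverse uv))
    x = proj₁ (residue p (cong-1 (u * v′)))
    x≡ : Cong P (+ toℕ x) (u * v′)
    x≡ = cong-sym (subst₂ (λ m y → Cong m (u * v′) y) (ℤₚ.*-identityˡ P) (trans (ℤₚ.+-identityˡ (1ℤ * + toℕ x)) (ℤₚ.*-identityˡ (+ toℕ x)))
      (proj₂ (residue p (cong-1 (u * v′)))))
    lemma₁ : ∀ u v v′ d → u * v′ * (u * v′) - d * (v * v′ * (v * v′)) ≡ v′ * v′ * (u * u - d * (v * v))
    lemma₁ = solve-∀ ℤ-ring

  -- The squares and the values t - u y² each take (p + 1) / 2 values modulo p.
  binary-represents : ∀ {u} t → Unit u → ∃[ x ] ∃[ y ] P ∣ℤ x * x + u * (y * y) - t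
  binary-represents {u} t uu = collide (Finₚ.pigeonhole p<n value)
    where
    m = proj₁ half
    n = suc m ℕ.+ suc m
    p<n : p ℕ.< n
    p<n = ℕₚ.≤-reflexive (trans (cong suc (proj₂ half)) (sym (cong suc (ℕₚ.+-suc m m))))
    sq : Fin (suc m) → ℤ
    sq x = + toℕ x * + toℕ x
    value′ : Fin (suc m) ⊎ Fin (suc m) → Fin p
    value′ (inj₁ x) = residue-class (sq x)
    value′ (inj₂ y) = residue-class (t - u * sq y)
    value : Fin n → Fin p
    value i = value′ (Fin.splitAt (suc m) i)
    toℕ≤m : (x : Fin (suc m)) → toℕ x ℕ.≤ m
    toℕ≤m x = ℕ.s≤s⁻¹ (Finₚ.toℕ<n x)
    <p : ∀ {k} → k ℕ.≤ m ℕ.+ m → k ℕ.< p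
    <p k≤ = subst (_ ℕ.<_) (sym (proj₂ half)) (ℕ.s≤s k≤)
    -- For x, y ≤ m and p = 2m + 1, both x - y and x + y are smaller than p in absolute value, so p
    -- divides one of them only if it is 0.
    sq-injective : ∀ x y → P ∣ℤ sq x - sq y → x ≡ y
    sq-injective x y d = [ difference-case , sum-case ]′ (euclid {a - b} {a + b} (subst (P ∣ℤ_) (lemma a b) d))
      where
      a = + toℕ x
      b = + toℕ y
      lemma : ∀ a b → a * a - b * b ≡ (a - b) * (a + b)
      lemma = solve-∀ ℤ-ring
      difference-case : P ∣ℤ a - b → x ≡ y
      difference-case e = Finₚ.toℕ-injective (∣-small⇒≡
        (<p (ℕₚ.≤-trans (toℕ≤m x) (ℕₚ.m≤m+n m m))) (<p (ℕₚ.≤-trans (toℕ≤m y) (ℕₚ.m≤m+n m m))) e)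
      sum-case : P ∣ℤ a + b → x ≡ y
      sum-case e = Finₚ.toℕ-injective (trans (ℕₚ.m+n≡0⇒m≡0 (toℕ x) x+y≡0) (sym (ℕₚ.m+n≡0⇒n≡0 (toℕ x) x+y≡0)))
        where
        x+y≡0 : toℕ x ℕ.+ toℕ y ≡ 0
        x+y≡0 = ∣-small⇒≡ (<p (ℕₚ.+-mono-≤ (toℕ≤m x) (toℕ≤m y))) (<p ℕ.z≤n)
          (subst (P ∣ℤ_) (sym (trans (ℤₚ.+-identityʳ (+ (toℕ x ℕ.+ toℕ y))) (ℤₚ.pos-+ (toℕ x) (toℕ y)))) e)
    lemma₁ : ∀ x y t u → u * (x - y) ≡ - 1ℤ * (t - u * x - (t - u * y))
    lemma₁ = solve-∀ ℤ-ring
    lemma₂ : ∀ x y t u → x + u * y - t ≡ 1ℤ * (x - (t - u * y))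
    lemma₂ = solve-∀ ℤ-ring
    collision : ∀ {x y} → P ∣ℤ sq x - (t - u * sq y) → ∃[ x ] ∃[ y ] P ∣ℤ x * x + u * (y * y) - t
    collision {x} {y} e = + toℕ x , + toℕ y , ∣ℤ-multiple 1ℤ e (lemma₂ (sq x) (sq y) t u)
    -- A collision between the two families solves the congruence. Within one family it is excluded,
    -- because distinct elements of 0, ..., m have distinct squares modulo p and u is invertible.
    compare : ∀ {i j} k l → i ≢ j → Fin.join (suc m) (suc m) k ≡ i → Fin.join (suc m) (suc m) l ≡ j →
      value′ k ≡ value′ l → ∃[ x ] ∃[ y ] P ∣ℤ x * x + u * (y * y) - t
    compare (inj₁ x) (inj₂ y) _ _ _ e = collision {x} {y} (residue-class-≡ (sq x) (t - u * sq y) e)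
    compare (inj₂ y) (inj₁ x) _ _ _ e = collision {x} {y} (residue-class-≡ (sq x) (t - u * sq y) (sym e))
    compare (inj₁ x) (inj₁ y) i≢j refl refl e = contradiction
      (cong (Fin._↑ˡ suc m) (sq-injective x y (residue-class-≡ (sq x) (sq y) e))) i≢j
    compare (inj₂ x) (inj₂ y) i≢j refl refl e = contradiction
      (cong (suc m Fin.↑ʳ_) (sq-injective x y ([ (λ P∣u → contradiction P∣u uu) , (λ d → d) ]′
        (euclid {u} {sq x - sq y} (∣ℤ-multiple (- 1ℤ) (residue-class-≡ (t - u * sq x) (t - u * sq y) e) (lemma₁ (sq x) (sq y) t u)))))) i≢j
    collide : (∃[ i ] ∃[ j ] i Fin.< j × value i ≡ value j) → ∃[ x ] ∃[ y ] P ∣ℤ x * x + u * (y * y) - t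
    collide (i , j , i<j , e) = compare (Fin.splitAt (suc m) i) (Fin.splitAt (suc m) j) (Finₚ.<⇒≢ i<j)
      (Finₚ.join-splitAt (suc m) (suc m) i) (Finₚ.join-splitAt (suc m) (suc m) j) e

  -- Modulo p the binary part x² + u y² already represents every residue: -w, which makes ⟨1,u,w⟩
  -- isotropic, and any unit τ, for which z = 0 is taken in ⟨1,u,pw⟩.
  odd-ternary-dense : ∀ {d₁ d₂ d₃} → d₁ ≢ 0ℚ → d₂ ≢ 0ℚ → d₃ ≢ 0ℚ → Dens (Rep₃ d₁ d₂ d₃)
  odd-ternary-dense = ternary-dense
    (λ {u} {w} uu uw → isotropic-dense p-modulus {u} {w} uw
      (let x , y , d = binary-represents (- w) uu in
       x , y , subst (P ∣ℤ_) (cong (λ v → x * x + u * (y * y) + v) (ℤₚ.neg-involutive w)) d))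
    (λ {u} {w} uu uw → dense-1,u,pw p-modulus {u} {w} uw λ {τ} _ →
      let x , y , d = binary-represents τ uu in
      x , y , 0ℤ , ∣ℤ-multiple 1ℤ d (lemma x y u (P * w) τ))
    where
    lemma : ∀ x y u w τ → x * x + u * (y * y) + w * (0ℤ * 0ℤ) - τ ≡ 1ℤ * (x * x + u * (y * y) - τ)
    lemma = solve-∀ ℤ-ring

  -- If every residue had a root, choosing roots would map p residues injectively to p - 1
  -- candidates.
  nonresidue : ∃[ ε ] ¬ (∃[ x ] P ∣ℤ + toℕ {p} x * + toℕ x - ε)
  nonresidue = let i , h = Finₚ.¬∀⟶∃¬ p _ residue? ¬all in + toℕ i , h
    where
    Residue : Fin p → Set
    Residue i = ∃[ x ] P ∣ℤ + toℕ {p} x * + toℕ x - + toℕ i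
    residue? : ∀ i → Dec (Residue i)
    residue? i = Finₚ.any? λ x → P ℤ∣.∣? (+ toℕ x * + toℕ x - + toℕ i)
    q = ℕ.pred p
    p≡ : suc q ≡ p
    p≡ = ℕₚ.suc-pred p
    1<q : 1 ℕ.< q
    1<q = ℕ.s≤s⁻¹ (subst (2 ℕ.<_) (sym p≡) p>2)
    one : Fin q
    one = Fin.fromℕ< 1<q
    -- The roots p - 1 and 1 have the same square, so p - 1 is never needed.
    shrink : ∀ {i} → Residue i → ∃[ x ] P ∣ℤ + toℕ {q} x * + toℕ x - + toℕ i
    shrink {i} (x , d) with toℕ x ℕₚ.<? q
    ... | yes x<q = Fin.fromℕ< x<q , subst (λ n → P ∣ℤ + n * + n - + toℕ i) (sym (Finₚ.toℕ-fromℕ< x<q)) d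
    ... | no  x≮q = one , subst (λ n → P ∣ℤ + n * + n - + toℕ i) (sym (Finₚ.toℕ-fromℕ< 1<q))
        (∣ℤ-sum d (∣ℤ-multiple (- (a - 1ℤ)) (ℤ∣.∣-reflexive P≡) refl) (lemma a (+ toℕ i)))
      where
      a = + toℕ x
      P≡ : P ≡ a + 1ℤ
      P≡ = trans (cong +_ (trans (sym p≡) (trans (cong suc (ℕₚ.≤-antisym (ℕₚ.≮⇒≥ x≮q) (ℕ.s≤s⁻¹ (subst (toℕ x ℕ.<_) (sym p≡) (Finₚ.toℕ<n x))))) (ℕₚ.+-comm 1 (toℕ x))))) (ℤₚ.pos-+ (toℕ x) 1)
      lemma : ∀ a i → + 1 * + 1 - i ≡ a * a - i + - (a - 1ℤ) * (a + 1ℤ)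
      lemma = solve-∀ ℤ-ring
    ¬all : ¬ (∀ i → Residue i)
    ¬all all = collide (Finₚ.pigeonhole q<p rt)
      where
      q<p : q ℕ.< p
      q<p = ℕₚ.≤-reflexive p≡
      rt : Fin p → Fin q
      rt i = proj₁ (shrink (all i))
      lemma : ∀ x i j → i - j ≡ x - j - (x - i)
      lemma = solve-∀ ℤ-ring
      collide : ¬ (∃[ i ] ∃[ j ] i Fin.< j × rt i ≡ rt j)
      collide (i , j , i<j , e) = Finₚ.<⇒≢ i<j (Finₚ.toℕ-injective (∣-small⇒≡ (Finₚ.toℕ<n i) (Finₚ.toℕ<n j)
        (subst (P ∣ℤ_) (sym (lemma (x * x) (+ toℕ i) (+ toℕ j)))
          (ℤ∣.∣m∣n⇒∣m-n (subst (λ r → P ∣ℤ + toℕ r * + toℕ r - + toℕ j) (sym e) (proj₂ (shrink (all j)))) (proj₂ (shrink (all i)))))))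
        where x = + toℕ (rt i)

  Residue : ℤ → Set
  Residue d = ∃[ x ] P ∣ℤ + toℕ {p} x * + toℕ x - d

  -- If v were a unit, u / v would be a square root of d modulo p.
  nonresidue⇒∣ : ∀ {d} → ¬ Residue d → ∀ u v → P ∣ℤ u * u - d * (v * v) → P ∣ℤ u × P ∣ℤ v
  nonresidue⇒∣ {d} nr u v e with P ℤ∣.∣? v
  ... | no uv    = contradiction (root u v uv e) nr
  ... | yes P∣v  = P∣x²⇒P∣x (∣ℤ-sum e (ℤ∣.∣n⇒∣m*n d (ℤ∣.∣n⇒∣m*n v P∣v)) (lemma (u * u) (d * (v * v)))) , P∣v
    where
    lemma : ∀ x y → x ≡ x - y + y
    lemma = solve-∀ ℤ-ring

  -- Take r = ε, a nonresidue. Modulo p the term in v drops out and ε z² ≡ u² forces p to divide u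
  -- and z. Modulo p² only p w v² is then left, so p divides v.
  anisotropic-ramified : ∀ {w} → Unit w → Anisotropic (P * w)
  anisotropic-ramified {w} uw = ε , λ u v z d →
    let P²∣ = P²∣-from d
        P∣u , P∣z = nonresidue⇒∣ nr u z (∣ℤ-sum (∣ℤ-multiple (- 1ℤ) (P∣-from P²∣) refl) (ℤ∣.∣m⇒∣m*n {P} (w * (v * v)) ℤ∣.∣-refl) (lemma₁ P ε w u v z))
    in P∣u , P∣x²⇒P∣x ([ (λ P∣w → contradiction P∣w uw) , (λ e → e) ]′ (euclid {w} {v * v} (go {u} {v} {z} P²∣ P∣u P∣z))) , P∣z
    where
    ε = proj₁ nonresidue
    nr = proj₂ nonresidue
    lemma₁ : ∀ P ε w u v z → u * u - ε * (z * z) ≡ - 1ℤ * (ε * (z * z) - u * u + P * w * (v * v)) + P * (w * (v * v))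
    lemma₁ = solve-∀ ℤ-ring
    go : ∀ {u v z} → P * P ∣ℤ ε * (z * z) - u * u + P * w * (v * v) → P ∣ℤ u → P ∣ℤ z → P ∣ℤ w * (v * v)
    go {v = v} (divides q e) (divides u′ refl) (divides z′ refl) = divides (q - ε * (z′ * z′) + u′ * u′)
      (ℤ-*-cancelˡ P≢0 (trans (lemma P ε w u′ v z′) (trans (cong (_- (ε * (z′ * P * (z′ * P)) - u′ * P * (u′ * P))) e) (lemma′ P ε u′ z′ q))))
      where
      lemma : ∀ P ε w u v z → P * (w * (v * v)) ≡ ε * (z * P * (z * P)) - u * P * (u * P) + P * w * (v * v) - (ε * (z * P * (z * P)) - u * P * (u * P))
      lemma = solve-∀ ℤ-ring
      lemma′ : ∀ P ε u z q → q * (P * P) - (ε * (z * P * (z * P)) - u * P * (u * P)) ≡ P * ((q - ε * (z * z) + u * u) * P)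
      lemma′ = solve-∀ ℤ-ring

  -- Take r = p. Modulo p the congruence u² ≡ w v² forces p to divide u and v. Modulo p² only p z²
  -- is then left, so p divides z.
  anisotropic-inert : ∀ {w} → ¬ Residue w → Anisotropic w
  anisotropic-inert {w} nr = P , λ u v z d →
    let P²∣ = P²∣-from d
        P∣u , P∣v = nonresidue⇒∣ nr u v (∣ℤ-sum (∣ℤ-multiple (- 1ℤ) (P∣-from P²∣) refl) (ℤ∣.∣m⇒∣m*n {P} (z * z) ℤ∣.∣-refl) (lemma₁ P w u v z))
    in P∣u , P∣v , P∣x²⇒P∣x (go {u} {v} {z} P²∣ P∣u P∣v)
    where
    lemma₁ : ∀ P w u v z → u * u - w * (v * v) ≡ - 1ℤ * (P * (z * z) - u * u + w * (v * v)) + P * (z * z)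
    lemma₁ = solve-∀ ℤ-ring
    go : ∀ {u v z} → P * P ∣ℤ P * (z * z) - u * u + w * (v * v) → P ∣ℤ u → P ∣ℤ v → P ∣ℤ z * z
    go {z = z} (divides q e) (divides u′ refl) (divides v′ refl) = divides (q + u′ * u′ - w * (v′ * v′))
      (ℤ-*-cancelˡ P≢0 (trans (lemma P w u′ v′ z) (trans (cong (_- (- (u′ * P * (u′ * P)) + w * (v′ * P * (v′ * P)))) e) (lemma′ P w u′ v′ q))))
      where
      lemma : ∀ P w u v z → P * (z * z) ≡ P * (z * z) - u * P * (u * P) + w * (v * P * (v * P)) - (- (u * P * (u * P)) + w * (v * P * (v * P)))
      lemma = solve-∀ ℤ-ring
      lemma′ : ∀ P w u v q → q * (P * P) - (- (u * P * (u * P)) + w * (v * P * (v * P))) ≡ P * ((q + u * u - w * (v * v)) * P)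
      lemma′ = solve-∀ ℤ-ring

-- The prime 2.

module EvenPrime (2-prime : Prime 2) where
  open PAdic 2 2-prime
  open Density 2 2-prime
  open Ternary 2 2-prime
  open Anisotropy 2 2-prime

  8-modulus : SquareModulus (+ 8)
  8-modulus = record { P∣M = divides (+ 4) refl ; V-M = mkV 1ℤ 1ℤ Unit-1 refl }

  -- Three ranges occur: `lift 1ℤ (+ 2)` on `Fin 4` lists the odd residues modulo 8, `lift 1ℤ (+ 4)`
  -- on `Fin 4` the residues modulo 16 that are 1 modulo 4, and `lift 0ℤ 1ℤ` on `Fin 8` all residues
  -- modulo 8.
  lift : ∀ {n} → ℤ → ℤ → Fin n → ℤ
  lift c d r = c + d * + toℕ r

  form : (u w : ℤ) (x y z : ℤ) → ℤ
  form u w x y z = x * x + u * (y * y) + w * (z * z)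

  -- The condition in `Anisotropic` for p = 2, restricted to representatives modulo 8 and hence
  -- decidable.
  Only-even : (r D : ℤ) → Set
  Only-even r D = ∀ (u v z : Fin 8) →
    + 8 ∣ℤ r * (lift 0ℤ 1ℤ z * lift 0ℤ 1ℤ z) - lift 0ℤ 1ℤ u * lift 0ℤ 1ℤ u + D * (lift 0ℤ 1ℤ v * lift 0ℤ 1ℤ v) →
    + 2 ∣ℤ lift 0ℤ 1ℤ u × + 2 ∣ℤ lift 0ℤ 1ℤ v × + 2 ∣ℤ lift 0ℤ 1ℤ z

  abstract
    -- Abstract, since unfolding these decision procedures at open terms stalls type checking.
    represent-unit₈ : ∀ (a b c : Fin 4) → ∃[ x ] ∃[ y ] ∃[ z ]
      + 8 ∣ℤ form (lift 1ℤ (+ 2) a) (+ 2 * lift 1ℤ (+ 2) b) (+ toℕ {3} x) (+ toℕ {3} y) (+ toℕ {3} z) - lift 1ℤ (+ 2) c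
    represent-unit₈ = toWitness {a? = Finₚ.all? λ a → Finₚ.all? λ b → Finₚ.all? λ c →
      Finₚ.any? λ x → Finₚ.any? λ y → Finₚ.any? λ z → + 8 ℤ∣.∣? _} _

    -- The second alternative cannot be merged into the first: if u and w are 1 modulo 4, the form
    -- is x² + y² + z² modulo 4, which vanishes only at even vectors.
    isotropic-or-1mod4 : ∀ (a b : Fin 4) →
      (∃[ x ] ∃[ y ] + 8 ∣ℤ + toℕ {3} x * + toℕ x + lift 1ℤ (+ 2) a * (+ toℕ {3} y * + toℕ y) + lift 1ℤ (+ 2) b) ⊎
      (+ 4 ∣ℤ lift 1ℤ (+ 2) a - 1ℤ × + 4 ∣ℤ lift 1ℤ (+ 2) b - 1ℤ)
    isotropic-or-1mod4 = toWitness {a? = Finₚ.all? λ a → Finₚ.all? λ b →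
      (Finₚ.any? λ x → Finₚ.any? λ y → + 8 ℤ∣.∣? _) ⊎-dec ((+ 4 ℤ∣.∣? _) ×-dec (+ 4 ℤ∣.∣? _))} _

    -- A product of two values, since a single one can miss a class. The vectors (1, 0, 0) and (1,
    -- 2, 0) give 1 and 5 modulo 8, and (1, 1, 1) gives a value that is 3 modulo 4; the products
    -- meet all odd residues.
    represent-ratio₈ : ∀ (a b c : Fin 4) → ∃[ x ] ∃[ y ] ∃[ e ]
      + 8 ∣ℤ form (lift 1ℤ (+ 4) a) (lift 1ℤ (+ 4) b) (+ toℕ {3} x) (+ toℕ {3} y) 0ℤ *
             form (lift 1ℤ (+ 4) a) (lift 1ℤ (+ 4) b) 1ℤ (+ toℕ {2} e) (+ toℕ {2} e) - lift 1ℤ (+ 2) c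
    represent-ratio₈ = toWitness {a? = Finₚ.all? λ a → Finₚ.all? λ b → Finₚ.all? λ c →
      Finₚ.any? λ x → Finₚ.any? λ y → Finₚ.any? λ e → + 8 ℤ∣.∣? _} _

    -- Modulo 16, so that the half of the value is still determined modulo 8.
    represent-2·unit₁₆ : ∀ (a b c : Fin 4) → ∃[ x ] ∃[ y ] ∃[ z ]
      + 16 ∣ℤ form (lift 1ℤ (+ 4) a) (lift 1ℤ (+ 4) b) (+ toℕ {4} x) (+ toℕ {4} y) (+ toℕ {4} z) - + 2 * lift 1ℤ (+ 2) c
    represent-2·unit₁₆ = toWitness {a? = Finₚ.all? λ a → Finₚ.all? λ b → Finₚ.all? λ c →
      Finₚ.any? λ x → Finₚ.any? λ y → Finₚ.any? λ z → + 16 ℤ∣.∣? _} _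

    only-even? : ∀ r D → Dec (Only-even r D)
    only-even? r D = Finₚ.all? λ u → Finₚ.all? λ v → Finₚ.all? λ z →
      (+ 8 ℤ∣.∣? _) →-dec ((+ 2 ℤ∣.∣? _) ×-dec (+ 2 ℤ∣.∣? _) ×-dec (+ 2 ℤ∣.∣? _))

    -- Here and below r is chosen with Hilbert symbol -1 against D at the prime 2: 5 against twice
    -- any odd number, -1 against 3 and 7, and 2 against 5.
    only-even-ramified : ∀ (b : Fin 4) → Only-even (+ 5) (+ 2 * lift 1ℤ (+ 2) b)
    only-even-ramified = toWitness {a? = Finₚ.all? λ b → only-even? (+ 5) (+ 2 * lift 1ℤ (+ 2) b)} _

    only-even-3 : Only-even -1ℤ (+ 3)
    only-even-3 = toWitness {a? = only-even? -1ℤ (+ 3)} _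

    only-even-5 : Only-even (+ 2) (+ 5)
    only-even-5 = toWitness {a? = only-even? (+ 2) (+ 5)} _

    only-even-7 : Only-even -1ℤ (+ 7)
    only-even-7 = toWitness {a? = only-even? -1ℤ (+ 7)} _

  unit⇒odd : ∀ {z} → Unit z → Cong (+ 2) z 1ℤ
  unit⇒odd {z} uz = go (residue 2 (cong-1 z))
    where
    go : (∃[ r ] Cong (+ 2) z (0ℤ + 1ℤ * + toℕ {2} r)) → Cong (+ 2) z 1ℤ
    go (zero     , c) = ⊥-elim (uz (cong-∣ c (divides 0ℤ refl)))
    go (suc zero , c) = c

  unit-residue : ∀ {z} → Unit z → ∃[ r ] Cong (+ 8) z (lift {4} 1ℤ (+ 2) r)
  unit-residue uz = residue 4 (unit⇒odd uz)

  cong-form : ∀ {d u u′ w w′} x y z → Cong d u u′ → Cong d w w′ → Cong d (form u w x y z) (form u′ w′ x y z)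
  cong-form x y z u≡ w≡ =
    cong-+ (cong-+ (cong-refl {a = x * x}) (cong-* u≡ (cong-refl {a = y * y}))) (cong-* w≡ (cong-refl {a = z * z}))

  transfer : ∀ {d a a′ t t′} → Cong d a a′ → Cong d t t′ → d ∣ℤ a′ - t′ → d ∣ℤ a - t
  transfer a≡ t≡ e = difference (cong-trans a≡ (cong-trans (mkCong e) (cong-sym t≡)))

  dense-1,u,2w : ∀ {u w} → Unit u → Unit w → Dens (Rep₃ 1ℚ (int u) (int (P * w)))
  dense-1,u,2w {u} {w} uu uw = dense-1,u,pw 8-modulus {u} {w} uw λ uτ →
    let a , u≡ = unit-residue uu
        b , w≡ = unit-residue uw
        c , τ≡ = unit-residue uτ
        x , y , z , e = represent-unit₈ a b c
    in + toℕ x , + toℕ y , + toℕ z ,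
       transfer (cong-form (+ toℕ x) (+ toℕ y) (+ toℕ z) u≡ (cong-* (cong-refl {a = + 2}) w≡)) τ≡ e

  module _ {u w : ℤ} (u≡1 : Cong (+ 4) u 1ℤ) (w≡1 : Cong (+ 4) w 1ℤ) where

    private
      a = proj₁ (residue 4 u≡1)
      b = proj₁ (residue 4 w≡1)
      u₁₆ : Cong (+ 16) u (lift 1ℤ (+ 4) a)
      u₁₆ = proj₂ (residue 4 u≡1)
      w₁₆ : Cong (+ 16) w (lift 1ℤ (+ 4) b)
      w₁₆ = proj₂ (residue 4 w≡1)
      8∣16 : + 8 ∣ℤ + 16
      8∣16 = divides (+ 2) refl

    -- The product of the two values satisfies f g ≡ τ modulo 8, hence τ f g ≡ τ² and Hensel's lemma
    -- applies.
    unit-class : ∀ {τ} → Unit τ → ∃[ a ] ∃[ b ] Rep₃ 1ℚ (int u) (int w) a × Rep₃ 1ℚ (int u) (int w) b ×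
      a ≢ 0ℚ × b ≢ 0ℚ × Square (int τ *ℚ a *ℚ b)
    unit-class {τ} uτ = int f , int g , Rep₃-int u w (+ toℕ x) (+ toℕ y) 0ℤ , Rep₃-int u w 1ℤ (+ toℕ e) (+ toℕ e) ,
      *-≢0⁻ˡ fg≢0 , *-≢0⁻ʳ {int f} fg≢0 ,
      subst Square (trans (int-* τ (f * g)) (trans (cong (int τ *ℚ_) (int-* f g)) (sym (ℚProp.*-assoc (int τ) (int f) (int g)))))
        (unit-square 8-modulus {τ * (f * g)} uτ (∣ℤ-multiple τ 8∣ (lemma τ (f * g))))
      where
      c = proj₁ (unit-residue uτ)
      x = proj₁ (represent-ratio₈ a b c)
      y = proj₁ (proj₂ (represent-ratio₈ a b c))
      e = proj₁ (proj₂ (proj₂ (represent-ratio₈ a b c)))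
      f = form u w (+ toℕ x) (+ toℕ y) 0ℤ
      g = form u w 1ℤ (+ toℕ e) (+ toℕ e)
      8∣ : + 8 ∣ℤ f * g - τ
      8∣ = transfer
        (cong-* (cong-form (+ toℕ x) (+ toℕ y) 0ℤ (cong-coarsen 8∣16 u₁₆) (cong-coarsen 8∣16 w₁₆))
                (cong-form 1ℤ (+ toℕ e) (+ toℕ e) (cong-coarsen 8∣16 u₁₆) (cong-coarsen 8∣16 w₁₆)))
        (proj₂ (unit-residue uτ)) (proj₂ (proj₂ (proj₂ (represent-ratio₈ a b c))))
      fg≢0 : int f *ℚ int g ≢ 0ℚ
      fg≢0 h = int≢0 {f * g} (Unit⇒≢0 (M∣⇒Unit 8-modulus uτ 8∣)) (trans (int-* f g) h)
      lemma : ∀ τ a → τ * a - τ * τ ≡ τ * (a - τ)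
      lemma = solve-∀ ℤ-ring

    -- A value f ≡ 2τ modulo 16 is 2κ with κ ≡ τ modulo 8. Then 2τ · f = 4 τ κ, and τ κ ≡ τ² modulo
    -- 8 is a square.
    2·unit-class : ∀ {τ} → Unit τ → ∃[ a ] ∃[ b ] Rep₃ 1ℚ (int u) (int w) a × Rep₃ 1ℚ (int u) (int w) b ×
      a ≢ 0ℚ × b ≢ 0ℚ × Square (int (P * τ) *ℚ a *ℚ b)
    2·unit-class {τ} uτ = int f , 1ℚ , Rep₃-int u w (+ toℕ x) (+ toℕ y) (+ toℕ z) , Rep₃-1 (int u) (int w) ,
      int≢0 {f} (λ f≡0 → ℤ-*-≢0 P≢0 (Unit⇒≢0 uκ) (trans (sym f≡2κ) f≡0)) , ℚProp.1≢0 ,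
      subst Square square≡ (Square-scale {int (τ * κ)} (int P) (unit-square 8-modulus {τ * κ} uτ (divides (τ * q) (lemma₂ τ q))))
      where
      c = proj₁ (unit-residue uτ)
      x = proj₁ (represent-2·unit₁₆ a b c)
      y = proj₁ (proj₂ (represent-2·unit₁₆ a b c))
      z = proj₁ (proj₂ (proj₂ (represent-2·unit₁₆ a b c)))
      f = form u w (+ toℕ x) (+ toℕ y) (+ toℕ z)
      2τ≡ : Cong (+ 16) (+ 2 * τ) (+ 2 * lift 1ℤ (+ 2) c)
      2τ≡ = double (proj₂ (unit-residue uτ))
        where
        lemma : ∀ q a b → + 2 * a - + 2 * b ≡ + 2 * (a - b)
        lemma = λ _ → solve-∀ ℤ-ring
        lemma′ : ∀ q → + 2 * (q * + 8) ≡ q * + 16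
        lemma′ = solve-∀ ℤ-ring
        double : ∀ {a b} → Cong (+ 8) a b → Cong (+ 16) (+ 2 * a) (+ 2 * b)
        double {a} {b} (mkCong (divides q e)) = mkCong (divides q (trans (lemma q a b) (trans (cong (+ 2 *_) e) (lemma′ q))))
      16∣ : + 16 ∣ℤ f - + 2 * τ
      16∣ = transfer (cong-form (+ toℕ x) (+ toℕ y) (+ toℕ z) u₁₆ w₁₆) 2τ≡ (proj₂ (proj₂ (proj₂ (represent-2·unit₁₆ a b c))))
      q = _∣ℤ_.quotient 16∣
      κ = τ + q * + 8
      lemma₁ : ∀ f τ q → f - + 2 * τ ≡ q * + 16 → f ≡ + 2 * (τ + q * + 8)
      lemma₁ f τ q e = trans (l f τ) (trans (cong (_+ + 2 * τ) e) (l′ τ q))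
        where
        l : ∀ f τ → f ≡ f - + 2 * τ + + 2 * τ
        l = solve-∀ ℤ-ring
        l′ : ∀ τ q → q * + 16 + + 2 * τ ≡ + 2 * (τ + q * + 8)
        l′ = solve-∀ ℤ-ring
      f≡2κ : f ≡ P * κ
      f≡2κ = lemma₁ f τ q (_∣ℤ_.equality 16∣)
      lemma₂ : ∀ τ q → τ * (τ + q * + 8) - τ * τ ≡ τ * q * + 8
      lemma₂ = solve-∀ ℤ-ring
      uκ : Unit κ
      uκ = M∣⇒Unit 8-modulus uτ (divides q (lemma τ q))
        where
        lemma : ∀ τ q → τ + q * + 8 - τ ≡ q * + 8
        lemma = solve-∀ ℤ-ring
      lemma₃ : ∀ P τ κ → P *ℚ P *ℚ (τ *ℚ κ) ≡ P *ℚ τ *ℚ (P *ℚ κ) *ℚ 1ℚ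
      lemma₃ = solve-∀ ℚ-ring
      square≡ : int P *ℚ int P *ℚ int (τ * κ) ≡ int (P * τ) *ℚ int f *ℚ 1ℚ
      square≡ = trans (cong (int P *ℚ int P *ℚ_) (int-* τ κ)) (trans (lemma₃ (int P) (int τ) (int κ))
        (cong₂ (λ i j → i *ℚ j *ℚ 1ℚ) (sym (int-* P τ)) (trans (sym (int-* P κ)) (cong int (sym f≡2κ)))))

  dense-1,u,w : ∀ {u w} → Unit u → Unit w → Dens (Rep₃ 1ℚ (int u) (int w))
  dense-1,u,w {u} {w} uu uw = [ isotropic , 1mod4 ]′ (isotropic-or-1mod4 a b)
    where
    a = proj₁ (unit-residue uu)
    b = proj₁ (unit-residue uw)
    u≡ = proj₂ (unit-residue uu)
    w≡ = proj₂ (unit-residue uw)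
    isotropic : (∃[ x ] ∃[ y ] + 8 ∣ℤ + toℕ {3} x * + toℕ x + lift 1ℤ (+ 2) a * (+ toℕ {3} y * + toℕ y) + lift 1ℤ (+ 2) b) →
      Dens (Rep₃ 1ℚ (int u) (int w))
    isotropic (x , y , e) = isotropic-dense 8-modulus {u} {w} uw (+ toℕ x , + toℕ y ,
      cong-∣ (cong-+ (cong-+ (cong-refl {a = + toℕ x * + toℕ x}) (cong-* u≡ (cong-refl {a = + toℕ y * + toℕ y}))) w≡) e)
    4∣8 : + 4 ∣ℤ + 8
    4∣8 = divides (+ 2) refl
    1mod4 : + 4 ∣ℤ lift 1ℤ (+ 2) a - 1ℤ × + 4 ∣ℤ lift 1ℤ (+ 2) b - 1ℤ → Dens (Rep₃ 1ℚ (int u) (int w))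
    1mod4 (u∣ , w∣) = dense-by-class (unit-class u≡1 w≡1) (2·unit-class u≡1 w≡1)
      where
      u≡1 = cong-trans (cong-coarsen 4∣8 u≡) (mkCong u∣)
      w≡1 = cong-trans (cong-coarsen 4∣8 w≡) (mkCong w∣)

  even-ternary-dense : ∀ {d₁ d₂ d₃} → d₁ ≢ 0ℚ → d₂ ≢ 0ℚ → d₃ ≢ 0ℚ → Dens (Rep₃ d₁ d₂ d₃)
  even-ternary-dense = ternary-dense dense-1,u,w dense-1,u,2w

  -- Here p³ = 8, and both the divisibility by 8 and the parities depend only on residues modulo 8.
  only-even⇒anisotropic : ∀ {r D D′} → Cong (+ 8) D D′ → Only-even r D′ → Anisotropic D
  only-even⇒anisotropic {r} {D} {D′} D≡ h = r , λ u v z d →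
    let u′ , u≡ = residue {0ℤ} {1ℤ} 8 (cong-1 u)
        v′ , v≡ = residue {0ℤ} {1ℤ} 8 (cong-1 v)
        z′ , z≡ = residue {0ℤ} {1ℤ} 8 (cong-1 z)
        2∣u , 2∣v , 2∣z = h u′ v′ z′ (cong-∣ (cong-sym (cong-+
          (cong-+ (cong-* (cong-refl {+ 8} {r}) (cong-* z≡ z≡)) (cong-neg (cong-* u≡ u≡))) (cong-* D≡ (cong-* v≡ v≡)))) d)
    in cong-∣ (cong-coarsen 2∣8 u≡) 2∣u , cong-∣ (cong-coarsen 2∣8 v≡) 2∣v , cong-∣ (cong-coarsen 2∣8 z≡) 2∣z
    where
    2∣8 : + 2 ∣ℤ + 8
    2∣8 = divides (+ 4) refl

  anisotropic-ramified : ∀ {w} → Unit w → Anisotropic (P * w)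
  anisotropic-ramified uw = let b , w≡ = unit-residue uw in
    only-even⇒anisotropic {+ 5} (cong-* (cong-refl {a = + 2}) w≡) (only-even-ramified b)

  anisotropic-inert : ∀ {w} → Unit w → ¬ + 8 ∣ℤ w - 1ℤ → Anisotropic w
  anisotropic-inert {w} uw 8∤ = go (unit-residue uw)
    where
    go : (∃[ r ] Cong (+ 8) w (lift {4} 1ℤ (+ 2) r)) → Anisotropic w
    go (zero               , c) = contradiction (difference c) 8∤
    go (suc zero           , c) = only-even⇒anisotropic { -1ℤ} c only-even-3
    go (suc (suc zero)     , c) = only-even⇒anisotropic {+ 2} c only-even-5
    go (suc (suc (suc zero)) , c) = only-even⇒anisotropic { -1ℤ} c only-even-7

-- Diagonalisation over ℚ.

det-cong : ∀ {n} {M N : Matrix n} → (∀ i j → M i j ≡ N i j) → det M ≡ det N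
det-cong {zero}  _ = refl
det-cong {suc n} {M} {N} h = sum-cong-≗ {suc n} λ j → cong₂ (λ m d → sign j *ℚ m *ℚ d) (h zero j)
  (det-cong {n} λ i k → h (suc i) (Fin.punchIn j k))
  where
  sign : Fin (suc n) → ℚ
  sign j = (-ℚ 1ℚ) ^ℚ toℕ j

-- M = A Cᵀ + B Dᵀ. This form of the rank condition passes to minors by deleting entries of the four
-- vectors.
record RankAtMost2 {n} (M : Matrix n) : Set where
  constructor rank≤2
  field
    A B C D : Fin n → ℚ
    entry   : ∀ i j → M i j ≡ A i *ℚ C j +ℚ B i *ℚ D j

-- The minors in the Laplace expansion again have rank at most 2, which reduces everything to a
-- polynomial identity for 3 × 3 matrices.
det-rank≤2 : ∀ n {M : Matrix (3 ℕ.+ n)} → RankAtMost2 M → det M ≡ 0ℚ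
det-rank≤2 zero {M} (rank≤2 A B C D entry) = trans (det-cong entry) (lemma
  (A zero) (A (suc zero)) (A (suc (suc zero))) (B zero) (B (suc zero)) (B (suc (suc zero)))
  (C zero) (C (suc zero)) (C (suc (suc zero))) (D zero) (D (suc zero)) (D (suc (suc zero))))
  where
  -- The left side is the unfolded Laplace expansion, including the factors 1 and the final summands
  -- 0.
  lemma : ∀ a₀ a₁ a₂ b₀ b₁ b₂ c₀ c₁ c₂ d₀ d₁ d₂ →
    let m₀₀ = a₀ *ℚ c₀ +ℚ b₀ *ℚ d₀; m₀₁ = a₀ *ℚ c₁ +ℚ b₀ *ℚ d₁; m₀₂ = a₀ *ℚ c₂ +ℚ b₀ *ℚ d₂
        m₁₀ = a₁ *ℚ c₀ +ℚ b₁ *ℚ d₀; m₁₁ = a₁ *ℚ c₁ +ℚ b₁ *ℚ d₁; m₁₂ = a₁ *ℚ c₂ +ℚ b₁ *ℚ d₂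
        m₂₀ = a₂ *ℚ c₀ +ℚ b₂ *ℚ d₀; m₂₁ = a₂ *ℚ c₁ +ℚ b₂ *ℚ d₁; m₂₂ = a₂ *ℚ c₂ +ℚ b₂ *ℚ d₂
        det₂ = λ (m₀₀ m₀₁ m₁₀ m₁₁ : ℚ) →
          1ℚ *ℚ m₀₀ *ℚ (1ℚ *ℚ m₁₁ *ℚ 1ℚ +ℚ 0ℚ) +ℚ (-ℚ 1ℚ *ℚ m₀₁ *ℚ (1ℚ *ℚ m₁₀ *ℚ 1ℚ +ℚ 0ℚ) +ℚ 0ℚ)
    in 1ℚ *ℚ m₀₀ *ℚ det₂ m₁₁ m₁₂ m₂₁ m₂₂ +ℚ
       (-ℚ 1ℚ *ℚ m₀₁ *ℚ det₂ m₁₀ m₁₂ m₂₀ m₂₂ +ℚ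
       (1ℚ *ℚ m₀₂ *ℚ det₂ m₁₀ m₁₁ m₂₀ m₂₁ +ℚ 0ℚ)) ≡ 0ℚ
  lemma = solve-∀ ℚ-ring
det-rank≤2 (suc n) {M} (rank≤2 A B C D entry) = trans
  (sum-cong-≗ {4 ℕ.+ n} λ j → trans
    (cong (λ d → (-ℚ 1ℚ) ^ℚ toℕ j *ℚ M zero j *ℚ d) (det-rank≤2 n
      (rank≤2 (A ∘ suc) (B ∘ suc) (C ∘ Fin.punchIn j) (D ∘ Fin.punchIn j) λ i k → entry (suc i) (Fin.punchIn j k))))
    (ℚProp.*-zeroʳ ((-ℚ 1ℚ) ^ℚ toℕ j *ℚ M zero j)))
  (sum-replicate-zero (4 ℕ.+ n))

Vec : ℕ → Set
Vec n = Fin n → ℚ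

dot : ∀ {n} → Vec n → Vec n → ℚ
dot x y = sumℚ λ i → x i *ℚ y i

dot-congʳ : ∀ {n} (x : Vec n) {y y′} → (∀ i → y i ≡ y′ i) → dot x y ≡ dot x y′
dot-congʳ x h = sum-cong-≗ λ i → cong (x i *ℚ_) (h i)

dot-comm : ∀ {n} (x y : Vec n) → dot x y ≡ dot y x
dot-comm x y = sum-cong-≗ λ i → ℚProp.*-comm (x i) (y i)

dot-linear : ∀ {n} (x y z : Vec n) c → dot x (λ i → y i +ℚ c *ℚ z i) ≡ dot x y +ℚ c *ℚ dot x z
dot-linear x y z c = begin
  sumℚ (λ i → x i *ℚ (y i +ℚ c *ℚ z i))                       ≡⟨ sum-cong-≗ (λ i → lemma (x i) (y i) c (z i)) ⟩
  sumℚ (λ i → x i *ℚ y i +ℚ c *ℚ (x i *ℚ z i))                ≡⟨ ∑-distrib-+ (λ i → x i *ℚ y i) (λ i → c *ℚ (x i *ℚ z i)) ⟩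
  dot x y +ℚ sumℚ (λ i → c *ℚ (x i *ℚ z i))                   ≡⟨ cong (dot x y +ℚ_) (*-distribˡ-sum c (λ i → x i *ℚ z i)) ⟨
  dot x y +ℚ c *ℚ dot x z                                     ∎
  where
  open ≡-Reasoning
  lemma : ∀ x y c z → x *ℚ (y +ℚ c *ℚ z) ≡ x *ℚ y +ℚ c *ℚ (x *ℚ z)
  lemma = solve-∀ ℚ-ring

dot-0 : ∀ {n} (x : Vec n) → dot x (λ _ → 0ℚ) ≡ 0ℚ
dot-0 {n} x = trans (sum-cong-≗ λ i → ℚProp.*-zeroʳ (x i)) (sum-replicate-zero n)

basis : ∀ {n} → Fin n → Vec n
basis zero    zero    = 1ℚ
basis zero    (suc _) = 0ℚ
basis (suc _) zero    = 0ℚ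
basis (suc i) (suc j) = basis i j

dot-basis : ∀ {n} (x : Vec n) i → dot x (basis i) ≡ x i
dot-basis {suc n} x zero = trans (cong₂ _+ℚ_ (ℚProp.*-identityʳ (x zero)) (dot-0 (x ∘ suc))) (ℚProp.+-identityʳ (x zero))
dot-basis {suc n} x (suc i) = trans (cong₂ _+ℚ_ (ℚProp.*-zeroʳ (x zero)) (dot-basis (x ∘ suc) i)) (ℚProp.+-identityˡ (x (suc i)))

apply : ∀ {n} → Matrix n → Vec n → Vec n
apply M x i = dot (M i) x

quad : ∀ {n} → Matrix n → Vec n → ℚ
quad M x = dot x (apply M x)

Symmetric : ∀ {n} → Matrix n → Set
Symmetric M = ∀ i j → M i j ≡ M j i

dot-apply-comm : ∀ {n} {M : Matrix n} → Symmetric M → ∀ x y → dot x (apply M y) ≡ dot y (apply M x)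
dot-apply-comm {n} {M} sym-M x y = begin
  sumℚ (λ i → x i *ℚ dot (M i) y)                       ≡⟨ sum-cong-≗ (λ i → *-distribˡ-sum (x i) (λ j → M i j *ℚ y j)) ⟩
  sumℚ (λ i → sumℚ (λ j → x i *ℚ (M i j *ℚ y j)))       ≡⟨ ∑-comm (λ i j → x i *ℚ (M i j *ℚ y j)) ⟩
  sumℚ (λ j → sumℚ (λ i → x i *ℚ (M i j *ℚ y j)))       ≡⟨ sum-cong-≗ (λ j → sum-cong-≗ λ i → trans (lemma (x i) (M i j) (y j)) (cong (λ m → y j *ℚ (m *ℚ x i)) (sym-M i j))) ⟩
  sumℚ (λ j → sumℚ (λ i → y j *ℚ (M j i *ℚ x i)))       ≡⟨ sum-cong-≗ (λ j → *-distribˡ-sum (y j) (λ i → M j i *ℚ x i)) ⟨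
  sumℚ (λ j → y j *ℚ dot (M j) x)                       ∎
  where
  open ≡-Reasoning
  lemma : ∀ x m y → x *ℚ (m *ℚ y) ≡ y *ℚ (m *ℚ x)
  lemma = solve-∀ ℚ-ring

quad-translate : ∀ {n} {M : Matrix n} → Symmetric M → ∀ x v c →
  quad M (λ i → x i +ℚ c *ℚ v i) ≡ quad M x +ℚ 2ℚ *ℚ c *ℚ dot (apply M v) x +ℚ c *ℚ c *ℚ quad M v
quad-translate {n} {M} sym-M x v c = begin
  dot y (apply M y)                                            ≡⟨ dot-congʳ y (λ i → dot-linear (M i) x v c) ⟩
  dot y (λ i → apply M x i +ℚ c *ℚ apply M v i)                ≡⟨ dot-linear y (apply M x) (apply M v) c ⟩
  dot y (apply M x) +ℚ c *ℚ dot y (apply M v)                  ≡⟨ cong₂ (λ a b → a +ℚ c *ℚ b) (expand (apply M x)) (expand (apply M v)) ⟩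
  dot (apply M x) x +ℚ c *ℚ dot (apply M x) v +ℚ c *ℚ (dot (apply M v) x +ℚ c *ℚ dot (apply M v) v)
    ≡⟨ cong₂ (λ a b → a +ℚ c *ℚ b +ℚ c *ℚ (dot (apply M v) x +ℚ c *ℚ dot (apply M v) v)) (dot-comm (apply M x) x)
         (trans (dot-comm (apply M x) v) (trans (dot-apply-comm sym-M v x) (dot-comm x (apply M v)))) ⟩
  quad M x +ℚ c *ℚ s +ℚ c *ℚ (s +ℚ c *ℚ dot (apply M v) v)     ≡⟨ cong (λ a → quad M x +ℚ c *ℚ s +ℚ c *ℚ (s +ℚ c *ℚ a)) (dot-comm (apply M v) v) ⟩
  quad M x +ℚ c *ℚ s +ℚ c *ℚ (s +ℚ c *ℚ quad M v)              ≡⟨ lemma (quad M x) c s (quad M v) ⟩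
  quad M x +ℚ 2ℚ *ℚ c *ℚ s +ℚ c *ℚ c *ℚ quad M v               ∎
  where
  open ≡-Reasoning
  y : Vec n
  y i = x i +ℚ c *ℚ v i
  s = dot (apply M v) x
  expand : ∀ z → dot y z ≡ dot z x +ℚ c *ℚ dot z v
  expand z = trans (dot-comm y z) (dot-linear z x v c)
  lemma : ∀ q c s r → q +ℚ c *ℚ s +ℚ c *ℚ (s +ℚ c *ℚ r) ≡ q +ℚ 2ℚ *ℚ c *ℚ s +ℚ c *ℚ c *ℚ r
  lemma = solve-∀ ℚ-ring

Rep : ∀ {n} → Matrix n → ℚ → Set
Rep M q = ∃[ x ] quad M x ≡ q

-- A nonzero diagonal entry is the value at a basis vector. If the diagonal vanishes, eᵢ + eⱼ has
-- the value 2 Mᵢⱼ.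
anisotropic-vector : ∀ {n} {M : Matrix n} → Symmetric M → (∀ i j → M i j ≡ 0ℚ) ⊎ (∃[ v ] quad M v ≢ 0ℚ)
anisotropic-vector {n} {M} sym-M with Finₚ.any? (λ i → ¬? (M i i ℚProp.≟ 0ℚ))
... | yes (i , Mii≢0) = inj₂ (basis i , λ e → Mii≢0 (trans (sym (quad-basis i)) e))
  where
  quad-basis : ∀ i → quad M (basis i) ≡ M i i
  quad-basis i = trans (dot-comm (basis i) _) (trans (dot-basis (apply M (basis i)) i) (dot-basis (M i) i))
... | no ¬diagonal with Finₚ.any? (λ i → Finₚ.any? λ j → ¬? (M i j ℚProp.≟ 0ℚ))
...   | no ¬entry = inj₁ λ i j → decidable-stable (M i j ℚProp.≟ 0ℚ) (λ ≢0 → ¬entry (i , j , ≢0))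
...   | yes (i , j , Mij≢0) = inj₂ ((λ k → basis i k +ℚ 1ℚ *ℚ basis j k) , λ e →
        *-≢0 {2ℚ} (λ ()) Mij≢0 (trans (sym quad≡) e))
  where
  open ≡-Reasoning
  quad-basis : ∀ i → quad M (basis i) ≡ 0ℚ
  quad-basis i = trans (dot-comm (basis i) _) (trans (dot-basis (apply M (basis i)) i) (trans (dot-basis (M i) i)
    (decidable-stable (M i i ℚProp.≟ 0ℚ) (λ ≢0 → ¬diagonal (i , ≢0)))))
  lemma : ∀ s → 0ℚ +ℚ 2ℚ *ℚ 1ℚ *ℚ s +ℚ 1ℚ *ℚ 1ℚ *ℚ 0ℚ ≡ 2ℚ *ℚ s
  lemma = solve-∀ ℚ-ring
  quad≡ : quad M (λ k → basis i k +ℚ 1ℚ *ℚ basis j k) ≡ 2ℚ *ℚ M i j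
  quad≡ = begin
    quad M (λ k → basis i k +ℚ 1ℚ *ℚ basis j k)                                  ≡⟨ quad-translate sym-M (basis i) (basis j) 1ℚ ⟩
    quad M (basis i) +ℚ 2ℚ *ℚ 1ℚ *ℚ dot (apply M (basis j)) (basis i) +ℚ 1ℚ *ℚ 1ℚ *ℚ quad M (basis j)
      ≡⟨ cong₂ (λ a b → a +ℚ 2ℚ *ℚ 1ℚ *ℚ dot (apply M (basis j)) (basis i) +ℚ 1ℚ *ℚ 1ℚ *ℚ b) (quad-basis i) (quad-basis j) ⟩
    0ℚ +ℚ 2ℚ *ℚ 1ℚ *ℚ dot (apply M (basis j)) (basis i) +ℚ 1ℚ *ℚ 1ℚ *ℚ 0ℚ           ≡⟨ lemma (dot (apply M (basis j)) (basis i)) ⟩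
    2ℚ *ℚ dot (apply M (basis j)) (basis i)                                       ≡⟨ cong (2ℚ *ℚ_) (trans (dot-basis (apply M (basis j)) i) (dot-basis (M i) j)) ⟩
    2ℚ *ℚ M i j                                                                   ∎

-- Completing the square: M = (M v)(M v)ᵀ / d + M′ with d = vᵀMv and M′v = 0.
module CompleteSquare {n} {M : Matrix n} (sym-M : Symmetric M) (v : Vec n) (d≢0 : quad M v ≢ 0ℚ) where

  d i : ℚ
  d = quad M v
  i = proj₁ (inverse d≢0)

  ℓ : Vec n
  ℓ = apply M v

  M′ : Matrix n
  M′ j k = M j k +ℚ -ℚ (i *ℚ ℓ j) *ℚ ℓ k

  sym-M′ : Symmetric M′
  sym-M′ j k = cong₂ _+ℚ_ (sym-M j k) (lemma i (ℓ j) (ℓ k))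
    where
    lemma : ∀ i x y → -ℚ (i *ℚ x) *ℚ y ≡ -ℚ (i *ℚ y) *ℚ x
    lemma = solve-∀ ℚ-ring

  quad-M′ : ∀ x → quad M′ x ≡ quad M x +ℚ -ℚ (i *ℚ dot ℓ x) *ℚ dot ℓ x
  quad-M′ x = begin
    dot x (apply M′ x)                                              ≡⟨ dot-congʳ x (λ j → trans (dot-comm (M′ j) x) (trans (dot-linear x (M j) ℓ (-ℚ (i *ℚ ℓ j)))
                                                                         (cong₂ _+ℚ_ (dot-comm x (M j)) (trans (cong (-ℚ (i *ℚ ℓ j) *ℚ_) (dot-comm x ℓ)) (lemma₁ i (ℓ j) (dot ℓ x)))))) ⟩
    dot x (λ j → apply M x j +ℚ -ℚ (i *ℚ dot ℓ x) *ℚ ℓ j)           ≡⟨ dot-linear x (apply M x) ℓ (-ℚ (i *ℚ dot ℓ x)) ⟩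
    quad M x +ℚ -ℚ (i *ℚ dot ℓ x) *ℚ dot x ℓ                        ≡⟨ cong (λ s → quad M x +ℚ -ℚ (i *ℚ dot ℓ x) *ℚ s) (dot-comm x ℓ) ⟩
    quad M x +ℚ -ℚ (i *ℚ dot ℓ x) *ℚ dot ℓ x                        ∎
    where
    open ≡-Reasoning
    lemma₁ : ∀ i l s → -ℚ (i *ℚ l) *ℚ s ≡ -ℚ (i *ℚ s) *ℚ l
    lemma₁ = solve-∀ ℚ-ring

  -- As M′ v = 0, moving x along v does not change its value under M′. The shift t = c - (ℓ · x) / d
  -- brings ℓ · x to d c, which contributes (d c)² / d = d c².
  Rep-M′ : ∀ {q} c → Rep M′ q → Rep M (d *ℚ (c *ℚ c) +ℚ q)
  Rep-M′ {q} c (x , refl) = (λ j → x j +ℚ t *ℚ v j) , (begin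
    quad M (λ j → x j +ℚ t *ℚ v j)                                 ≡⟨ quad-translate sym-M x v t ⟩
    quad M x +ℚ 2ℚ *ℚ t *ℚ s +ℚ t *ℚ t *ℚ d                        ≡⟨ lemma (quad M x) s d c i ⟩
    d *ℚ (c *ℚ c) +ℚ (quad M x +ℚ -ℚ (i *ℚ s) *ℚ s) +ℚ (d *ℚ i -ℚ 1ℚ) *ℚ (i *ℚ s *ℚ s -ℚ 2ℚ *ℚ c *ℚ s)
      ≡⟨ cong₂ (λ a b → d *ℚ (c *ℚ c) +ℚ a +ℚ (b -ℚ 1ℚ) *ℚ (i *ℚ s *ℚ s -ℚ 2ℚ *ℚ c *ℚ s)) (sym (quad-M′ x)) (proj₂ (inverse d≢0)) ⟩
    d *ℚ (c *ℚ c) +ℚ quad M′ x +ℚ (1ℚ -ℚ 1ℚ) *ℚ (i *ℚ s *ℚ s -ℚ 2ℚ *ℚ c *ℚ s) ≡⟨ lemma₂ (d *ℚ (c *ℚ c) +ℚ quad M′ x) (i *ℚ s *ℚ s -ℚ 2ℚ *ℚ c *ℚ s) ⟩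
    d *ℚ (c *ℚ c) +ℚ quad M′ x                                     ∎)
    where
    open ≡-Reasoning
    s = dot ℓ x
    t = c -ℚ i *ℚ s
    -- An identity valid for arbitrary d and i; the multiple of d i - 1 marks where d i = 1 enters.
    -- The same device serves for 1 / a in the binary case.
    lemma : ∀ q s d c i → q +ℚ 2ℚ *ℚ (c -ℚ i *ℚ s) *ℚ s +ℚ (c -ℚ i *ℚ s) *ℚ (c -ℚ i *ℚ s) *ℚ d ≡
      d *ℚ (c *ℚ c) +ℚ (q +ℚ -ℚ (i *ℚ s) *ℚ s) +ℚ (d *ℚ i -ℚ 1ℚ) *ℚ (i *ℚ s *ℚ s -ℚ 2ℚ *ℚ c *ℚ s)
    lemma = solve-∀ ℚ-ring
    lemma₂ : ∀ a b → a +ℚ (1ℚ -ℚ 1ℚ) *ℚ b ≡ a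
    lemma₂ = solve-∀ ℚ-ring

  entry : ∀ j k → M j k ≡ i *ℚ ℓ j *ℚ ℓ k +ℚ M′ j k
  entry j k = lemma (M j k) (i *ℚ ℓ j) (ℓ k)
    where
    lemma : ∀ m a b → m ≡ a *ℚ b +ℚ (m +ℚ -ℚ a *ℚ b)
    lemma = solve-∀ ℚ-ring

-- One inclusion of value sets, in the direction along which density is inherited.
record DiagonalTernary {n} (M : Matrix n) : Set where
  field
    d₁ d₂ d₃ : ℚ
    d₁≢0     : d₁ ≢ 0ℚ
    d₂≢0     : d₂ ≢ 0ℚ
    d₃≢0     : d₃ ≢ 0ℚ
    rep      : ∀ {q} → Rep₃ d₁ d₂ d₃ q → Rep M q

-- Were the remainder 0 before the third square is split off, M would be a sum of at most two
-- matrices of rank one and its determinant would vanish.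
diagonalTernary : ∀ n {M : Matrix (3 ℕ.+ n)} → Symmetric M → det M ≢ 0ℚ → DiagonalTernary M
diagonalTernary n {M} sym-M det≢0 = [ (λ M≡0 → contradiction (det-rank≤2 n (rank0 M≡0)) det≢0) , (λ (v₁ , d₁≢0) → step₁ v₁ d₁≢0) ]′
  (anisotropic-vector sym-M)
  where
  rank0 : (∀ j k → M j k ≡ 0ℚ) → RankAtMost2 M
  rank0 M≡0 = rank≤2 (λ _ → 0ℚ) (λ _ → 0ℚ) (λ _ → 0ℚ) (λ _ → 0ℚ) M≡0
  module _ (v₁ : Vec (3 ℕ.+ n)) (d₁≢0 : quad M v₁ ≢ 0ℚ) where
    module S₁ = CompleteSquare sym-M v₁ d₁≢0
    rank1 : (∀ j k → S₁.M′ j k ≡ 0ℚ) → RankAtMost2 M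
    rank1 M′≡0 = rank≤2 (λ j → S₁.i *ℚ S₁.ℓ j) (λ _ → 0ℚ) S₁.ℓ (λ _ → 0ℚ)
      λ j k → trans (S₁.entry j k) (cong (S₁.i *ℚ S₁.ℓ j *ℚ S₁.ℓ k +ℚ_) (M′≡0 j k))
    module _ (v₂ : Vec (3 ℕ.+ n)) (d₂≢0 : quad S₁.M′ v₂ ≢ 0ℚ) where
      module S₂ = CompleteSquare S₁.sym-M′ v₂ d₂≢0
      rank2 : (∀ j k → S₂.M′ j k ≡ 0ℚ) → RankAtMost2 M
      rank2 M″≡0 = rank≤2 (λ j → S₁.i *ℚ S₁.ℓ j) (λ j → S₂.i *ℚ S₂.ℓ j) S₁.ℓ S₂.ℓ
        λ j k → trans (S₁.entry j k) (cong (S₁.i *ℚ S₁.ℓ j *ℚ S₁.ℓ k +ℚ_)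
          (trans (S₂.entry j k) (trans (cong (S₂.i *ℚ S₂.ℓ j *ℚ S₂.ℓ k +ℚ_) (M″≡0 j k)) (ℚProp.+-identityʳ _))))
      module _ (v₃ : Vec (3 ℕ.+ n)) (d₃≢0 : quad S₂.M′ v₃ ≢ 0ℚ) where
        module S₃ = CompleteSquare S₂.sym-M′ v₃ d₃≢0
        quad-0 : quad S₃.M′ (λ _ → 0ℚ) ≡ 0ℚ
        quad-0 = trans (dot-comm (λ _ → 0ℚ) (apply S₃.M′ (λ _ → 0ℚ))) (dot-0 (apply S₃.M′ (λ _ → 0ℚ)))
        lemma : ∀ d₁ d₂ d₃ x y z → d₁ *ℚ (x *ℚ x) +ℚ (d₂ *ℚ (y *ℚ y) +ℚ (d₃ *ℚ (z *ℚ z) +ℚ 0ℚ)) ≡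
          d₁ *ℚ (x *ℚ x) +ℚ d₂ *ℚ (y *ℚ y) +ℚ d₃ *ℚ (z *ℚ z)
        lemma = solve-∀ ℚ-ring
        rep : ∀ {q} → Rep₃ S₁.d S₂.d S₃.d q → Rep M q
        rep (rep₃ x y z refl) = subst (Rep M) (lemma S₁.d S₂.d S₃.d x y z)
          (S₁.Rep-M′ x (S₂.Rep-M′ y (S₃.Rep-M′ z ((λ _ → 0ℚ) , quad-0))))
        step₃ : DiagonalTernary M
        step₃ = record { d₁≢0 = d₁≢0 ; d₂≢0 = d₂≢0 ; d₃≢0 = d₃≢0 ; rep = rep }
      step₂ : DiagonalTernary M
      step₂ = [ (λ M″≡0 → contradiction (det-rank≤2 n (rank2 M″≡0)) det≢0) , (λ (v₃ , d₃≢0) → step₃ v₃ d₃≢0) ]′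
        (anisotropic-vector S₂.sym-M′)
    step₁ : DiagonalTernary M
    step₁ = [ (λ M′≡0 → contradiction (det-rank≤2 n (rank1 M′≡0)) det≢0) , (λ (v₂ , d₂≢0) → step₂ v₂ d₂≢0) ]′
      (anisotropic-vector S₁.sym-M′)

-- Integral forms and their Gram matrices.

int-sum : ∀ {n} (f : Fin n → ℤ) → int (sumℤ f) ≡ sumℚ (int ∘ f)
int-sum {zero}  f = refl
int-sum {suc n} f = trans (int-+ (f zero) (sumℤ (f ∘ suc))) (cong (int (f zero) +ℚ_) (int-sum (f ∘ suc)))

/2≡½* : ∀ z → z ℚ./ 2 ≡ ½ *ℚ int z
/2≡½* z = ℚProp.toℚᵘ-injective (begin
  ℚ.toℚᵘ (z ℚ./ 2)              ≈⟨ ℚProp.toℚᵘ-fromℚᵘ (mkℚᵘ z 1) ⟩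
  mkℚᵘ z 1                      ≈⟨ *≡* (lemma z) ⟩
  ℚ.toℚᵘ ½ ℚᵘ.* mkℚᵘ z 0        ≈⟨ ℚᵘₚ.*-congˡ {ℚ.toℚᵘ ½} (toℚᵘ-int z) ⟨
  ℚ.toℚᵘ ½ ℚᵘ.* ℚ.toℚᵘ (int z)  ≈⟨ ℚProp.toℚᵘ-homo-* ½ (int z) ⟨
  ℚ.toℚᵘ (½ *ℚ int z)           ∎)
  where
  open ℚᵘₚ.≃-Reasoning
  lemma : ∀ z → z * + 2 ≡ 1ℤ * z * + 2
  lemma = solve-∀ ℤ-ring

-- The coefficients as an upper triangular matrix U, total in both indices.
upper : ∀ {n} → Homogeneous₂ n → Fin n → Fin n → ℤ
upper P i j with i Finₚ.≤? j
... | yes i≤j = P i j i≤j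
... | no  _   = 0ℤ

-- Names the local function of ⟦_⟧.
terms : ∀ {n} (P : Homogeneous₂ n) (x : Fin n → ℤ) →
  Σ[ f ∈ (Fin n → Fin n → ℤ) ] ⟦_⟧ {n} P x ≡ sumℤ {n} λ i → sumℤ {n} λ j → f i j
terms P x = _ , refl

upper-≤ : ∀ {n} (P : Homogeneous₂ n) i j (i≤j : i Fin.≤ j) → upper P i j ≡ P i j i≤j
upper-≤ P i j i≤j with i Finₚ.≤? j
... | yes _  = refl
... | no i≰j = contradiction i≤j i≰j

upper-≰ : ∀ {n} (P : Homogeneous₂ n) i j → ¬ i Fin.≤ j → upper P i j ≡ 0ℤ
upper-≰ P i j i≰j with i Finₚ.≤? j
... | yes i≤j = contradiction i≤j i≰j
... | no _    = refl

terms-≤ : ∀ {n} (P : Homogeneous₂ n) x i j (i≤j : i Fin.≤ j) → proj₁ (terms P x) i j ≡ P i j i≤j * x i * x j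
terms-≤ P x i j i≤j with i Finₚ.≤? j
... | yes _  = refl
... | no i≰j = contradiction i≤j i≰j

terms-≰ : ∀ {n} (P : Homogeneous₂ n) x i j → ¬ i Fin.≤ j → proj₁ (terms P x) i j ≡ 0ℤ
terms-≰ P x i j i≰j with i Finₚ.≤? j
... | yes i≤j = contradiction i≤j i≰j
... | no _    = refl

terms-upper : ∀ {n} (P : Homogeneous₂ n) x i j → proj₁ (terms P x) i j ≡ upper P i j * x i * x j
terms-upper P x i j = go (i Finₚ.≤? j)
  where
  go : Dec (i Fin.≤ j) → proj₁ (terms P x) i j ≡ upper P i j * x i * x j
  go (yes i≤j) = trans (terms-≤ P x i j i≤j) (cong (λ u → u * x i * x j) (sym (upper-≤ P i j i≤j)))
  go (no i≰j)  = trans (terms-≰ P x i j i≰j) (trans (lemma (x i) (x j)) (cong (λ u → u * x i * x j) (sym (upper-≰ P i j i≰j))))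
    where
    lemma : ∀ x y → 0ℤ ≡ 0ℤ * x * y
    lemma = solve-∀ ℤ-ring

-- The Gram matrix is (U + Uᵀ) / 2; on the diagonal the two halves add up to the coefficient itself.
gram-upper : ∀ {n} (P : Homogeneous₂ n) i j → gram P i j ≡ ½ *ℚ (int (upper P i j) +ℚ int (upper P j i))
gram-upper P i j with Finₚ.<-cmp i j
... | tri< i<j _ _ = trans (/2≡½* c) (cong (½ *ℚ_) (trans (sym (ℚProp.+-identityʳ (int c)))
        (cong₂ (λ a b → int a +ℚ int b) (sym (upper-≤ P i j (ℕₚ.<⇒≤ i<j))) (sym (upper-≰ P j i (ℕₚ.<⇒≱ i<j))))))
  where c = P i j (ℕₚ.<⇒≤ i<j)
... | tri> _ _ j<i = trans (/2≡½* c) (cong (½ *ℚ_) (trans (sym (ℚProp.+-identityˡ (int c)))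
        (cong₂ (λ a b → int a +ℚ int b) (sym (upper-≰ P i j (ℕₚ.<⇒≱ j<i))) (sym (upper-≤ P j i (ℕₚ.<⇒≤ j<i))))))
  where c = P j i (ℕₚ.<⇒≤ j<i)
... | tri≈ _ refl _ = trans (lemma (int (P i i ℕₚ.≤-refl))) (cong (λ a → ½ *ℚ (int a +ℚ int a)) (sym (upper-≤ P i i ℕₚ.≤-refl)))
  where
  lemma : ∀ x → x ≡ ½ *ℚ (x +ℚ x)
  lemma = solve-∀ ℚ-ring

gram-symmetric : ∀ {n} (P : Homogeneous₂ n) → Symmetric (gram P)
gram-symmetric P i j = trans (gram-upper P i j)
  (trans (cong (½ *ℚ_) (ℚProp.+-comm (int (upper P i j)) (int (upper P j i)))) (sym (gram-upper P j i)))

-- Exchanging the two summations replaces U by Uᵀ, so the average of the two expressions is the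
-- value of the Gram matrix.
int-form-gram : ∀ {n} (P : Homogeneous₂ n) x → int (⟦ P ⟧ x) ≡ quad (gram P) (int ∘ x)
int-form-gram {n} P x = begin
  int (⟦ P ⟧ x)                                                 ≡⟨ cong int (proj₂ (terms P x)) ⟩
  int (sumℤ λ i → sumℤ λ j → proj₁ (terms P x) i j)             ≡⟨ int-sum (λ i → sumℤ λ j → proj₁ (terms P x) i j) ⟩
  sumℚ (λ i → int (sumℤ λ j → proj₁ (terms P x) i j))           ≡⟨ sum-cong-≗ (λ i → trans (int-sum (proj₁ (terms P x) i)) (sum-cong-≗ λ j → int-term i j)) ⟩
  S                                                             ≡⟨ halves S ⟩
  ½ *ℚ S +ℚ ½ *ℚ S                                              ≡⟨ cong (λ s → ½ *ℚ S +ℚ ½ *ℚ s) (∑-comm t) ⟩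
  ½ *ℚ S +ℚ ½ *ℚ sumℚ (λ j → sumℚ λ i → t i j)                  ≡⟨ cong₂ _+ℚ_ (*-distribˡ-sum ½ (λ i → sumℚ (t i))) (*-distribˡ-sum ½ (λ j → sumℚ λ i → t i j)) ⟩
  sumℚ (λ i → ½ *ℚ sumℚ (t i)) +ℚ sumℚ (λ i → ½ *ℚ sumℚ (λ j → t j i)) ≡⟨ ∑-distrib-+ (λ i → ½ *ℚ sumℚ (t i)) (λ i → ½ *ℚ sumℚ (λ j → t j i)) ⟨
  sumℚ (λ i → ½ *ℚ sumℚ (t i) +ℚ ½ *ℚ sumℚ (λ j → t j i))       ≡⟨ sum-cong-≗ row ⟩
  quad (gram P) (int ∘ x)                                       ∎
  where
  open ≡-Reasoning
  t : Fin n → Fin n → ℚ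
  t i j = int (upper P i j) *ℚ int (x i) *ℚ int (x j)
  S = sumℚ λ i → sumℚ (t i)
  halves : ∀ s → s ≡ ½ *ℚ s +ℚ ½ *ℚ s
  halves = solve-∀ ℚ-ring
  int-term : ∀ i j → int (proj₁ (terms P x) i j) ≡ t i j
  int-term i j = trans (cong int (terms-upper P x i j))
    (trans (int-* (upper P i j * x i) (x j)) (cong (_*ℚ int (x j)) (int-* (upper P i j) (x i))))
  lemma : ∀ a b u v → ½ *ℚ (a *ℚ u *ℚ v) +ℚ ½ *ℚ (b *ℚ v *ℚ u) ≡ u *ℚ (½ *ℚ (a +ℚ b) *ℚ v)
  lemma = solve-∀ ℚ-ring
  row : ∀ i → ½ *ℚ sumℚ (t i) +ℚ ½ *ℚ sumℚ (λ j → t j i) ≡ int (x i) *ℚ apply (gram P) (int ∘ x) i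
  row i = begin
    ½ *ℚ sumℚ (t i) +ℚ ½ *ℚ sumℚ (λ j → t j i)                  ≡⟨ cong₂ _+ℚ_ (*-distribˡ-sum ½ (t i)) (*-distribˡ-sum ½ (λ j → t j i)) ⟩
    sumℚ (λ j → ½ *ℚ t i j) +ℚ sumℚ (λ j → ½ *ℚ t j i)          ≡⟨ ∑-distrib-+ (λ j → ½ *ℚ t i j) (λ j → ½ *ℚ t j i) ⟨
    sumℚ (λ j → ½ *ℚ t i j +ℚ ½ *ℚ t j i)                       ≡⟨ sum-cong-≗ (λ j → trans (lemma (int (upper P i j)) (int (upper P j i)) (int (x i)) (int (x j)))
                                                                      (cong (λ g → int (x i) *ℚ (g *ℚ int (x j))) (sym (gram-upper P i j)))) ⟩
    sumℚ (λ j → int (x i) *ℚ (gram P i j *ℚ int (x j)))         ≡⟨ *-distribˡ-sum (int (x i)) (λ j → gram P i j *ℚ int (x j)) ⟨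
    int (x i) *ℚ apply (gram P) (int ∘ x) i                     ∎

quad-scale : ∀ {n} (M : Matrix n) c {x y : Vec n} → (∀ i → y i ≡ c *ℚ x i) → quad M y ≡ c *ℚ c *ℚ quad M x
quad-scale M c {x} {y} h = begin
  sumℚ (λ i → y i *ℚ apply M y i)                     ≡⟨ sum-cong-≗ (λ i → cong₂ _*ℚ_ (h i) (trans (sum-cong-≗ λ j → trans (cong (M i j *ℚ_) (h j)) (lemma₁ (M i j) c (x j)))
                                                            (sym (*-distribˡ-sum c (λ j → M i j *ℚ x j))))) ⟩
  sumℚ (λ i → c *ℚ x i *ℚ (c *ℚ apply M x i))         ≡⟨ sum-cong-≗ (λ i → lemma₂ c (x i) (apply M x i)) ⟩
  sumℚ (λ i → c *ℚ c *ℚ (x i *ℚ apply M x i))         ≡⟨ *-distribˡ-sum (c *ℚ c) (λ i → x i *ℚ apply M x i) ⟨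
  c *ℚ c *ℚ quad M x                                  ∎
  where
  open ≡-Reasoning
  lemma₁ : ∀ m c x → m *ℚ (c *ℚ x) ≡ c *ℚ (m *ℚ x)
  lemma₁ = solve-∀ ℚ-ring
  lemma₂ : ∀ c x m → c *ℚ x *ℚ (c *ℚ m) ≡ c *ℚ c *ℚ (x *ℚ m)
  lemma₂ = solve-∀ ℚ-ring

commonDenominator : ∀ {n} (x : Vec n) → ∃[ d ] Σ[ z ∈ (Fin n → ℤ) ] d ≢ 0ℤ × (∀ i → int (z i) ≡ int d *ℚ x i)
commonDenominator {zero}  x = 1ℤ , (λ ()) , (λ ()) , λ ()
commonDenominator {suc n} x =
  let d , z , d≢0 , h = commonDenominator (x ∘ suc)
      e = ↧ x zero
      numerators : Fin (suc n) → ℤ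
      numerators = λ { zero → d * ↥ x zero ; (suc i) → e * z i }
  in d * e , numerators , ℤ-*-≢0 d≢0 (λ ()) , λ
    { zero → trans (int-* d (↥ x zero)) (trans (cong (int d *ℚ_) (sym (fraction (x zero))))
        (trans (lemma₁ (int d) (x zero) (int e)) (cong (_*ℚ x zero) (sym (int-* d e)))))
    ; (suc i) → trans (int-* e (z i)) (trans (cong (int e *ℚ_) (h i))
        (trans (lemma₂ (int e) (int d) (x (suc i))) (cong (_*ℚ x (suc i)) (sym (int-* d e)))))
    }
  where
  lemma₁ : ∀ d x e → d *ℚ (x *ℚ e) ≡ d *ℚ e *ℚ x
  lemma₁ = solve-∀ ℚ-ring
  lemma₂ : ∀ e d x → e *ℚ (d *ℚ x) ≡ d *ℚ e *ℚ x
  lemma₂ = solve-∀ ℚ-ring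

-- Both vectors are multiplied by the same integer D, the product of their common denominators, so
-- both values gain the factor D² and the quotient stays q.
quotient∈R : ∀ {n} (Q : QuadraticForm n) {q a b} → Rep (gram (coeff Q)) a → Rep (gram (coeff Q)) b →
  b ≢ 0ℚ → q *ℚ b ≡ a → R (Values Q) q
quotient∈R {n} Q {q} (x , refl) (y , refl) b≢0 e =
  A , B , (X , refl) , (Y , refl) , B-nonZero , sym (begin
    A *ℚ 1/B                 ≡⟨ cong (_*ℚ 1/B) qB≡A ⟨
    q *ℚ B *ℚ 1/B            ≡⟨ ℚProp.*-assoc q B 1/B ⟩
    q *ℚ (B *ℚ 1/B)          ≡⟨ cong (q *ℚ_) (ℚProp.*-inverseʳ B {{B-nonZero}}) ⟩
    q *ℚ 1ℚ                  ≡⟨ ℚProp.*-identityʳ q ⟩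
    q                        ∎)
  where
  open ≡-Reasoning
  G = gram (coeff Q)
  cx = commonDenominator x
  cy = commonDenominator y
  dx = proj₁ cx
  dy = proj₁ cy
  D = dx * dy
  X Y : Fin n → ℤ
  X i = dy * proj₁ (proj₂ cx) i
  Y i = dx * proj₁ (proj₂ cy) i
  A = int (⟦ coeff Q ⟧ X)
  B = int (⟦ coeff Q ⟧ Y)
  lemma : ∀ a b x → b *ℚ (a *ℚ x) ≡ a *ℚ b *ℚ x
  lemma = solve-∀ ℚ-ring
  A≡ : A ≡ int D *ℚ int D *ℚ quad G x
  A≡ = trans (int-form-gram (coeff Q) X) (quad-scale G (int D) λ i → trans (int-* dy (proj₁ (proj₂ cx) i))
    (trans (cong (int dy *ℚ_) (proj₂ (proj₂ (proj₂ cx)) i)) (trans (lemma (int dx) (int dy) (x i)) (cong (_*ℚ x i) (sym (int-* dx dy))))))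
  B≡ : B ≡ int D *ℚ int D *ℚ quad G y
  B≡ = trans (int-form-gram (coeff Q) Y) (quad-scale G (int D) λ i → trans (int-* dx (proj₁ (proj₂ cy) i))
    (trans (cong (int dx *ℚ_) (proj₂ (proj₂ (proj₂ cy)) i)) (trans (sym (ℚProp.*-assoc (int dx) (int dy) (y i))) (cong (_*ℚ y i) (sym (int-* dx dy))))))
  D≢0 : int D ≢ 0ℚ
  D≢0 = int≢0 (ℤ-*-≢0 (proj₁ (proj₂ (proj₂ cx))) (proj₁ (proj₂ (proj₂ cy))))
  B-nonZero : ℚ.NonZero B
  B-nonZero = ℚ.≢-nonZero (λ B≡0 → *-≢0 (*-≢0 D≢0 D≢0) b≢0 (trans (sym B≡) B≡0))
  1/B = ℚ.1/_ B {{B-nonZero}}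
  lemma₂ : ∀ q c b → q *ℚ (c *ℚ c *ℚ b) ≡ c *ℚ c *ℚ (q *ℚ b)
  lemma₂ = solve-∀ ℚ-ring
  qB≡A : q *ℚ B ≡ A
  qB≡A = trans (cong (q *ℚ_) B≡) (trans (lemma₂ q (int D) (quad G y)) (trans (cong (int D *ℚ int D *ℚ_) e) (sym A≡)))

-- From rational points to ℚₚ.

module Completion (p : ℕ) (p-prime : Prime p) where
  open PAdic p p-prime
  open Density p p-prime

  i≤+∣i∣ : ∀ i → i ℤ.≤ + ∣ i ∣
  i≤+∣i∣ (+ n)      = ℤₚ.≤-refl
  i≤+∣i∣ ℤ.-[1+ n ] = ℤ.-≤+

  ≤⁺-weaken : ∀ {k l m} → k ℤ.≤ l → [ l ] ≤⁺ m → [ k ] ≤⁺ m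
  ≤⁺-weaken k≤l [ l≤m ]    = [ ℤₚ.≤-trans k≤l l≤m ]
  ≤⁺-weaken k≤l (_ ≤⊤⁺)    = _ ≤⊤⁺

  -- A late term of the Cauchy sequence is approximated instead of its limit, and the ultrametric
  -- inequality joins the two errors. A possibly negative k is strengthened to ∣ k ∣.
  Dens⇒Dense : ∀ {n} (Q : QuadraticForm n) → Dens (Rep (gram (coeff Q))) → Dense p (R (Values Q))
  Dens⇒Dense Q dens x k =
    let N , close = cauchy x (+ ∣ k ∣)
        q , _ , _ , wa , wb , b≢0 , e , v = dens (seq x N) ∣ k ∣
    in q , quotient∈R Q wa wb b≢0 e , N , λ m m≥N → ≤⁺-weaken (i≤+∣i∣ k) (V⇒≤ν
         (V-resp (lemma (seq x m) (seq x N) q) (V-+ (≤ν⇒V (close m N m≥N ℕₚ.≤-refl)) v)))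
    where
    lemma : ∀ s t q → s -ℚ t +ℚ (t -ℚ q) ≡ s -ℚ q
    lemma = solve-∀ ℚ-ring

  Dense⇒approximation : ∀ {A} → Dense p A → ∀ r k → ∃[ q ] A q × V k (r -ℚ q)
  Dense⇒approximation dense r k =
    let q , q∈A , N , close = dense (ι r) (+ k)
    in q , q∈A , ≤ν⇒V (close N ℕₚ.≤-refl)

-- Binary forms and their discriminant.

record Binary (a b c q : ℚ) : Set where
  constructor binary
  field
    x y   : ℚ
    value : a *ℚ (x *ℚ x) +ℚ b *ℚ (x *ℚ y) +ℚ c *ℚ (y *ℚ y) ≡ q

disc : (a b c : ℤ) → ℤ
disc a b c = b * b - + 4 * a * c

int-disc : ∀ a b c → int (disc a b c) ≡ int b *ℚ int b -ℚ 4ℚ *ℚ int a *ℚ int c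
int-disc a b c = trans (int-- (b * b) (+ 4 * a * c))
  (cong₂ _-ℚ_ (int-* b b) (trans (int-* (+ 4 * a) c) (cong (_*ℚ int c) (int-* (+ 4) a))))

module _ {P : Homogeneous₂ 2} {a b c : ℤ} (P≐ : P ≐ aX₁²+bX₁X₂+cX₂² a b c) where

  binary-value : ∀ x → ⟦ P ⟧ x ≡ a * (x zero * x zero) + b * (x zero * x (suc zero)) + c * (x (suc zero) * x (suc zero))
  binary-value x = trans (lemma (P zero zero ℕ.z≤n) (P zero (suc zero) ℕ.z≤n) (P (suc zero) (suc zero) (ℕ.s≤s ℕ.z≤n)) (x zero) (x (suc zero)))
    (cong₂ _+_ (cong₂ (λ a b → a * (x zero * x zero) + b * (x zero * x (suc zero))) (P≐ zero zero ℕ.z≤n) (P≐ zero (suc zero) ℕ.z≤n))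
      (cong (_* (x (suc zero) * x (suc zero))) (P≐ (suc zero) (suc zero) (ℕ.s≤s ℕ.z≤n))))
    where
    -- The left side is the unfolded double sum, with a 0 for the position below the diagonal and
    -- one at the end of each sum.
    lemma : ∀ a b c x y → (a * x * x + (b * x * y + 0ℤ)) + ((0ℤ + (c * y * y + 0ℤ)) + 0ℤ) ≡ a * (x * x) + b * (x * y) + c * (y * y)
    lemma = solve-∀ ℤ-ring

  private
    g₀₀ : gram P zero zero ≡ int a
    g₀₀ = cong int (P≐ zero zero ℕ.z≤n)
    g₀₁ : gram P zero (suc zero) ≡ ½ *ℚ int b
    g₀₁ = trans (/2≡½* (P zero (suc zero) ℕ.z≤n)) (cong (λ z → ½ *ℚ int z) (P≐ zero (suc zero) ℕ.z≤n))
    g₁₀ : gram P (suc zero) zero ≡ ½ *ℚ int b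
    g₁₀ = g₀₁
    g₁₁ : gram P (suc zero) (suc zero) ≡ int c
    g₁₁ = cong int (P≐ (suc zero) (suc zero) (ℕ.s≤s ℕ.z≤n))

  Binary⇒Rep : ∀ {q} → Binary (int a) (int b) (int c) q → Rep (gram P) q
  Binary⇒Rep (binary x y refl) = v , trans (lemma (gram P zero zero) (gram P zero (suc zero)) (gram P (suc zero) zero) (gram P (suc zero) (suc zero)) x y)
    (cong₂ _+ℚ_ (cong₂ (λ g h → g *ℚ (x *ℚ x) +ℚ h *ℚ (x *ℚ y)) g₀₀ (trans (cong₂ _+ℚ_ g₀₁ g₁₀) (halves (int b)))) (cong (_*ℚ (y *ℚ y)) g₁₁))
    where
    v : Vec 2
    v zero    = x
    v (suc _) = y
    halves : ∀ b → ½ *ℚ b +ℚ ½ *ℚ b ≡ b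
    halves = solve-∀ ℚ-ring
    lemma : ∀ g₀₀ g₀₁ g₁₀ g₁₁ x y →
      x *ℚ (g₀₀ *ℚ x +ℚ (g₀₁ *ℚ y +ℚ 0ℚ)) +ℚ (y *ℚ (g₁₀ *ℚ x +ℚ (g₁₁ *ℚ y +ℚ 0ℚ)) +ℚ 0ℚ) ≡
      g₀₀ *ℚ (x *ℚ x) +ℚ (g₀₁ +ℚ g₁₀) *ℚ (x *ℚ y) +ℚ g₁₁ *ℚ (y *ℚ y)
    lemma = solve-∀ ℚ-ring

  -- The determinant is a c - b² / 4, so nonsingular means nonzero discriminant.
  det-binary : det (gram P) ≡ -ℚ (¼ *ℚ int (disc a b c))
  det-binary = trans (cong₂ (λ g g′ → g +ℚ (g′ +ℚ 0ℚ)) (cong₂ (λ g h → 1ℚ *ℚ g *ℚ (1ℚ *ℚ h *ℚ 1ℚ +ℚ 0ℚ)) g₀₀ g₁₁)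
      (cong₂ (λ g h → -ℚ 1ℚ *ℚ g *ℚ (1ℚ *ℚ h *ℚ 1ℚ +ℚ 0ℚ)) g₀₁ g₁₀))
    (trans (lemma (int a) (int b) (int c)) (cong (λ d → -ℚ (¼ *ℚ d)) (sym (int-disc a b c))))
    where
    lemma : ∀ a b c → 1ℚ *ℚ a *ℚ (1ℚ *ℚ c *ℚ 1ℚ +ℚ 0ℚ) +ℚ (-ℚ 1ℚ *ℚ (½ *ℚ b) *ℚ (1ℚ *ℚ (½ *ℚ b) *ℚ 1ℚ +ℚ 0ℚ) +ℚ 0ℚ) ≡
      -ℚ (¼ *ℚ (b *ℚ b -ℚ 4ℚ *ℚ a *ℚ c))
    lemma = solve-∀ ℚ-ring

quotient-equation : ∀ {n} {Q : QuadraticForm n} {q} → R (Values Q) q →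
  ∃[ x ] ∃[ y ] ⟦ coeff Q ⟧ y ≢ 0ℤ × q *ℚ int (⟦ coeff Q ⟧ y) ≡ int (⟦ coeff Q ⟧ x)
quotient-equation {n} {Q} (_ , _ , (x , refl) , (y , refl) , B≢0 , refl) =
  x , y , (λ e → ≢0 (cong int e)) ,
  trans (ℚProp.*-assoc A (ℚ.1/_ B {{B≢0}}) B) (trans (cong (A *ℚ_) (ℚProp.*-inverseˡ B {{B≢0}})) (ℚProp.*-identityʳ A))
  where
  A = int (⟦ coeff Q ⟧ x)
  B = int (⟦ coeff Q ⟧ y)
  ≢0 : B ≢ 0ℚ
  ≢0 B≡0 = ℚProp.1≢0 (trans (sym (ℚProp.*-inverseʳ B {{B≢0}})) (trans (cong (_*ℚ ℚ.1/_ B {{B≢0}}) B≡0) (ℚProp.*-zeroˡ (ℚ.1/_ B {{B≢0}}))))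

-- The conditional in the next two lemmas is the unfolding of legendre.
legendre-1⁻ : ∀ {A B : Set} (d : Dec A) (e : Dec B) →
  (if does d then 0ℤ else if does e then 1ℤ else -1ℤ) ≡ 1ℤ → ¬ A × B
legendre-1⁻ (yes _) _       ()
legendre-1⁻ (no ¬a) (yes b) _ = ¬a , b
legendre-1⁻ (no _)  (no _)  ()

legendre-1 : ∀ {A B : Set} (d : Dec A) (e : Dec B) → ¬ A → ¬ ¬ B →
  (if does d then 0ℤ else if does e then 1ℤ else -1ℤ) ≡ 1ℤ
legendre-1 (yes a) _       ¬a _   = contradiction a ¬a
legendre-1 (no _)  (yes _) _  _   = refl
legendre-1 (no _)  (no ¬b) _  ¬¬b = contradiction ¬b ¬¬b

-- The two directions of the equivalence.

module Main (p : ℕ) (p-prime : Prime p) where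
  open PAdic p p-prime
  open Density p p-prime
  open Ternary p p-prime
  open Anisotropy p p-prime
  open Completion p p-prime

  p≡2∨p>2 : p ≡ 2 ⊎ p > 2
  p≡2∨p>2 = [ inj₂ , inj₁ ∘ sym ]′ (ℕₚ.m≤n⇒m<n∨m≡n p>1)

  dense-ternary : ∀ {d₁ d₂ d₃} → d₁ ≢ 0ℚ → d₂ ≢ 0ℚ → d₃ ≢ 0ℚ → Dens (Rep₃ d₁ d₂ d₃)
  dense-ternary = [ even , (λ p>2 → OddPrime.odd-ternary-dense p p-prime p>2) ]′ p≡2∨p>2
    where
    even : p ≡ 2 → ∀ {d₁ d₂ d₃} → d₁ ≢ 0ℚ → d₂ ≢ 0ℚ → d₃ ≢ 0ℚ → Dens (Rep₃ d₁ d₂ d₃)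
    even refl = EvenPrime.even-ternary-dense p-prime

  ramified : ∀ {w} → Unit w → Anisotropic (P * w)
  ramified = [ even , (λ p>2 → OddPrime.anisotropic-ramified p p-prime p>2) ]′ p≡2∨p>2
    where
    even : p ≡ 2 → ∀ {w} → Unit w → Anisotropic (P * w)
    even refl = EvenPrime.anisotropic-ramified p-prime

  SquareConditions : ℤ → Set
  SquareConditions D = 2 ∣ νℤ p D ×
    (p > 2 → legendre p (unitPart p-prime D) ≡ 1ℤ) ×
    (p ≡ 2 → + 8 ∣ℤ (unitPart p-prime D - 1ℤ))

  -- Here D = p^(2m) w, and the condition at p makes w a unit congruent to the square of a unit. It
  -- also yields D ≠ 0, since a unit w is not 0.
  conditions⇒square : ∀ {D} → SquareConditions D → D ≢ 0ℤ × Square (int D)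
  conditions⇒square {D} (ℕ∣.divides m e≡ , odd-condition , even-condition) =
    (λ D≡0 → ℤ-*-≢0 (P^≢0 (νℤ p D)) (Unit⇒≢0 (proj₁ unit-square-w)) (trans (sym (unitPart-eq D)) D≡0)) ,
    subst Square (sym D≡) (Square-scale (int (P ^ m)) (proj₂ unit-square-w))
    where
    w = unitPart p-prime D
    D≡ : int D ≡ int (P ^ m) *ℚ int (P ^ m) *ℚ int w
    D≡ = begin
      int D                                   ≡⟨ cong int (unitPart-eq D) ⟩
      int (P ^ νℤ p D * w)                    ≡⟨ cong (λ e → int (P ^ e * w)) (trans e≡ (trans (ℕₚ.*-comm m 2) (cong (m ℕ.+_) (ℕₚ.+-identityʳ m)))) ⟩
      int (P ^ (m ℕ.+ m) * w)                 ≡⟨ cong (λ K → int (K * w)) (ℤₚ.^-distribˡ-+-* P m m) ⟩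
      int (P ^ m * P ^ m * w)                 ≡⟨ trans (int-* (P ^ m * P ^ m) w) (cong (_*ℚ int w) (int-* (P ^ m) (P ^ m))) ⟩
      int (P ^ m) *ℚ int (P ^ m) *ℚ int w     ∎
      where open ≡-Reasoning
    even : p ≡ 2 → Unit w × Square (int w)
    even refl = M∣⇒Unit EvenPrime-modulus Unit-1 8∣ , unit-square EvenPrime-modulus {w} Unit-1 8∣
      where
      EvenPrime-modulus = EvenPrime.8-modulus p-prime
      8∣ = even-condition refl
    odd : p > 2 → Unit w × Square (int w)
    odd p>2 = go (legendre-1⁻ (P ℤ∣.∣? w) (Finₚ.any? λ x → P ℤ∣.∣? (+ toℕ {p} x * + toℕ x - w)) (odd-condition p>2))
      where
      go : Unit w × (∃[ x ] P ∣ℤ + toℕ {p} x * + toℕ x - w) → Unit w × Square (int w)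
      go (uw , x , d) = uw , unit-square (OddPrime.p-modulus p p-prime p>2) {w} {+ toℕ x}
          (λ P∣x → uw (∣ℤ-sum (ℤ∣.∣n⇒∣m*n (+ toℕ x) P∣x) (ℤ∣.∣m⇒∣-m d) (lemma₁ (+ toℕ x * + toℕ x) w)))
          (∣ℤ-multiple (- 1ℤ) d (lemma₂ (+ toℕ x * + toℕ x) w))
        where
        lemma₁ : ∀ x w → w ≡ x + - (x - w)
        lemma₁ = solve-∀ ℤ-ring
        lemma₂ : ∀ x w → w - x ≡ - 1ℤ * (x - w)
        lemma₂ = solve-∀ ℤ-ring
    unit-square-w : Unit w × Square (int w)
    unit-square-w = [ even , odd ]′ p≡2∨p>2

  -- For a ≠ 0 the identity 4 a Q = (2 a x + b y)² - D y² exhibits Q as a multiple of the norm form.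
  -- For a = 0 one has D = b² ≠ 0, and Q(x, 1) = b x + c takes every rational value.
  binary-dense : ∀ a b c → disc a b c ≢ 0ℤ → Square (int (disc a b c)) → Dens (Binary (int a) (int b) (int c))
  binary-dense a b c D≢0 sq with a ℤₚ.≟ 0ℤ
  ... | no a≢0 = Dens-map (¼ *ℚ i) (*-≢0 {¼} (λ ()) i≢0) f (norm-dense (int≢0 D≢0) sq)
    where
    i = proj₁ (inverse (int≢0 a≢0))
    ai≡1 = proj₂ (inverse (int≢0 a≢0))
    i≢0 : i ≢ 0ℚ
    i≢0 = *-≢0⁻ʳ {int a} (λ e → ℚProp.1≢0 (trans (sym ai≡1) e))
    lemma : ∀ a b c i X Y → let x = ½ *ℚ i *ℚ (X -ℚ b *ℚ Y) in
      a *ℚ (x *ℚ x) +ℚ b *ℚ (x *ℚ Y) +ℚ c *ℚ (Y *ℚ Y) ≡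
      ¼ *ℚ i *ℚ (1ℚ *ℚ (X *ℚ X) +ℚ -ℚ (b *ℚ b -ℚ 4ℚ *ℚ a *ℚ c) *ℚ (Y *ℚ Y)) +ℚ
      (a *ℚ i -ℚ 1ℚ) *ℚ (¼ *ℚ i *ℚ ((X -ℚ b *ℚ Y) *ℚ (X -ℚ b *ℚ Y)) -ℚ c *ℚ (Y *ℚ Y))
    lemma = solve-∀ ℚ-ring
    lemma₂ : ∀ s t → s +ℚ (1ℚ -ℚ 1ℚ) *ℚ t ≡ s
    lemma₂ = solve-∀ ℚ-ring
    f : ∀ {q} → Rep₂ 1ℚ (-ℚ int (disc a b c)) q → Binary (int a) (int b) (int c) (¼ *ℚ i *ℚ q)
    f (rep₂ X Y refl) = binary (½ *ℚ i *ℚ (X -ℚ int b *ℚ Y)) Y (trans (lemma (int a) (int b) (int c) i X Y)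
      (trans (cong₂ (λ D e → ¼ *ℚ i *ℚ (1ℚ *ℚ (X *ℚ X) +ℚ -ℚ D *ℚ (Y *ℚ Y)) +ℚ (e -ℚ 1ℚ) *ℚ t) (sym (int-disc a b c)) ai≡1)
        (lemma₂ (¼ *ℚ i *ℚ (1ℚ *ℚ (X *ℚ X) +ℚ -ℚ int (disc a b c) *ℚ (Y *ℚ Y))) t)))
      where t = ¼ *ℚ i *ℚ ((X -ℚ int b *ℚ Y) *ℚ (X -ℚ int b *ℚ Y)) -ℚ int c *ℚ (Y *ℚ Y)
  ... | yes refl = λ r k → r , r , 1ℚ , everything r , everything 1ℚ , ℚProp.1≢0 , ℚProp.*-identityʳ r ,
      V-resp (sym (ℚProp.+-inverseʳ r)) (V-0 k)
    where
    b≢0 : b ≢ 0ℤ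
    b≢0 refl = D≢0 (lemma c)
      where
      lemma : ∀ c → 0ℤ * 0ℤ - + 4 * 0ℤ * c ≡ 0ℤ
      lemma = solve-∀ ℤ-ring
    i = proj₁ (inverse (int≢0 b≢0))
    bi≡1 = proj₂ (inverse (int≢0 b≢0))
    lemma : ∀ b c i r → let x = i *ℚ (r -ℚ c) in
      0ℚ *ℚ (x *ℚ x) +ℚ b *ℚ (x *ℚ 1ℚ) +ℚ c *ℚ (1ℚ *ℚ 1ℚ) ≡ b *ℚ i *ℚ (r -ℚ c) +ℚ c
    lemma = solve-∀ ℚ-ring
    lemma₂ : ∀ r c → 1ℚ *ℚ (r -ℚ c) +ℚ c ≡ r
    lemma₂ = solve-∀ ℚ-ring
    everything : ∀ r → Binary 0ℚ (int b) (int c) r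
    everything r = binary (i *ℚ (r -ℚ int c)) 1ℚ (trans (lemma (int b) (int c) i r)
      (trans (cong (λ e → e *ℚ (r -ℚ int c) +ℚ int c) bi≡1) (lemma₂ r (int c))))

  -- A common factor p of u, v, z can be cancelled, so descent on |z| reaches a primitive triple.
  anisotropic⇒⊥ : ∀ {D q} ((r , _) : Anisotropic D) → V 3 (int r -ℚ q) →
    ∀ n u v z → ∣ z ∣ ℕ.≤ n → z ≢ 0ℤ → q *ℚ int (z * z) ≡ int (u * u - D * (v * v)) → ⊥
  anisotropic⇒⊥ aniso vq zero u v z ∣z∣≤0 z≢0 _ = z≢0 (ℤₚ.∣i∣≡0⇒i≡0 (ℕₚ.n≤0⇒n≡0 ∣z∣≤0))
  anisotropic⇒⊥ {D} {q} aniso@(r , only) vq (suc n) u v z ∣z∣≤ z≢0 e = descend (only u v z divisible)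
    where
    open ≡-Reasoning
    lemma : ∀ r q z → (r -ℚ q) *ℚ z ≡ r *ℚ z -ℚ q *ℚ z
    lemma = solve-∀ ℚ-ring
    lemmaℤ : ∀ s u w → s - (u - w) ≡ s - u + w
    lemmaℤ = solve-∀ ℤ-ring
    -- By q z² = u² - D v² this integer equals (r - q) z², and r - q lies in p³ ℤ_(p).
    divisible : P ^ 3 ∣ℤ r * (z * z) - u * u + D * (v * v)
    divisible = V-int⁻ (V-resp (begin
      (int r -ℚ q) *ℚ int (z * z)                           ≡⟨ lemma (int r) q (int (z * z)) ⟩
      int r *ℚ int (z * z) -ℚ q *ℚ int (z * z)              ≡⟨ cong₂ _-ℚ_ (sym (int-* r (z * z))) e ⟩
      int (r * (z * z)) -ℚ int (u * u - D * (v * v))        ≡⟨ int-- (r * (z * z)) (u * u - D * (v * v)) ⟨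
      int (r * (z * z) - (u * u - D * (v * v)))             ≡⟨ cong int (lemmaℤ (r * (z * z)) (u * u) (D * (v * v))) ⟩
      int (r * (z * z) - u * u + D * (v * v))               ∎) (V-* vq (V₀-int (z * z))))
    descend : P ∣ℤ u × P ∣ℤ v × P ∣ℤ z → ⊥
    descend (divides u′ refl , divides v′ refl , divides z′ refl) = anisotropic⇒⊥ {D} {q} aniso vq n u′ v′ z′
      (ℕ.s≤s⁻¹ (ℕₚ.<-≤-trans ∣z′∣< ∣z∣≤)) z′≢0
      (*-cancelˡ-ℚ (int≢0 (ℤ-*-≢0 P≢0 P≢0)) (begin
        int (P * P) *ℚ (q *ℚ int (z′ * z′))                 ≡⟨ lemma₁ (int (P * P)) q (int (z′ * z′)) ⟩
        q *ℚ (int (P * P) *ℚ int (z′ * z′))                 ≡⟨ cong (q *ℚ_) (int-* (P * P) (z′ * z′)) ⟨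
        q *ℚ int (P * P * (z′ * z′))                        ≡⟨ cong (λ y → q *ℚ int y) (lemma₂ P z′) ⟩
        q *ℚ int (z′ * P * (z′ * P))                        ≡⟨ e ⟩
        int (u′ * P * (u′ * P) - D * (v′ * P * (v′ * P)))   ≡⟨ cong int (lemma₃ D P u′ v′) ⟩
        int (P * P * (u′ * u′ - D * (v′ * v′)))             ≡⟨ int-* (P * P) (u′ * u′ - D * (v′ * v′)) ⟩
        int (P * P) *ℚ int (u′ * u′ - D * (v′ * v′))        ∎))
      where
      z′≢0 : z′ ≢ 0ℤ
      z′≢0 refl = z≢0 refl
      ∣z′∣< : ∣ z′ ∣ ℕ.< ∣ z′ * P ∣
      ∣z′∣< = subst (∣ z′ ∣ ℕ.<_) (sym (ℤₚ.abs-* z′ P))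
        (ℕₚ.m<m*n ∣ z′ ∣ p {{ℕ.≢-nonZero (z′≢0 ∘ ℤₚ.∣i∣≡0⇒i≡0)}} p>1)
      lemma₁ : ∀ c q z → c *ℚ (q *ℚ z) ≡ q *ℚ (c *ℚ z)
      lemma₁ = solve-∀ ℚ-ring
      lemma₂ : ∀ P z → P * P * (z * z) ≡ z * P * (z * P)
      lemma₂ = solve-∀ ℤ-ring
      lemma₃ : ∀ D P u v → u * P * (u * P) - D * (v * P * (v * P)) ≡ P * P * (u * u - D * (v * v))
      lemma₃ = solve-∀ ℤ-ring

  -- The coefficient cancels, so every quotient is a square x² / y², hence of the form (u² - D v²) /
  -- z² with v = 0. The ramified D = p then excludes density.
  unary-not-dense : ∀ (Q : QuadraticForm 1) → ¬ Dense p (R (Values Q))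
  unary-not-dense Q dense =
    let aniso = ramified Unit-1
        q , q∈ , vq = Dense⇒approximation dense (int (proj₁ aniso)) 3
        x , y , B≢0 , e = quotient-equation {Q = Q} q∈
    in anisotropic⇒⊥ {P * 1ℤ} {q} aniso vq ∣ y zero ∣ (x zero) 0ℤ (y zero) ℕₚ.≤-refl
         (λ y≡0 → B≢0 (trans (value y) (trans (cong (λ t → a * (t * t)) y≡0) (ℤₚ.*-zeroʳ a))))
         (*-cancelˡ-ℚ (a≢0 y B≢0) (equation {q} x y e))
    where
    open ≡-Reasoning
    a = coeff Q zero zero ℕ.z≤n
    value : ∀ x → ⟦ coeff Q ⟧ x ≡ a * (x zero * x zero)
    value x = lemma a (x zero)
      where
      lemma : ∀ a x → a * x * x + 0ℤ + 0ℤ ≡ a * (x * x)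
      lemma = solve-∀ ℤ-ring
    a≢0 : ∀ y → ⟦ coeff Q ⟧ y ≢ 0ℤ → int a ≢ 0ℚ
    a≢0 y B≢0 = int≢0 {a} (λ a≡0 → B≢0 (trans (value y) (trans (cong (_* (y zero * y zero)) a≡0) (ℤₚ.*-zeroˡ (y zero * y zero)))))
    lemma₁ : ∀ a q y → a *ℚ (q *ℚ y) ≡ q *ℚ (a *ℚ y)
    lemma₁ = solve-∀ ℚ-ring
    lemma₂ : ∀ D u → u ≡ u - D * (0ℤ * 0ℤ)
    lemma₂ = solve-∀ ℤ-ring
    equation : ∀ {q} x y → q *ℚ int (⟦ coeff Q ⟧ y) ≡ int (⟦ coeff Q ⟧ x) →
      int a *ℚ (q *ℚ int (y zero * y zero)) ≡ int a *ℚ int (x zero * x zero - P * 1ℤ * (0ℤ * 0ℤ))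
    equation {q} x y e = begin
      int a *ℚ (q *ℚ int (y zero * y zero))      ≡⟨ lemma₁ (int a) q (int (y zero * y zero)) ⟩
      q *ℚ (int a *ℚ int (y zero * y zero))      ≡⟨ cong (q *ℚ_) (trans (cong int (value y)) (int-* a (y zero * y zero))) ⟨
      q *ℚ int (⟦ coeff Q ⟧ y)                   ≡⟨ e ⟩
      int (⟦ coeff Q ⟧ x)                        ≡⟨ trans (cong int (value x)) (int-* a (x zero * x zero)) ⟩
      int a *ℚ int (x zero * x zero)             ≡⟨ cong (λ s → int a *ℚ int s) (lemma₂ (P * 1ℤ) (x zero * x zero)) ⟩
      int a *ℚ int (x zero * x zero - P * 1ℤ * (0ℤ * 0ℤ)) ∎

  module _ (Q : QuadraticForm 2) {a b c : ℤ} (Q≐ : coeff Q ≐ aX₁²+bX₁X₂+cX₂² a b c)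
           (dense : Dense p (R (Values Q))) where

    -- With B(x,y) the polar form of Q and D its discriminant, B(x,y)² - 4 Q(x) Q(y) = D (x₁y₂ - x₂y₁)².
    ¬anisotropic : ∀ m D → disc a b c ≡ P ^ m * P ^ m * D → ¬ Anisotropic D
    ¬anisotropic m D disc≡ aniso =
      let q , q∈ , vq = Dense⇒approximation dense (int (proj₁ aniso)) 3
          x , y , B≢0 , e = quotient-equation {Q = Q} q∈
      -- With q Q(y) = Q(x), the choice z = 2 Q(y) gives q z² = 4 Q(x) Q(y). The square factor
      -- p^(2m) of the discriminant moves into v.
      in anisotropic⇒⊥ {D} {q} aniso vq ∣ + 2 * ⟦ coeff Q ⟧ y ∣ (polar x y) (P ^ m * minor x y) (+ 2 * ⟦ coeff Q ⟧ y) ℕₚ.≤-refl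
           (ℤ-*-≢0 {+ 2} (λ ()) B≢0) (equation {q} x y e)
      where
      open ≡-Reasoning
      polar minor : (Fin 2 → ℤ) → (Fin 2 → ℤ) → ℤ
      polar x y = + 2 * a * x zero * y zero + b * (x zero * y (suc zero) + x (suc zero) * y zero) + + 2 * c * x (suc zero) * y (suc zero)
      minor x y = x zero * y (suc zero) - x (suc zero) * y zero
      lemma₁ : ∀ q b → q *ℚ (4ℚ *ℚ b *ℚ b) ≡ 4ℚ *ℚ (q *ℚ b) *ℚ b
      lemma₁ = solve-∀ ℚ-ring
      lemma₂ : ∀ a b c x₁ x₂ y₁ y₂ →
        let u = + 2 * a * x₁ * y₁ + b * (x₁ * y₂ + x₂ * y₁) + + 2 * c * x₂ * y₂
            v = x₁ * y₂ - x₂ * y₁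
        in + 4 * (a * (x₁ * x₁) + b * (x₁ * x₂) + c * (x₂ * x₂)) * (a * (y₁ * y₁) + b * (y₁ * y₂) + c * (y₂ * y₂)) ≡
           u * u - (b * b - + 4 * a * c) * (v * v)
      lemma₂ = solve-∀ ℤ-ring
      lemma₃ : ∀ K D v → K * K * D * (v * v) ≡ D * (K * v * (K * v))
      lemma₃ = solve-∀ ℤ-ring
      double : ∀ z → + 2 * z * (+ 2 * z) ≡ + 4 * z * z
      double = solve-∀ ℤ-ring
      int-4 : ∀ a b → int (+ 4 * a * b) ≡ 4ℚ *ℚ int a *ℚ int b
      int-4 a b = trans (int-* (+ 4 * a) b) (cong (_*ℚ int b) (int-* (+ 4) a))
      equation : ∀ {q} x y → q *ℚ int (⟦ coeff Q ⟧ y) ≡ int (⟦ coeff Q ⟧ x) →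
        q *ℚ int (+ 2 * ⟦ coeff Q ⟧ y * (+ 2 * ⟦ coeff Q ⟧ y)) ≡
        int (polar x y * polar x y - D * (P ^ m * minor x y * (P ^ m * minor x y)))
      equation {q} x y e = begin
        q *ℚ int (+ 2 * Y * (+ 2 * Y))                ≡⟨ cong (λ s → q *ℚ s) (trans (cong int (double Y)) (int-4 Y Y)) ⟩
        q *ℚ (4ℚ *ℚ int Y *ℚ int Y)                   ≡⟨ lemma₁ q (int Y) ⟩
        4ℚ *ℚ (q *ℚ int Y) *ℚ int Y                   ≡⟨ cong (λ s → 4ℚ *ℚ s *ℚ int Y) e ⟩
        4ℚ *ℚ int X *ℚ int Y                          ≡⟨ int-4 X Y ⟨
        int (+ 4 * X * Y)                             ≡⟨ cong₂ (λ s t → int (+ 4 * s * t)) (binary-value Q≐ x) (binary-value Q≐ y) ⟩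
        int (+ 4 * (a * (x zero * x zero) + b * (x zero * x (suc zero)) + c * (x (suc zero) * x (suc zero))) *
                   (a * (y zero * y zero) + b * (y zero * y (suc zero)) + c * (y (suc zero) * y (suc zero))))
                                                      ≡⟨ cong int (lemma₂ a b c (x zero) (x (suc zero)) (y zero) (y (suc zero))) ⟩
        int (polar x y * polar x y - disc a b c * (minor x y * minor x y))
                                                      ≡⟨ cong (λ s → int (polar x y * polar x y - s)) (trans (cong (_* (minor x y * minor x y)) disc≡) (lemma₃ (P ^ m) D (minor x y))) ⟩
        int (polar x y * polar x y - D * (P ^ m * minor x y * (P ^ m * minor x y))) ∎
        where
        X = ⟦ coeff Q ⟧ x
        Y = ⟦ coeff Q ⟧ y

    -- An odd valuation leaves p w after removal of p^(2m), which is anisotropic. With even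
    -- valuation w is left, anisotropic unless it is a square at p; since that condition is
    -- decidable, refuting its negation is enough.
    dense⇒conditions : disc a b c ≢ 0ℤ → SquareConditions (disc a b c)
    dense⇒conditions D≢0 = go (parity e) refl
      where
      D = disc a b c
      e = νℤ p D
      w = unitPart p-prime D
      uw : Unit w
      uw = unitPart-unit D≢0
      go : ∀ {e′} → Parity e′ → e′ ≡ e → SquareConditions D
      go (1+2* m) e≡ = ⊥-elim (¬anisotropic m (P * w) (begin
        D                               ≡⟨ unitPart-eq D ⟩
        P ^ e * w                       ≡⟨ cong (λ i → P ^ i * w) e≡ ⟨
        P * P ^ (m ℕ.+ m) * w           ≡⟨ cong (λ K → P * K * w) (ℤₚ.^-distribˡ-+-* P m m) ⟩
        P * (P ^ m * P ^ m) * w         ≡⟨ lemma P (P ^ m) w ⟩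
        P ^ m * P ^ m * (P * w)         ∎) (ramified uw))
        where
        open ≡-Reasoning
        lemma : ∀ P K w → P * (K * K) * w ≡ K * K * (P * w)
        lemma = solve-∀ ℤ-ring
      go (2* m) e≡ =
        ℕ∣.divides m (trans (sym e≡) (trans (cong (m ℕ.+_) (sym (ℕₚ.+-identityʳ m))) (ℕₚ.*-comm 2 m))) ,
        (λ p>2 → legendre-1 (P ℤ∣.∣? w) (Finₚ.any? λ x → P ℤ∣.∣? (+ toℕ {p} x * + toℕ x - w)) uw
          (λ nonresidue → ¬w (OddPrime.anisotropic-inert p p-prime p>2 nonresidue))) ,
        even-case
        where
        ¬w : ¬ Anisotropic w
        ¬w = ¬anisotropic m w (trans (unitPart-eq D) (cong (_* w) (trans (cong (P ^_) (sym e≡)) (ℤₚ.^-distribˡ-+-* P m m))))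
        even-case : p ≡ 2 → + 8 ∣ℤ w - 1ℤ
        even-case refl = decidable-stable (+ 8 ℤ∣.∣? (w - 1ℤ)) (λ 8∤ → ¬w (EvenPrime.anisotropic-inert p-prime uw 8∤))

theorem1 : (p : ℕ) (p-prime : Prime p) (n : ℕ) → n ≥ 1 →
    (Q : QuadraticForm n) → Nonsingular Q →
    Dense p (R (Values Q)) ⇔
    (n ≥ 3 ⊎
     (Σ[ n≡2 ∈ n ≡ 2 ] ∃[ a ] ∃[ b ] ∃[ c ]
       (subst Homogeneous₂ n≡2 (coeff Q) ≐ aX₁²+bX₁X₂+cX₂² a b c) ×
       (let D = b * b - + 4 * a * c in
         2 ∣ νℤ p D ×
         (p > 2 → legendre p (unitPart p-prime D) ≡ 1ℤ) ×
         (p ≡ 2 → + 8 ∣ℤ (unitPart p-prime D - 1ℤ)))))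
theorem1 p p-prime n n≥1 Q nonsingular = mk⇔ (necessary n n≥1 Q nonsingular) (sufficient n Q nonsingular)
  where
  open Density p p-prime using (Dens-⊆)
  open Completion p p-prime
  open Main p p-prime

  Condition : (n : ℕ) → QuadraticForm n → Set
  Condition n Q = n ≥ 3 ⊎ (Σ[ n≡2 ∈ n ≡ 2 ] ∃[ a ] ∃[ b ] ∃[ c ]
    (subst Homogeneous₂ n≡2 (coeff Q) ≐ aX₁²+bX₁X₂+cX₂² a b c) × SquareConditions (disc a b c))

  necessary : ∀ n → n ≥ 1 → (Q : QuadraticForm n) → Nonsingular Q → Dense p (R (Values Q)) → Condition n Q
  necessary 1 _ Q _ dense = ⊥-elim (unary-not-dense Q dense)
  necessary 2 _ Q nonsingular dense = inj₂ (refl , a , b , c , Q≐ ,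
    dense⇒conditions Q Q≐ dense (λ D≡0 → nonsingular (trans (det-binary Q≐) (cong (λ D → -ℚ (¼ *ℚ int D)) D≡0))))
    where
    a = coeff Q zero zero ℕ.z≤n
    b = coeff Q zero (suc zero) ℕ.z≤n
    c = coeff Q (suc zero) (suc zero) (ℕ.s≤s ℕ.z≤n)
    Q≐ : coeff Q ≐ aX₁²+bX₁X₂+cX₂² a b c
    Q≐ zero       zero       _ = refl
    Q≐ zero       (suc zero) _ = refl
    Q≐ (suc zero) (suc zero) _ = refl
  necessary (suc (suc (suc n))) _ _ _ _ = inj₁ (ℕ.s≤s (ℕ.s≤s (ℕ.s≤s ℕ.z≤n)))

  sufficient : ∀ n (Q : QuadraticForm n) → Nonsingular Q → Condition n Q → Dense p (R (Values Q))
  sufficient (suc (suc (suc n))) Q nonsingular (inj₁ _) =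
    Dens⇒Dense Q (Dens-⊆ rep (dense-ternary d₁≢0 d₂≢0 d₃≢0))
    where open DiagonalTernary (diagonalTernary n (gram-symmetric (coeff Q)) nonsingular)
  sufficient 1 _ _ (inj₁ (ℕ.s≤s ()))
  sufficient 2 _ _ (inj₁ (ℕ.s≤s (ℕ.s≤s ())))
  sufficient n Q _ (inj₂ (refl , a , b , c , Q≐ , conditions)) =
    let D≢0 , square = conditions⇒square conditions
    in Dens⇒Dense Q (Dens-⊆ (Binary⇒Rep Q≐) (binary-dense a b c D≢0 square))
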